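{- Let $\phi$ be an odd set composition of $[n]$. Then $$\Delta^\circ(\boldsymbol\eta_\phi)=\sum_{\psi\le\phi}\mathbf M_\psi\otimes\Bigg(\sum_{\substack{\chi\le\xi\text{ for some }\xi\in\mathscr C_\phi^\psi\\ \chi\text{ odd}}}C_\chi^{\phi\psi}\,\boldsymbol\eta_\chi\Bigg),$$ where $\psi$ runs over set compositions of $[n]$ with $\psi\le\phi$ and $\chi$ over odd set compositions of $[n]$. In particular, $\mathrm{NC}\Pi$ is a left co-ideal of $\mathrm{NCQSym}$ under the internal coproduct, i.e. $\Delta^\circ(\mathrm{NC}\Pi)\subseteq\mathrm{NCQSym}\otimes\mathrm{NC}\Pi$.
   Context: Let $\mathbf x_1,\mathbf x_2,\dots$ be noncommuting variables over $\mathbb Q$, $[m]=\{1,\dots,m\}$. A set composition $\phi=\phi_1|\cdots|\phi_{\ell(\phi)}$ of $[n]$ is a sequence of disjoint nonempty sets with union $[n]$; it is odd if all blocks have odd size. $\psi\le\phi$ means each block of $\psi$ is a union of consecutive blocks of $\phi$. $\psi\wedge\chi$ is obtained from $\psi_1\cap\chi_1,\psi_1\cap\chi_2,\dots,\psi_{\ell(\psi)}\cap\chi_{\ell(\chi)}$ (lexicographic order) by deleting empty sets. $\mathbf M_\phi=\sum\mathbf x_{i_1}\cdots\mathbf x_{i_n}$ over tuples of positive integers with $i_j=i_k$ iff $j,k$ in the same block and $i_j<i_k$ iff the block of $j$ is left of that of $k$; $\mathrm{NCQSym}=\mathrm{span}\{\mathbf M_\phi\}$. The internal coproduct is the linear map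 $\Delta^\circ:\mathrm{NCQSym}\to\mathrm{NCQSym}\otimes\mathrm{NCQSym}$ with $\Delta^\circ(\mathbf M_\phi)=\sum_{\psi\wedge\varphi=\phi}\mathbf M_\psi\otimes\mathbf M_\varphi$. For odd $\phi$ of $[n]$, $p(\phi)=(n-\ell(\phi))/2$ and $\boldsymbol\eta_\phi=(-1)^{p(\phi)}\sum_{\psi\le\phi}2^{\ell(\psi)}\mathbf M_\psi$. $\mathscr C_\phi^\psi=\{\phi_{\tau(1)}|\cdots|\phi_{\tau(\ell(\phi))}:\tau\in\mathfrak S_{\ell(\phi)},\ \psi\wedge(\phi_{\tau(1)}|\cdots|\phi_{\tau(\ell(\phi))})=\phi\}$. Let $\mu$ be the Möbius function of the poset of odd set compositions of $[n]$ under $\le$. For odd $\chi$ with $\chi\le\xi$ for some $\xi\in\mathscr C_\phi^\psi$, $C_\chi^{\phi\psi}=(-1)^{p(\chi)+p(\phi)}\sum_{\zeta}\mu(\chi,\zeta)2^{\ell(\psi\wedge\zeta)-\ell(\zeta)}$, summed over odd set compositions $\zeta$ with $\chi\le\zeta\le\xi$ for some $\xi\in\mathscr C_\phi^\psi$. $\mathrm{NC}\Pi$ is the span of all $\mathbf K_{(P,\gamma,\sigma)}=\sum_f\mathbf x_{|f(\sigma^{ -1}(1))|}\cdots\mathbf x_{|f(\sigma^{ -1}(n))|}$, where $P$ is a poset on an $n$-set $X$, $\gamma,\sigma:X\to[n]$ bijections, and $f$ ranges over maps $X\to\mathbb Z\setminus\{0\}$ such that for $a\le b$: $f(a)\preceq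 f(b)$ in the order $-1\prec1\prec-2\prec2\prec\cdots$, $f(a)=f(b)>0\Rightarrow\gamma(a)<\gamma(b)$, $f(a)=f(b)<0\Rightarrow\gamma(a)>\gamma(b)$; the $\boldsymbol\eta_\phi$ ($\phi$ odd) lie in $\mathrm{NC}\Pi$ and form a basis of it. -}

module Defs where

open import Data.Bool using (Bool; true; false; if_then_else_; _∧_; _∨_; not; T)
open import Data.Nat as ℕ using (ℕ; zero; suc; _≡ᵇ_; _<ᵇ_; _≤ᵇ_; _∸_; _/_; _%_)
open import Data.Fin using (Fin)
open import Data.Fin.Properties using () renaming (all? to allFin?)
open import Data.List using (List; []; _∷_; [_]; map; concatMap; filterᵇ; length; upTo; allFin; foldr)
open import Data.Vec using (Vec; []; _∷_; lookup)
open import Data.Integer using (+_)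
open import Data.Rational using (ℚ; 0ℚ; 1ℚ; _+_; _*_; -_) renaming (_/_ to _÷ℚ_)
open import Data.Product using (Σ; _×_; _,_)
open import Relation.Binary.PropositionalEquality using (_≡_)

anyL : {A : Set} → (A → Bool) → List A → Bool
anyL p = foldr (λ x b → p x ∨ b) false

allL : {A : Set} → (A → Bool) → List A → Bool
allL p = foldr (λ x b → p x ∧ b) true

countL : {A : Set} → (A → Bool) → List A → ℕ
countL p xs = length (filterᵇ p xs)

sumℚ : {A : Set} → List A → (A → ℚ) → ℚ
sumℚ xs f = foldr (λ x s → f x + s) 0ℚ xs

powℚ : ℚ → ℕ → ℚ
powℚ q zero = 1ℚ
powℚ q (suc k) = q * powℚ q k

signℚ : ℕ → ℚ
signℚ zero = 1ℚ
signℚ (suc k) = - signℚ k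

two^[_-_] : ℕ → ℕ → ℚ
two^[ a - b ] = powℚ (+ 2 ÷ℚ 1) a * powℚ (+ 1 ÷ℚ 2) b

-- Words of length n over ℕ.  A set composition φ = φ₁|…|φₗ of [n] is
-- encoded by its "packed word": the vector w with w_i = j - 1 iff i ∈ φ_j
-- (blocks indexed from 0).  A word is packed iff its set of values is
-- {0,…,ℓ-1} for some ℓ, i.e. downward closed.

Word : ℕ → Set
Word n = Vec ℕ n

module _ {n : ℕ} where

  _at_ : Word n → Fin n → ℕ
  w at i = lookup w i

  occurs : ℕ → Word n → Bool
  occurs k w = anyL (λ i → (w at i) ≡ᵇ k) (allFin n)

  packedᵇ : Word n → Bool
  packedᵇ w = allL (λ i → allL (λ k → occurs k w) (upTo (w at i))) (allFin n)

  wordEqᵇ : Word n → Word n → Bool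
  wordEqᵇ u v = allL (λ i → (u at i) ≡ᵇ (v at i)) (allFin n)

  len : Word n → ℕ
  len w = countL (λ k → occurs k w) (upTo n)

  blockSize : Word n → ℕ → ℕ
  blockSize w k = countL (λ i → (w at i) ≡ᵇ k) (allFin n)

  oddᵇ : Word n → Bool
  oddᵇ w = allL (λ k → (blockSize w k % 2) ≡ᵇ 1) (upTo (len w))

  pp : Word n → ℕ
  pp w = (n ∸ len w) / 2

  -- ψ ≤ φ : each block of ψ is a union of consecutive blocks of φ
  -- (in order): elements in a common φ-block lie in a common ψ-block,
  -- and the ψ-blocks respect the order of the φ-blocks.
  _≼ᵇ_ : Word n → Word n → Bool
  ψ ≼ᵇ φ = allL (λ i → allL (λ j →
             (not ((φ at i) ≡ᵇ (φ at j)) ∨ ((ψ at i) ≡ᵇ (ψ at j))) ∧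
             (not ((φ at i) <ᵇ (φ at j)) ∨ ((ψ at i) ≤ᵇ (ψ at j))))
             (allFin n)) (allFin n)

  lexLtᵇ : ℕ × ℕ → ℕ × ℕ → Bool
  lexLtᵇ (a , b) (c , d) = (a <ᵇ c) ∨ ((a ≡ᵇ c) ∧ (b <ᵇ d))

  pairEqᵇ : ℕ × ℕ → ℕ × ℕ → Bool
  pairEqᵇ (a , b) (c , d) = (a ≡ᵇ c) ∧ (b ≡ᵇ d)

  -- ψ ∧ χ : blocks ψ_a ∩ χ_b in lexicographic order of (a , b), empty
  -- ones deleted.  Element i lies in ψ_a ∩ χ_b with (a , b) = key i; its
  -- block index is the number of nonempty intersections preceding it,
  -- i.e. the number of distinct keys lexicographically below key i.
  meet : Word n → Word n → Word n
  meet ψ χ = Data.Vec.tabulate λ i →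
    countL (λ k → lexLtᵇ k (key i)) distinctKeys
    where
      key : Fin n → ℕ × ℕ
      key i = (ψ at i , χ at i)
      keysUpTo : List (Fin n) → List (ℕ × ℕ)
      keysUpTo [] = []
      keysUpTo (i ∷ is) = let ks = keysUpTo is in
        if anyL (pairEqᵇ (key i)) ks then ks else key i ∷ ks
      distinctKeys : List (ℕ × ℕ)
      distinctKeys = keysUpTo (allFin n)

  -- ξ is a rearrangement φ_{τ(1)}|…|φ_{τ(ℓ)} of the blocks of φ:
  -- ξ has exactly the same blocks (as sets) as φ.
  rearrᵇ : Word n → Word n → Bool
  rearrᵇ φ ξ = allL (λ i → allL (λ j →
                 ((φ at i) ≡ᵇ (φ at j)) ∧ ((ξ at i) ≡ᵇ (ξ at j)) ∨
                 not ((φ at i) ≡ᵇ (φ at j)) ∧ not ((ξ at i) ≡ᵇ (ξ at j)))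
                 (allFin n)) (allFin n)

words : ℕ → (n : ℕ) → List (Word n)
words k zero = [ [] ]
words k (suc n) = concatMap (λ v → map (_∷ v) (upTo k)) (words k n)

-- all set compositions of [n] (as packed words; entries are < n)
SC : (n : ℕ) → List (Word n)
SC n = filterᵇ packedᵇ (words n n)

OddSC : (n : ℕ) → List (Word n)
OddSC n = filterᵇ oddᵇ (SC n)

module _ {n : ℕ} where

  inCᵇ : Word n → Word n → Word n → Bool
  inCᵇ φ ψ ξ = rearrᵇ φ ξ ∧ wordEqᵇ (meet ψ ξ) φ

  belowCᵇ : Word n → Word n → Word n → Bool
  belowCᵇ φ ψ χ = anyL (λ ξ → inCᵇ φ ψ ξ ∧ (χ ≼ᵇ ξ)) (SC n)

  -- Möbius function of the poset of odd set compositions of [n] under ≤,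
  -- by the recursion μ(x,x) = 1, μ(x,y) = - Σ_{x ≤ z < y} μ(x,z) for x < y,
  -- μ(x,y) = 0 otherwise.  The fuel argument is only for termination:
  -- z < y forces len z < len y, so fuel suc (len y) always suffices.
  μ-fuel : ℕ → Word n → Word n → ℚ
  μ-fuel zero x y = 0ℚ
  μ-fuel (suc f) x y =
    if wordEqᵇ x y then 1ℚ
    else if x ≼ᵇ y then
      - sumℚ (filterᵇ (λ z → (x ≼ᵇ z) ∧ (z ≼ᵇ y) ∧ not (wordEqᵇ z y)) (OddSC n))
             (λ z → μ-fuel f x z)
    else 0ℚ

  μ : Word n → Word n → ℚ
  μ x y = μ-fuel (suc (len y)) x y

  Ccoef : Word n → Word n → Word n → ℚ
  Ccoef χ φ ψ = signℚ (pp χ ℕ.+ pp φ) *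
    sumℚ (filterᵇ (λ ζ → (χ ≼ᵇ ζ) ∧ belowCᵇ φ ψ ζ) (OddSC n))
         (λ ζ → μ χ ζ * two^[ len (meet ψ ζ) - len ζ ])

-- NCQSym in degree n, in the basis (𝐌_φ): an element is its coefficient
-- function (only the values at set compositions are relevant).
-- NCQSym_n ⊗ NCQSym_n is described likewise in the basis 𝐌_ψ ⊗ 𝐌_φ.

NCQ : ℕ → Set
NCQ n = Word n → ℚ

NCQ² : ℕ → Set
NCQ² n = Word n → Word n → ℚ

module _ {n : ℕ} where

  𝐌 : Word n → NCQ n
  𝐌 φ α = if wordEqᵇ α φ then 1ℚ else 0ℚ

  _⊗_ : NCQ n → NCQ n → NCQ² n
  (u ⊗ v) α β = u α * v β

  lincomb : List (Word n) → (Word n → ℚ) → (Word n → NCQ n) → NCQ n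
  lincomb xs c v α = sumℚ xs (λ x → c x * v x α)

  lincomb² : List (Word n) → (Word n → ℚ) → (Word n → NCQ² n) → NCQ² n
  lincomb² xs c v α β = sumℚ xs (λ x → c x * v x α β)

  Δ∘𝐌 : Word n → NCQ² n
  Δ∘𝐌 φ α β = sumℚ (SC n) (λ ψ → sumℚ (SC n) (λ ϑ →
                 if wordEqᵇ (meet ψ ϑ) φ then (𝐌 ψ ⊗ 𝐌 ϑ) α β else 0ℚ))

  Δ∘ : NCQ n → NCQ² n
  Δ∘ x = lincomb² (SC n) x Δ∘𝐌

  𝛈 : Word n → NCQ n
  𝛈 φ α = signℚ (pp φ) * lincomb (filterᵇ (λ ψ → ψ ≼ᵇ φ) (SC n))
                                 (λ ψ → powℚ (+ 2 ÷ℚ 1) (len ψ)) 𝐌 α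

  InNCΠ : NCQ n → Set
  InNCΠ x = Σ (Word n → ℚ) λ c → (∀ α → x α ≡ lincomb (OddSC n) c 𝛈 α)

  InNCQ⊗NCΠ : NCQ² n → Set
  InNCQ⊗NCΠ T = Σ (Word n → NCQ n) λ w → ((∀ α → InNCΠ (w α)) ×
                 (∀ α β → T α β ≡ sumℚ (SC n) (λ γ → (𝐌 γ ⊗ w γ) α β)))

-- Write W(β) = [α∧β ≤ φ] 2^ℓ(α∧β) for the coefficient of 𝐌_α ⊗ 𝐌_β in Δ°(𝛈_φ) (up to sign), and
-- R(β) for the corresponding coefficient on the right.  If β is odd then W(β) = R(β) is Möbius
-- inversion, because χ lies below some ξ ∈ 𝒞_φ^ψ exactly when ψ∧χ ≤ φ.  If β has a block B of even
-- size, use the cancellation property of peak functions (setting two consecutive variables to t and -t):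
--   Σ_s (-1)^|s| F(β∧s) = 0,  s running over the {0,1}-words supported on B.
-- It holds for F = W and F = R; the two trivial splittings contribute 2 F(β) and the others only F on
-- longer set compositions, so W(β) = R(β) follows by downward induction on ℓ(β).
-- To prove the cancellation, restrict to one block K of α∧β inside B.  If s is compatible with φ, it is
-- monotone along the blocks of φ in K, and the number of values of s on K equals the number of blocks
-- of φ in K which can be toggled in s; toggling a block of odd size reverses the sign.

module Submission where

open import Defs
open import Data.Bool using (Bool; true; false; if_then_else_; _∧_; _∨_; not; T; T?)
open import Data.Bool.Properties using (T-∧; T-∨)
open import Data.Empty using (⊥-elim)
open import Data.Fin as Fin using (Fin; toℕ)
import Data.Fin.Properties as Fin
open import Data.Integer using () renaming (+_ to pos)
open import Data.List as List using (List; []; _∷_; filterᵇ; length; upTo; allFin; map; concatMap)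
import Data.List.Properties as List
open import Data.List.Membership.Propositional using (_∈_)
open import Data.List.Membership.Propositional.Properties
  using (∈-upTo⁺; ∈-upTo⁻; ∈-allFin; ∈-filter⁺; ∈-filter⁻; ∈-map⁻; ∈-map⁺; ∈-concatMap⁻; ∈-concatMap⁺)
open import Data.List.Relation.Unary.Any as Any using (here; there)
open import Data.List.Relation.Unary.All as All using (All; []; _∷_)
open import Data.List.Relation.Unary.AllPairs using ([]; _∷_)
open import Data.List.Relation.Unary.Unique.Propositional using (Unique)
open import Data.List.Relation.Unary.Unique.Propositional.Properties using (upTo⁺; allFin⁺)
open import Data.Nat as ℕ using (ℕ; zero; suc; _≡ᵇ_; _<ᵇ_; _≤ᵇ_; _∸_; _%_; _≤_; _<_; z≤n; s≤s)
import Data.Nat.Properties as ℕ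
open import Data.Nat.ListAction using (sum)
open import Algebra.Properties.CommutativeSemigroup ℕ.+-commutativeSemigroup using (x∙yz≈y∙xz)
open import Data.Product using (∃; _×_; _,_; proj₁; proj₂; swap)
open import Data.Rational using (ℚ; 0ℚ; 1ℚ; _+_; _*_; -_; _-_; ½) renaming (_/_ to _÷ℚ_)
import Data.Rational.Properties as ℚ
open import Data.Sum using (_⊎_; inj₁; inj₂; [_,_]′)
open import Data.Unit using (tt)
open import Data.Vec using ([]; _∷_; lookup; tabulate)
open import Data.Vec.Properties using (lookup∘tabulate; tabulate∘lookup; tabulate-cong)
open import Function using (_∘_; id; Equivalence)
open import Relation.Binary.PropositionalEquality
  using (_≡_; _≢_; refl; sym; trans; cong; cong₂; subst; subst₂; module ≡-Reasoning)
open import Relation.Nullary using (¬_; yes; no; contradiction)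
open import Relation.Nullary.Decidable using (dec⇒maybe; _×-dec_; ¬?)
open import Relation.Binary.Definitions using (tri<; tri≈; tri>)
open import Tactic.RingSolver using (solve-∀)
open import Tactic.RingSolver.Core.AlmostCommutativeRing using (AlmostCommutativeRing; fromCommutativeRing)
open Equivalence using (to; from)

-- Why one class K suffices: a binary word takes one or two values on K, and 2^k = 2k for k = 1, 2.
-- Hence the factor of K in 2^ℓ(κ∧s) is twice the number of blocks of `φ` in K that can be toggled,
-- while the factors of the other classes are unchanged by a toggle in K. The signed sum becomes a
-- sum over blocks t of `φ` in K, and for fixed t the toggle pairs words of opposite weight. One
-- lemma serves both sides: κ = α∧β gives the relation for W, and κ = β with χ in place of `φ` gives
-- it for each 𝛈_χ occurring in R. The exponent ℓ(ψ∧ζ) - ℓ(ζ) in C has a simple origin: for every χ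
-- ≥ β the coefficient of 𝐌_β in 𝛈_χ has absolute value 2^ℓ(β), and dividing W by this common factor
-- leaves the function to be inverted. Parity enters twice. Odd blocks of `φ` make a toggle reverse
-- the sign. An even B gives the constant words 0 and 1 on B equal signs; for an odd B they would
-- cancel and the relation would say nothing about F(β), so compositions with only odd blocks need
-- Möbius inversion instead.

ℚ-ring : AlmostCommutativeRing _ _
ℚ-ring = fromCommutativeRing ℚ.+-*-commutativeRing (λ q → dec⇒maybe (0ℚ ℚ.≟ q))

-- Reflection of Boolean tests

¬T⇒false : ∀ {b} → ¬ T b → b ≡ false
¬T⇒false {false} _  = refl
¬T⇒false {true}  ¬b = ⊥-elim (¬b tt)

T⇒true : ∀ {b} → T b → b ≡ true
T⇒true {true} _ = refl

T-ext : ∀ {a b} → (T a → T b) → (T b → T a) → a ≡ b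
T-ext {false} {false} _ _ = refl
T-ext {false} {true}  _ g = ⊥-elim (g tt)
T-ext {true}  {false} f _ = ⊥-elim (f tt)
T-ext {true}  {true}  _ _ = refl

T-not⁻ : ∀ {b} → T (not b) → ¬ T b
T-not⁻ {false} _ ()

T-not⁺ : ∀ {b} → ¬ T b → T (not b)
T-not⁺ {false} _  = tt
T-not⁺ {true}  ¬b = ⊥-elim (¬b tt)

module _ {A : Set} {p : A → Bool} where

  allL⁻ : ∀ {xs x} → T (allL p xs) → x ∈ xs → T (p x)
  allL⁻ t (here refl)  = proj₁ (to T-∧ t)
  allL⁻ t (there x∈xs) = allL⁻ (proj₂ (to (T-∧ {p _}) t)) x∈xs

  allL⁺ : ∀ xs → (∀ x → x ∈ xs → T (p x)) → T (allL p xs)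
  allL⁺ []       _ = tt
  allL⁺ (x ∷ xs) h = from T-∧ (h x (here refl) , allL⁺ xs (λ y → h y ∘ there))

  anyL⁻ : ∀ xs → T (anyL p xs) → ∃ λ x → x ∈ xs × T (p x)
  anyL⁻ (x ∷ xs) t with to (T-∨ {p x}) t
  ... | inj₁ px = x , here refl , px
  ... | inj₂ t′ with y , y∈xs , py ← anyL⁻ xs t′ = y , there y∈xs , py

  anyL⁺ : ∀ {xs x} → x ∈ xs → T (p x) → T (anyL p xs)
  anyL⁺ (here refl)  px = from T-∨ (inj₁ px)
  anyL⁺ (there x∈xs) px = from (T-∨ {p _}) (inj₂ (anyL⁺ x∈xs px))

  ∈-filterᵇ⁻ : ∀ {xs x} → x ∈ filterᵇ p xs → x ∈ xs × T (p x)
  ∈-filterᵇ⁻ = ∈-filter⁻ (T? ∘ p)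

  ∈-filterᵇ⁺ : ∀ {xs x} → x ∈ xs → T (p x) → x ∈ filterᵇ p xs
  ∈-filterᵇ⁺ = ∈-filter⁺ (T? ∘ p)

-- Sums

ι : Bool → ℚ
ι b = if b then 1ℚ else 0ℚ

ι-true : ∀ {b} → T b → ι b ≡ 1ℚ
ι-true t = cong ι (T⇒true t)

ι-false : ∀ {b} → ¬ T b → ι b ≡ 0ℚ
ι-false f = cong ι (¬T⇒false f)

ι-cong : ∀ {a b} → (T a → T b) → (T b → T a) → ι a ≡ ι b
ι-cong f g = cong ι (T-ext f g)

ι-∧ : ∀ a b → ι (a ∧ b) ≡ ι a * ι b
ι-∧ true  b = sym (ℚ.*-identityˡ (ι b))
ι-∧ false b = sym (ℚ.*-zeroˡ (ι b))

if-ι : ∀ b x → (if b then x else 0ℚ) ≡ ι b * x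
if-ι true  x = sym (ℚ.*-identityˡ x)
if-ι false x = sym (ℚ.*-zeroˡ x)

ι-*-cong : ∀ b {x y} → (T b → x ≡ y) → ι b * x ≡ ι b * y
ι-*-cong true  h = cong (1ℚ *_) (h tt)
ι-*-cong false {x} {y} _ = trans (ℚ.*-zeroˡ x) (sym (ℚ.*-zeroˡ y))

ι-*-zero : ∀ b {x} → (T b → x ≡ 0ℚ) → ι b * x ≡ 0ℚ
ι-*-zero b h = trans (ι-*-cong b h) (ℚ.*-zeroʳ (ι b))

module _ {A : Set} where

  Σ-cong : ∀ (xs : List A) {f g : A → ℚ} → (∀ x → x ∈ xs → f x ≡ g x) → sumℚ xs f ≡ sumℚ xs g
  Σ-cong []       _ = refl
  Σ-cong (x ∷ xs) h = cong₂ _+_ (h x (here refl)) (Σ-cong xs (λ y → h y ∘ there))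

  Σ-zero : ∀ (xs : List A) {f : A → ℚ} → (∀ x → x ∈ xs → f x ≡ 0ℚ) → sumℚ xs f ≡ 0ℚ
  Σ-zero []       _ = refl
  Σ-zero (x ∷ xs) h = cong₂ _+_ (h x (here refl)) (Σ-zero xs (λ y → h y ∘ there))

  Σ-+ : ∀ (xs : List A) (f g : A → ℚ) → sumℚ xs (λ x → f x + g x) ≡ sumℚ xs f + sumℚ xs g
  Σ-+ []       f g = refl
  Σ-+ (x ∷ xs) f g = trans (cong (f x + g x +_) (Σ-+ xs f g)) (lemma (f x) (g x) (sumℚ xs f) (sumℚ xs g))
    where
    lemma : ∀ a b c d → (a + b) + (c + d) ≡ (a + c) + (b + d)
    lemma = solve-∀ ℚ-ring

  Σ-*ˡ : ∀ (xs : List A) c (f : A → ℚ) → sumℚ xs (λ x → c * f x) ≡ c * sumℚ xs f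
  Σ-*ˡ []       c f = sym (ℚ.*-zeroʳ c)
  Σ-*ˡ (x ∷ xs) c f = trans (cong (c * f x +_) (Σ-*ˡ xs c f)) (sym (ℚ.*-distribˡ-+ c (f x) (sumℚ xs f)))

  Σ-*ʳ : ∀ (xs : List A) c (f : A → ℚ) → sumℚ xs (λ x → f x * c) ≡ sumℚ xs f * c
  Σ-*ʳ xs c f = trans (Σ-cong xs (λ x _ → ℚ.*-comm (f x) c)) (trans (Σ-*ˡ xs c f) (ℚ.*-comm c _))

  Σ-filter : ∀ (p : A → Bool) xs (f : A → ℚ) → sumℚ (filterᵇ p xs) f ≡ sumℚ xs (λ x → ι (p x) * f x)
  Σ-filter p []       f = refl
  Σ-filter p (x ∷ xs) f with p x
  ... | true  = cong₂ _+_ (sym (ℚ.*-identityˡ (f x))) (Σ-filter p xs f)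
  ... | false = trans (Σ-filter p xs f)
    (trans (sym (ℚ.+-identityˡ _)) (cong (_+ sumℚ xs (λ x → ι (p x) * f x)) (sym (ℚ.*-zeroˡ (f x)))))

  Σ-++ : ∀ (xs ys : List A) f → sumℚ (xs List.++ ys) f ≡ sumℚ xs f + sumℚ ys f
  Σ-++ []       ys f = sym (ℚ.+-identityˡ _)
  Σ-++ (x ∷ xs) ys f = trans (cong (f x +_) (Σ-++ xs ys f)) (sym (ℚ.+-assoc (f x) _ _))

  Σ-δ : ∀ {xs a} (e : A → Bool) (f : A → ℚ) → Unique xs → a ∈ xs → T (e a) → (∀ x → T (e x) → x ≡ a) →
    sumℚ xs (λ x → ι (e x) * f x) ≡ f a
  Σ-δ {x ∷ xs} e f (x∉xs ∷ _) (here refl) ea e⇒ =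
    trans (cong₂ _+_ (trans (cong (_* f x) (ι-true ea)) (ℚ.*-identityˡ (f x)))
      (Σ-zero xs (λ y y∈xs → trans (cong (_* f y) (ι-false (λ ey → All.lookup x∉xs y∈xs (sym (e⇒ y ey))))) (ℚ.*-zeroˡ (f y)))))
    (ℚ.+-identityʳ (f x))
  Σ-δ {x ∷ xs} e f (x∉xs ∷ u) (there a∈xs) ea e⇒ =
    trans (cong₂ _+_ (trans (cong (_* f x) (ι-false (λ ex → All.lookup x∉xs a∈xs (e⇒ x ex)))) (ℚ.*-zeroˡ (f x))) (Σ-δ e f u a∈xs ea e⇒))
    (ℚ.+-identityˡ _)

module _ {A B : Set} where

  Σ-map : ∀ (g : A → B) xs (f : B → ℚ) → sumℚ (map g xs) f ≡ sumℚ xs (f ∘ g)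
  Σ-map g []       f = refl
  Σ-map g (x ∷ xs) f = cong (f (g x) +_) (Σ-map g xs f)

  Σ-concatMap : ∀ (g : A → List B) xs (f : B → ℚ) → sumℚ (concatMap g xs) f ≡ sumℚ xs (λ x → sumℚ (g x) f)
  Σ-concatMap g []       f = refl
  Σ-concatMap g (x ∷ xs) f = trans (Σ-++ (g x) (concatMap g xs) f) (cong (sumℚ (g x) f +_) (Σ-concatMap g xs f))

  Σ-swap : ∀ (xs : List A) (ys : List B) (f : A → B → ℚ) →
    sumℚ xs (λ x → sumℚ ys (f x)) ≡ sumℚ ys (λ y → sumℚ xs (λ x → f x y))
  Σ-swap []       ys f = sym (Σ-zero ys (λ _ _ → refl))
  Σ-swap (x ∷ xs) ys f = trans (cong (sumℚ ys (f x) +_) (Σ-swap xs ys f)) (sym (Σ-+ ys (f x) _))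

-- Counting

module _ {A : Set} where

  countL-∷ : ∀ (p : A → Bool) x xs → countL p (x ∷ xs) ≡ (if p x then 1 else 0) ℕ.+ countL p xs
  countL-∷ p x xs with p x
  ... | true  = refl
  ... | false = refl

  countL-cong : ∀ {p q : A → Bool} xs → (∀ x → x ∈ xs → p x ≡ q x) → countL p xs ≡ countL q xs
  countL-cong []       _ = refl
  countL-cong {p} {q} (x ∷ xs) h = begin
    countL p (x ∷ xs)                       ≡⟨ countL-∷ p x xs ⟩
    (if p x then 1 else 0) ℕ.+ countL p xs  ≡⟨ cong₂ (λ b m → (if b then 1 else 0) ℕ.+ m) (h x (here refl)) (countL-cong xs (λ y → h y ∘ there)) ⟩
    (if q x then 1 else 0) ℕ.+ countL q xs  ≡⟨ countL-∷ q x xs ⟨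
    countL q (x ∷ xs)                       ∎
    where open ≡-Reasoning

  countL-none : ∀ {p : A → Bool} xs → (∀ x → x ∈ xs → ¬ T (p x)) → countL p xs ≡ 0
  countL-none []       _ = refl
  countL-none {p} (x ∷ xs) h with p x in eq
  ... | true  = ⊥-elim (h x (here refl) (subst T (sym eq) tt))
  ... | false = countL-none xs (λ y → h y ∘ there)

  countL-pos : ∀ {p : A → Bool} xs → 0 < countL p xs → ∃ λ x → x ∈ xs × T (p x)
  countL-pos {p} (x ∷ xs) 0< with p x in eq
  ... | true  = x , here refl , subst T (sym eq) tt
  ... | false with y , y∈xs , py ← countL-pos xs 0< = y , there y∈xs , py

  countL-≤length : ∀ (p : A → Bool) xs → countL p xs ≤ length xs
  countL-≤length p xs = List.length-filter (T? ∘ p) xs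

  countL-mono : ∀ {p q : A → Bool} xs → (∀ x → x ∈ xs → T (p x) → T (q x)) → countL p xs ≤ countL q xs
  countL-mono []       _ = z≤n
  countL-mono {p} {q} (x ∷ xs) h with p x in eqp | q x in eqq | countL-mono xs (λ y → h y ∘ there)
  ... | true  | true  | r = s≤s r
  ... | true  | false | r = ⊥-elim (subst T eqq (h x (here refl) (subst T (sym eqp) tt)))
  ... | false | true  | r = ℕ.m≤n⇒m≤1+n r
  ... | false | false | r = r

  countL-mono-< : ∀ {p q : A → Bool} {xs a} → (∀ x → x ∈ xs → T (p x) → T (q x)) →
    a ∈ xs → ¬ T (p a) → T (q a) → countL p xs < countL q xs
  countL-mono-< {p} {q} {x ∷ xs} h (here refl) ¬pa qa with p x | q x | countL-mono xs (λ y → h y ∘ there)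
  ... | true  | _     | r = ⊥-elim (¬pa tt)
  ... | false | true  | r = s≤s r
  countL-mono-< {p} {q} {x ∷ xs} h (there a∈xs) ¬pa qa
    with p x in eqp | q x in eqq | countL-mono-< {p} {q} {xs} (λ y → h y ∘ there) a∈xs ¬pa qa
  ... | true  | true  | r = s≤s r
  ... | true  | false | r = ⊥-elim (subst T eqq (h x (here refl) (subst T (sym eqp) tt)))
  ... | false | true  | r = ℕ.m≤n⇒m≤1+n r
  ... | false | false | r = r

  countL-∨ : ∀ (p q : A → Bool) xs → (∀ x → x ∈ xs → T (p x) → ¬ T (q x)) →
    countL (λ x → p x ∨ q x) xs ≡ countL p xs ℕ.+ countL q xs
  countL-∨ p q []       _ = refl
  countL-∨ p q (x ∷ xs) h with p x in eqp | q x in eqq | countL-∨ p q xs (λ y → h y ∘ there)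
  ... | true  | true  | r = ⊥-elim (h x (here refl) (subst T (sym eqp) tt) (subst T (sym eqq) tt))
  ... | true  | false | r = cong suc r
  ... | false | true  | r = trans (cong suc r) (sym (ℕ.+-suc _ _))
  ... | false | false | r = r

  countL-one : ∀ {p : A → Bool} {xs a} → Unique xs → a ∈ xs → T (p a) → (∀ x → x ∈ xs → T (p x) → x ≡ a) →
    countL p xs ≡ 1
  countL-one {p} {x ∷ xs} (x∉xs ∷ _) (here refl) pa p⇒ =
    trans (countL-∷ p x xs) (cong₂ (λ b m → (if b then 1 else 0) ℕ.+ m) (T⇒true pa)
      (countL-none xs (λ y y∈xs py → All.lookup x∉xs y∈xs (sym (p⇒ y (there y∈xs) py)))))
  countL-one {p} {x ∷ xs} (x∉xs ∷ u) (there a∈xs) pa p⇒ =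
    trans (countL-∷ p x xs) (cong₂ (λ b m → (if b then 1 else 0) ℕ.+ m)
      (¬T⇒false (λ px → All.lookup x∉xs a∈xs (p⇒ x (here refl) px))) (countL-one u a∈xs pa (λ y → p⇒ y ∘ there)))

countL-map : ∀ {A B : Set} (f : A → B) (p : B → Bool) xs → countL p (map f xs) ≡ countL (p ∘ f) xs
countL-map f p []       = refl
countL-map f p (x ∷ xs) = trans (countL-∷ p (f x) _)
  (trans (cong ((if p (f x) then 1 else 0) ℕ.+_) (countL-map f p xs)) (sym (countL-∷ (p ∘ f) x xs)))

countL-< : ∀ {m n} → m ≤ n → countL (_<ᵇ m) (upTo n) ≡ m
countL-< {zero}  {n}     _         = countL-none (upTo n) (λ _ _ ())
countL-< {suc m} {suc n} (s≤s m≤n) = cong suc (trans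
  (cong (countL (_<ᵇ suc m)) (sym (List.map-upTo suc n)))
  (trans (countL-map suc (_<ᵇ suc m) (upTo n)) (countL-< m≤n)))

-- Words and set compositions

word-ext : ∀ {n} {u v : Word n} → (∀ i → u at i ≡ v at i) → u ≡ v
word-ext {u = u} {v} h = trans (sym (tabulate∘lookup u)) (trans (tabulate-cong h) (tabulate∘lookup v))

allFin⁻ : ∀ {n} {p : Fin n → Bool} → T (allL p (allFin n)) → ∀ i → T (p i)
allFin⁻ t i = allL⁻ t (∈-allFin i)

allFin⁺ᵇ : ∀ {n} {p : Fin n → Bool} → (∀ i → T (p i)) → T (allL p (allFin n))
allFin⁺ᵇ {n} h = allL⁺ (allFin n) (λ i _ → h i)

anyFin⁻ : ∀ {n} {p : Fin n → Bool} → T (anyL p (allFin n)) → ∃ λ i → T (p i)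
anyFin⁻ {n} t with i , _ , pi ← anyL⁻ (allFin n) t = i , pi

anyFin⁺ : ∀ {n} {p : Fin n → Bool} i → T (p i) → T (anyL p (allFin n))
anyFin⁺ i pi = anyL⁺ (∈-allFin i) pi

module _ {n : ℕ} (u v : Word n) where

  wordEqᵇ⇒≡ : T (wordEqᵇ u v) → u ≡ v
  wordEqᵇ⇒≡ t = word-ext (λ i → ℕ.≡ᵇ⇒≡ _ _ (allFin⁻ {p = λ i → u at i ≡ᵇ v at i} t i))

  ≡⇒wordEqᵇ : u ≡ v → T (wordEqᵇ u v)
  ≡⇒wordEqᵇ refl = allFin⁺ᵇ {p = λ i → u at i ≡ᵇ u at i} (λ i → ℕ.≡⇒≡ᵇ (u at i) _ refl)

∈-words⁻ : ∀ k {n} {w : Word n} → w ∈ words k n → ∀ i → w at i < k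
∈-words⁻ k {suc n} {w} w∈ = go (words k n) (λ _ v∈ → v∈) (∈-concatMap⁻ (λ v → map (_∷ v) (upTo k)) w∈)
  where
  go : ∀ vs → (∀ v → v ∈ vs → v ∈ words k n) → Any.Any (λ v → w ∈ map (_∷ v) (upTo k)) vs → ∀ i → w at i < k
  go (v ∷ vs) h (here w∈v) i with ∈-map⁻ (_∷ v) w∈v
  go (v ∷ vs) h (here w∈v) Fin.zero    | x , x∈ , refl = ∈-upTo⁻ x∈
  go (v ∷ vs) h (here w∈v) (Fin.suc i) | x , x∈ , refl = ∈-words⁻ k (h v (here refl)) i
  go (v ∷ vs) h (there a) i = go vs (λ u → h u ∘ there) a i

∈-words⁺ : ∀ k {n} {w : Word n} → (∀ i → w at i < k) → w ∈ words k n
∈-words⁺ k {w = []}    h = here refl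
∈-words⁺ k {w = x ∷ v} h = ∈-concatMap⁺ (λ v → map (_∷ v) (upTo k))
  (Any.map (λ { refl → ∈-map⁺ (_∷ v) (∈-upTo⁺ (h Fin.zero)) }) (∈-words⁺ k (h ∘ Fin.suc)))

Σ-words-suc : ∀ k n (f : Word (suc n) → ℚ) →
  sumℚ (words k (suc n)) f ≡ sumℚ (words k n) (λ v → sumℚ (upTo k) (λ x → f (x ∷ v)))
Σ-words-suc k n f = trans (Σ-concatMap _ (words k n) f) (Σ-cong (words k n) (λ v _ → Σ-map (_∷ v) (upTo k) f))

-- Induction on the word, one letter at a time, takes the place of a proof that `words k n` has no
-- repetitions.
Σ-words-δ : ∀ k {n} (α : Word n) f → (∀ i → α at i < k) →
  sumℚ (words k n) (λ w → ι (wordEqᵇ α w) * f w) ≡ f α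
Σ-words-δ k []      f _ = trans (ℚ.+-identityʳ _) (ℚ.*-identityˡ (f []))
Σ-words-δ k {suc n} (a ∷ α) f h = begin
  sumℚ (words k (suc n)) (λ w → ι (wordEqᵇ (a ∷ α) w) * f w)
    ≡⟨ Σ-words-suc k n (λ w → ι (wordEqᵇ (a ∷ α) w) * f w) ⟩
  sumℚ (words k n) (λ v → sumℚ (upTo k) (λ x → ι (wordEqᵇ (a ∷ α) (x ∷ v)) * f (x ∷ v)))
    ≡⟨ Σ-cong (words k n) (λ v _ → trans (Σ-cong (upTo k) (λ x _ → split x v)) (Σ-*ˡ (upTo k) (ι (wordEqᵇ α v)) (λ x → ι (a ≡ᵇ x) * f (x ∷ v)))) ⟩
  sumℚ (words k n) (λ v → ι (wordEqᵇ α v) * sumℚ (upTo k) (λ x → ι (a ≡ᵇ x) * f (x ∷ v)))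
    ≡⟨ Σ-words-δ k α (λ v → sumℚ (upTo k) (λ x → ι (a ≡ᵇ x) * f (x ∷ v))) (h ∘ Fin.suc) ⟩
  sumℚ (upTo k) (λ x → ι (a ≡ᵇ x) * f (x ∷ α))
    ≡⟨ Σ-δ (a ≡ᵇ_) (λ x → f (x ∷ α)) (upTo⁺ k) (∈-upTo⁺ (h Fin.zero)) (ℕ.≡⇒≡ᵇ a a refl) (λ x t → sym (ℕ.≡ᵇ⇒≡ a x t)) ⟩
  f (a ∷ α) ∎
  where
  open ≡-Reasoning
  lemma : ∀ b c d → (b * c) * d ≡ c * (b * d)
  lemma = solve-∀ ℚ-ring
  eq-∷ : ∀ x v → ι (wordEqᵇ (a ∷ α) (x ∷ v)) ≡ ι ((a ≡ᵇ x) ∧ wordEqᵇ α v)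
  eq-∷ x v = ι-cong
    (λ t → let e = wordEqᵇ⇒≡ (a ∷ α) (x ∷ v) t in
      from (T-∧ {a ≡ᵇ x}) (ℕ.≡⇒≡ᵇ a x (cong (_at Fin.zero) e) , ≡⇒wordEqᵇ α v (word-ext (λ i → cong (_at (Fin.suc i)) e))))
    (λ t → let t₁ , t₂ = to (T-∧ {a ≡ᵇ x}) t in
      ≡⇒wordEqᵇ (a ∷ α) (x ∷ v) (cong₂ _∷_ (ℕ.≡ᵇ⇒≡ a x t₁) (wordEqᵇ⇒≡ α v t₂)))
  split : ∀ x v → ι (wordEqᵇ (a ∷ α) (x ∷ v)) * f (x ∷ v) ≡ ι (wordEqᵇ α v) * (ι (a ≡ᵇ x) * f (x ∷ v))
  split x v = trans (cong (_* f (x ∷ v)) (trans (eq-∷ x v) (ι-∧ (a ≡ᵇ x) (wordEqᵇ α v))))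
    (lemma (ι (a ≡ᵇ x)) (ι (wordEqᵇ α v)) (f (x ∷ v)))

-- Packed words

record Packed {n : ℕ} (w : Word n) : Set where
  constructor packed
  field preimage : ∀ i k → k < w at i → ∃ λ j → w at j ≡ k

open Packed

module _ {n : ℕ} where

  occurs⁻ : ∀ k (w : Word n) → T (occurs k w) → ∃ λ j → w at j ≡ k
  occurs⁻ k w t with j , e ← anyFin⁻ {p = λ i → w at i ≡ᵇ k} t = j , ℕ.≡ᵇ⇒≡ _ _ e

  occurs⁺ : ∀ {k} (w : Word n) j → w at j ≡ k → T (occurs k w)
  occurs⁺ {k} w j e = anyFin⁺ {p = λ i → w at i ≡ᵇ k} j (ℕ.≡⇒≡ᵇ _ _ e)

  packed⁻ : (w : Word n) → T (packedᵇ w) → Packed w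
  packed⁻ w t .preimage i k k<wi =
    occurs⁻ k w (allL⁻ {p = λ k → occurs k w} (allFin⁻ {p = λ i → allL (λ k → occurs k w) (upTo (w at i))} t i) (∈-upTo⁺ k<wi))

  packed⁺ : (w : Word n) → Packed w → T (packedᵇ w)
  packed⁺ w pk = allFin⁺ᵇ {p = λ i → allL (λ k → occurs k w) (upTo (w at i))} (λ i →
    allL⁺ {p = λ k → occurs k w} (upTo (w at i)) (λ k k∈ → let j , e = pk .preimage i k (∈-upTo⁻ k∈) in occurs⁺ w j e))

  packed-≤ : {w : Word n} → Packed w → ∀ i k → k ≤ w at i → ∃ λ j → w at j ≡ k
  packed-≤ pk i k k≤ with ℕ.m≤n⇒m<n∨m≡n k≤
  ... | inj₁ k< = pk .preimage i k k<
  ... | inj₂ e  = i , sym e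

  -- Pigeonhole: choosing a position for each of the values 0, ..., `w at i` injects them into
  -- `Fin n`.
  packed-< : {w : Word n} → Packed w → ∀ i → w at i < n
  packed-< {w} pk i = Fin.injective⇒≤ {f = f} inj
    where
    at-k : (k : Fin (suc (w at i))) → ∃ λ j → w at j ≡ toℕ k
    at-k k = packed-≤ pk i (toℕ k) (ℕ.≤-pred (Fin.toℕ<n k))
    f : Fin (suc (w at i)) → Fin n
    f k = proj₁ (at-k k)
    inj : ∀ {k l} → f k ≡ f l → k ≡ l
    inj {k} {l} e = Fin.toℕ-injective (trans (sym (proj₂ (at-k k))) (trans (cong (w at_) e) (proj₂ (at-k l))))

  ∈-SC⁻ : {w : Word n} → w ∈ SC n → Packed w
  ∈-SC⁻ {w} w∈ = packed⁻ w (proj₂ (∈-filterᵇ⁻ {p = packedᵇ} {xs = words n n} w∈))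

  ∈-SC⁺ : {w : Word n} → Packed w → w ∈ SC n
  ∈-SC⁺ {w} pk = ∈-filterᵇ⁺ {p = packedᵇ} (∈-words⁺ n (packed-< pk)) (packed⁺ w pk)

  -- Stated for every word because elements of `NCQ n` are functions on all words; a word that is
  -- not packed matches no summand.
  Σ-SC-δ : ∀ α (f : Word n → ℚ) → sumℚ (SC n) (λ w → ι (wordEqᵇ α w) * f w) ≡ ι (packedᵇ α) * f α
  Σ-SC-δ α f with T? (packedᵇ α)
  ... | yes p = begin
    sumℚ (SC n) (λ w → ι (wordEqᵇ α w) * f w)                          ≡⟨ Σ-filter packedᵇ (words n n) (λ w → ι (wordEqᵇ α w) * f w) ⟩
    sumℚ (words n n) (λ w → ι (packedᵇ w) * (ι (wordEqᵇ α w) * f w))   ≡⟨ Σ-cong (words n n) (λ w _ → lemma (ι (packedᵇ w)) (ι (wordEqᵇ α w)) (f w)) ⟩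
    sumℚ (words n n) (λ w → ι (wordEqᵇ α w) * (ι (packedᵇ w) * f w))   ≡⟨ Σ-words-δ n α (λ w → ι (packedᵇ w) * f w) (packed-< (packed⁻ α p)) ⟩
    ι (packedᵇ α) * f α                                                ∎
    where
    open ≡-Reasoning
    lemma : ∀ a b c → a * (b * c) ≡ b * (a * c)
    lemma = solve-∀ ℚ-ring
  ... | no ¬p = trans
    (Σ-zero (SC n) (λ w w∈ → ι-*-zero (wordEqᵇ α w) (λ e → ⊥-elim (¬p (subst (T ∘ packedᵇ) (sym (wordEqᵇ⇒≡ α w e)) (packed⁺ w (∈-SC⁻ w∈)))))))
    (sym (trans (cong (_* f α) (ι-false ¬p)) (ℚ.*-zeroˡ (f α))))

infix 4 _≼_

-- Merges the two clauses of `_≼ᵇ_` into monotonicity: the clause on equal values follows by using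
-- it in both directions. A word is thus treated as a total preorder on positions. The record lets
-- the words be inferred from a proof.
record _≼_ {n : ℕ} (ψ φ : Word n) : Set where
  constructor monotone
  field at-≤ : ∀ i j → φ at i ≤ φ at j → ψ at i ≤ ψ at j

open _≼_

module _ {n : ℕ} (ψ φ : Word n) where

  private
    agree : Fin n → Fin n → Bool
    agree i j = (not ((φ at i) ≡ᵇ (φ at j)) ∨ ((ψ at i) ≡ᵇ (ψ at j)))
              ∧ (not ((φ at i) <ᵇ (φ at j)) ∨ ((ψ at i) ≤ᵇ (ψ at j)))

  ≼⁻ : T (ψ ≼ᵇ φ) → ψ ≼ φ
  ≼⁻ t .at-≤ i j φi≤φj with to (T-∧ {not ((φ at i) ≡ᵇ (φ at j)) ∨ ((ψ at i) ≡ᵇ (ψ at j))}) (allFin⁻ {p = agree i} (allFin⁻ {p = λ i → allL (agree i) (allFin n)} t i) j)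
  ... | t₁ , t₂ with ℕ.m≤n⇒m<n∨m≡n φi≤φj
  ... | inj₁ φi<φj with to (T-∨ {not ((φ at i) <ᵇ (φ at j))}) t₂
  ...   | inj₁ ¬φi<φj = ⊥-elim (T-not⁻ ¬φi<φj (ℕ.<⇒<ᵇ φi<φj))
  ...   | inj₂ ψi≤ψj  = ℕ.≤ᵇ⇒≤ _ _ ψi≤ψj
  ≼⁻ t .at-≤ i j φi≤φj | t₁ , t₂ | inj₂ φi≡φj with to (T-∨ {not ((φ at i) ≡ᵇ (φ at j))}) t₁
  ...   | inj₁ φi≢φj = ⊥-elim (T-not⁻ φi≢φj (ℕ.≡⇒≡ᵇ _ _ φi≡φj))
  ...   | inj₂ ψi≡ψj = ℕ.≤-reflexive (ℕ.≡ᵇ⇒≡ _ _ ψi≡ψj)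

  ≼⁺ : ψ ≼ φ → T (ψ ≼ᵇ φ)
  ≼⁺ h = allFin⁺ᵇ {p = λ i → allL (agree i) (allFin n)} (λ i → allFin⁺ᵇ {p = agree i} (λ j → from T-∧ (eq-part i j , lt-part i j)))
    where
    eq-part : ∀ i j → T (not ((φ at i) ≡ᵇ (φ at j)) ∨ ((ψ at i) ≡ᵇ (ψ at j)))
    eq-part i j with (φ at i) ℕ.≟ (φ at j)
    ... | yes e = from (T-∨ {not ((φ at i) ≡ᵇ (φ at j))}) (inj₂ (ℕ.≡⇒≡ᵇ (ψ at i) _
      (ℕ.≤-antisym (h .at-≤ i j (ℕ.≤-reflexive e)) (h .at-≤ j i (ℕ.≤-reflexive (sym e))))))
    ... | no ne = from T-∨ (inj₁ (T-not⁺ (ne ∘ ℕ.≡ᵇ⇒≡ _ _)))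
    lt-part : ∀ i j → T (not ((φ at i) <ᵇ (φ at j)) ∨ ((ψ at i) ≤ᵇ (ψ at j)))
    lt-part i j with (φ at i) ℕ.<? (φ at j)
    ... | yes lt = from (T-∨ {not ((φ at i) <ᵇ (φ at j))}) (inj₂ (ℕ.≤⇒≤ᵇ (h .at-≤ i j (ℕ.<⇒≤ lt))))
    ... | no nlt = from T-∨ (inj₁ (T-not⁺ (nlt ∘ ℕ.<ᵇ⇒< _ _)))

module _ {n : ℕ} where

  ≼-refl : {φ : Word n} → φ ≼ φ
  ≼-refl .at-≤ _ _ = id

  ≼-trans : {ψ φ χ : Word n} → ψ ≼ φ → φ ≼ χ → ψ ≼ χ
  ≼-trans p q .at-≤ i j = p .at-≤ i j ∘ q .at-≤ i j

  ≼-≡ : {ψ φ : Word n} → ψ ≼ φ → ∀ i j → φ at i ≡ φ at j → ψ at i ≡ ψ at j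
  ≼-≡ p i j e = ℕ.≤-antisym (p .at-≤ i j (ℕ.≤-reflexive e)) (p .at-≤ j i (ℕ.≤-reflexive (sym e)))

  -- A coarsening that merges no two blocks is no coarsening at all. Combined with `≼-antisym`, this
  -- is how equalities of set compositions are proved below: one comparison, then separation of
  -- blocks.
  ≼-reverse : {ψ φ : Word n} → ψ ≼ φ → (∀ i j → ψ at i ≡ ψ at j → φ at i ≡ φ at j) → φ ≼ ψ
  ≼-reverse p inj .at-≤ i j ψi≤ψj = ℕ.≮⇒≥ λ φj<φi →
    ℕ.<-irrefl (inj j i (ℕ.≤-antisym (p .at-≤ j i (ℕ.<⇒≤ φj<φi)) ψi≤ψj)) φj<φi

  ≼-antisym : {ψ φ : Word n} → Packed ψ → Packed φ → ψ ≼ φ → φ ≼ ψ → ψ ≡ φ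
  ≼-antisym pψ pφ p q = word-ext (λ i → ℕ.≤-antisym (below pψ p _ i refl) (below pφ q _ i refl))
    where
    -- Induction on the value: packedness gives a position of value one less, and a strict gap in
    -- `u` forces a strict gap in `v`.
    below : {u v : Word n} → Packed u → u ≼ v → ∀ k i → u at i ≡ k → k ≤ v at i
    below pu u≼v zero    i e = z≤n
    below pu u≼v (suc k) i e with j , uj≡k ← pu .preimage i k (ℕ.≤-reflexive (sym e)) =
      ℕ.≤-<-trans (below pu u≼v k j uj≡k)
        (ℕ.≰⇒> λ vi≤vj → ℕ.<-irrefl (sym uj≡k) (subst (_≤ _) e (u≼v .at-≤ i j vi≤vj)))

-- Extremal elements

-- Generic in the order, since it serves to maximise a rank, to minimise a position, and to find the
-- extremal block in either `Direction`.
best : ∀ {n} {_≲_ : ℕ → ℕ → Set} → (∀ a b → a ≲ b ⊎ b ≲ a) → (∀ {a b c} → a ≲ b → b ≲ c → a ≲ c) →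
  (p : Fin n → Bool) (f : Fin n → ℕ) → (∃ λ i → T (p i)) → ∃ λ i → T (p i) × (∀ j → T (p j) → f j ≲ f i)
best {suc n} {_≲_} total ≲-trans p f (i , pi) with Fin.any? (λ j → T? (p (Fin.suc j)))
best {suc n} {_≲_} total ≲-trans p f (Fin.suc i , pi) | no ¬p = ⊥-elim (¬p (i , pi))
best {suc n} {_≲_} total ≲-trans p f (Fin.zero , p0) | no ¬p = Fin.zero , p0 , λ
  { Fin.zero    _  → [ id , id ]′ (total (f Fin.zero) (f Fin.zero))
  ; (Fin.suc j) pj → ⊥-elim (¬p (j , pj)) }
best {suc n} {_≲_} total ≲-trans p f _ | yes ∃p
  with i , pi , max ← best {_≲_ = _≲_} total ≲-trans (p ∘ Fin.suc) (f ∘ Fin.suc) ∃p | T? (p Fin.zero)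
... | no ¬p0 = Fin.suc i , pi , λ { Fin.zero p0 → ⊥-elim (¬p0 p0) ; (Fin.suc j) pj → max j pj }
... | yes p0 with total (f Fin.zero) (f (Fin.suc i))
...   | inj₁ f0≲fi = Fin.suc i , pi , λ { Fin.zero _ → f0≲fi ; (Fin.suc j) pj → max j pj }
...   | inj₂ fi≲f0 = Fin.zero , p0 , λ
  { Fin.zero    _  → [ id , id ]′ (total (f Fin.zero) (f Fin.zero))
  ; (Fin.suc j) pj → ≲-trans (max j pj) fi≲f0 }

-- The meet of two words

infix 4 _<ₗ_ _≤ₗ_

_<ₗ_ _≤ₗ_ : ℕ × ℕ → ℕ × ℕ → Set
(a , b) <ₗ (c , d) = a < c ⊎ a ≡ c × b < d
(a , b) ≤ₗ (c , d) = a < c ⊎ a ≡ c × b ≤ d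

<ₗ⁻ : ∀ x y → T (lexLtᵇ {0} x y) → x <ₗ y
<ₗ⁻ (a , b) (c , d) t with to (T-∨ {a <ᵇ c}) t
... | inj₁ a<c = inj₁ (ℕ.<ᵇ⇒< a c a<c)
... | inj₂ t′ with a≡c , b<d ← to (T-∧ {a ≡ᵇ c}) t′ = inj₂ (ℕ.≡ᵇ⇒≡ a c a≡c , ℕ.<ᵇ⇒< b d b<d)

<ₗ⁺ : ∀ x y → x <ₗ y → T (lexLtᵇ {0} x y)
<ₗ⁺ (a , b) (c , d) (inj₁ a<c)         = from (T-∨ {a <ᵇ c}) (inj₁ (ℕ.<⇒<ᵇ a<c))
<ₗ⁺ (a , b) (c , d) (inj₂ (a≡c , b<d)) =
  from (T-∨ {a <ᵇ c}) (inj₂ (from T-∧ (ℕ.≡⇒≡ᵇ a c a≡c , ℕ.<⇒<ᵇ b<d)))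

<ₗ-≤ₗ-trans : ∀ x y z → x <ₗ y → y ≤ₗ z → x <ₗ z
<ₗ-≤ₗ-trans _ _ _ (inj₁ p)          (inj₁ q)          = inj₁ (ℕ.<-trans p q)
<ₗ-≤ₗ-trans _ _ _ (inj₁ p)          (inj₂ (refl , _)) = inj₁ p
<ₗ-≤ₗ-trans _ _ _ (inj₂ (refl , _)) (inj₁ q)          = inj₁ q
<ₗ-≤ₗ-trans _ _ _ (inj₂ (refl , p)) (inj₂ (refl , q)) = inj₂ (refl , ℕ.<-≤-trans p q)

<ₗ-irrefl : ∀ x → ¬ x <ₗ x
<ₗ-irrefl _ (inj₁ p)       = ℕ.<-irrefl refl p
<ₗ-irrefl _ (inj₂ (_ , p)) = ℕ.<-irrefl refl p

≤ₗ⇒<ₗ⊎≡ : ∀ x y → x ≤ₗ y → x <ₗ y ⊎ x ≡ y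
≤ₗ⇒<ₗ⊎≡ _ _ (inj₁ p) = inj₁ (inj₁ p)
≤ₗ⇒<ₗ⊎≡ _ _ (inj₂ (refl , p)) with ℕ.m≤n⇒m<n∨m≡n p
... | inj₁ q    = inj₁ (inj₂ (refl , q))
... | inj₂ refl = inj₂ refl

<ₗ⇒≤ₗ : ∀ x y → x <ₗ y → x ≤ₗ y
<ₗ⇒≤ₗ _ _ (inj₁ p)       = inj₁ p
<ₗ⇒≤ₗ _ _ (inj₂ (e , p)) = inj₂ (e , ℕ.<⇒≤ p)

≤ₗ⊎>ₗ : ∀ x y → x ≤ₗ y ⊎ y <ₗ x
≤ₗ⊎>ₗ (a , b) (c , d) with ℕ.<-cmp a c
... | tri< a<c _ _ = inj₁ (inj₁ a<c)
... | tri> _ _ c<a = inj₂ (inj₁ c<a)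
... | tri≈ _ refl _ with ℕ.≤-<-connex b d
...   | inj₁ b≤d = inj₁ (inj₂ (refl , b≤d))
...   | inj₂ d<b = inj₂ (inj₂ (refl , d<b))

pairEqᵇ⇒≡ : ∀ x y → T (pairEqᵇ {0} x y) → x ≡ y
pairEqᵇ⇒≡ (a , b) (c , d) t with p , q ← to (T-∧ {a ≡ᵇ c}) t = cong₂ _,_ (ℕ.≡ᵇ⇒≡ a c p) (ℕ.≡ᵇ⇒≡ b d q)

≡⇒pairEqᵇ : ∀ x y → x ≡ y → T (pairEqᵇ {0} x y)
≡⇒pairEqᵇ (a , b) _ refl = from T-∧ (ℕ.≡⇒≡ᵇ a a refl , ℕ.≡⇒≡ᵇ b b refl)

-- Ranks among the distinct keys

module _ {n : ℕ} (key : Fin n → ℕ × ℕ) where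

  keys : List (Fin n) → List (ℕ × ℕ)
  keys []       = []
  keys (i ∷ is) = if anyL (pairEqᵇ {0} (key i)) (keys is) then keys is else key i ∷ keys is

  -- Only the recursion equations of `K` are used, so it applies to the key list hidden inside
  -- `meet`.
  keys-determined : (K : List (Fin n) → List (ℕ × ℕ)) → K [] ≡ [] →
    (∀ i is → K (i ∷ is) ≡ (if anyL (pairEqᵇ {0} (key i)) (K is) then K is else key i ∷ K is)) →
    ∀ is → K is ≡ keys is
  keys-determined K e f []       = e
  keys-determined K e f (i ∷ is) rewrite f i is | keys-determined K e f is = refl

  ∈-keys⁻ : ∀ {k} is → k ∈ keys is → ∃ λ j → key j ≡ k
  ∈-keys⁻ (i ∷ is) k∈ with anyL (pairEqᵇ {0} (key i)) (keys is)
  ∈-keys⁻ (i ∷ is) k∈          | true  = ∈-keys⁻ is k∈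
  ∈-keys⁻ (i ∷ is) (here refl) | false = i , refl
  ∈-keys⁻ (i ∷ is) (there k∈)  | false = ∈-keys⁻ is k∈

  ∈-keys⁺ : ∀ {j} is → j ∈ is → key j ∈ keys is
  ∈-keys⁺ (i ∷ is) j∈ with anyL (pairEqᵇ {0} (key i)) (keys is) in eq
  ∈-keys⁺ (i ∷ is) (here refl) | true
    with k , k∈ , e ← anyL⁻ {p = pairEqᵇ {0} (key i)} (keys is) (subst T (sym eq) tt) =
    subst (_∈ keys is) (sym (pairEqᵇ⇒≡ (key i) k e)) k∈
  ∈-keys⁺ (i ∷ is) (there j∈)  | true  = ∈-keys⁺ is j∈
  ∈-keys⁺ (i ∷ is) (here refl) | false = here refl
  ∈-keys⁺ (i ∷ is) (there j∈)  | false = there (∈-keys⁺ is j∈)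

  keys-unique : ∀ is → Unique (keys is)
  keys-unique [] = []
  keys-unique (i ∷ is) with anyL (pairEqᵇ {0} (key i)) (keys is) in eq
  ... | true  = keys-unique is
  ... | false = All.tabulate (λ {k} k∈ e → subst T eq (anyL⁺ {p = pairEqᵇ {0} (key i)} k∈ (≡⇒pairEqᵇ (key i) k e))) ∷ keys-unique is

  rank : Fin n → ℕ
  rank i = countL (λ k → lexLtᵇ {0} k (key i)) (keys (allFin n))

  rank-mono : ∀ i j → key i ≤ₗ key j → rank i ≤ rank j
  rank-mono i j i≤j = countL-mono (keys (allFin n)) (λ k _ k<i →
    <ₗ⁺ k (key j) (<ₗ-≤ₗ-trans k (key i) (key j) (<ₗ⁻ k (key i) k<i) i≤j))

  rank-strict : ∀ i j → key i <ₗ key j → rank i < rank j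
  rank-strict i j i<j = countL-mono-<
    (λ k _ k<i → <ₗ⁺ k (key j) (<ₗ-≤ₗ-trans k (key i) (key j) (<ₗ⁻ k (key i) k<i) (<ₗ⇒≤ₗ (key i) (key j) i<j)))
    (∈-keys⁺ (allFin n) (∈-allFin i))
    (<ₗ-irrefl (key i) ∘ <ₗ⁻ (key i) (key i))
    (<ₗ⁺ (key i) (key j) i<j)

  rank-cancel : ∀ i j → rank i ≤ rank j → key i ≤ₗ key j
  rank-cancel i j ri≤rj with ≤ₗ⊎>ₗ (key i) (key j)
  ... | inj₁ i≤j = i≤j
  ... | inj₂ j<i = ⊥-elim (ℕ.≤⇒≯ ri≤rj (rank-strict j i j<i))

  -- Take `j` of largest rank among the positions with a smaller key. Every key below that of `i` is
  -- then below that of `j` or equal to it, and as the listed keys are distinct, equality accounts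
  -- for exactly one.
  rank-pred : ∀ i m → rank i ≡ suc m → ∃ λ j → rank j ≡ m
  rank-pred i m e = j , ℕ.≤-antisym (ℕ.≤-pred (ℕ.≤-trans rj<ri (ℕ.≤-reflexive e))) (ℕ.≤-pred (ℕ.≤-trans (ℕ.≤-reflexive (sym e)) ri≤1+rj))
    where
    below : Fin n → Bool
    below j = lexLtᵇ {0} (key j) (key i)
    ∃below : ∃ λ j → T (below j)
    ∃below with k , k∈ , k<i ← countL-pos {p = λ k → lexLtᵇ {0} k (key i)} (keys (allFin n)) (subst (0 <_) (sym e) (s≤s z≤n))
           with j , refl ← ∈-keys⁻ (allFin n) k∈ = j , k<i
    max = best {_≲_ = _≤_} ℕ.≤-total ℕ.≤-trans below rank ∃below
    j = proj₁ max
    rj<ri : rank j < rank i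
    rj<ri = rank-strict j i (<ₗ⁻ (key j) (key i) (proj₁ (proj₂ max)))
    ri≤1+rj : rank i ≤ suc (rank j)
    ri≤1+rj = begin
      rank i
        ≤⟨ countL-mono (keys (allFin n)) split ⟩
      countL (λ k → lexLtᵇ {0} k (key j) ∨ pairEqᵇ {0} k (key j)) (keys (allFin n))
        ≡⟨ countL-∨ (λ k → lexLtᵇ {0} k (key j)) (λ k → pairEqᵇ {0} k (key j)) (keys (allFin n)) (λ k _ k<j k≡j →
             <ₗ-irrefl (key j) (subst (_<ₗ key j) (pairEqᵇ⇒≡ k (key j) k≡j) (<ₗ⁻ k (key j) k<j))) ⟩
      rank j ℕ.+ countL (λ k → pairEqᵇ {0} k (key j)) (keys (allFin n))
        ≡⟨ cong (rank j ℕ.+_) (countL-one (keys-unique (allFin n)) (∈-keys⁺ (allFin n) (∈-allFin j)) (≡⇒pairEqᵇ (key j) (key j) refl) (λ k _ → pairEqᵇ⇒≡ k (key j))) ⟩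
      rank j ℕ.+ 1
        ≡⟨ ℕ.+-comm (rank j) 1 ⟩
      suc (rank j) ∎
      where
      open ℕ.≤-Reasoning
      split : ∀ k → k ∈ keys (allFin n) → T (lexLtᵇ {0} k (key i)) → T (lexLtᵇ {0} k (key j) ∨ pairEqᵇ {0} k (key j))
      split k k∈ k<i with l , refl ← ∈-keys⁻ (allFin n) k∈
        with ≤ₗ⇒<ₗ⊎≡ (key l) (key j) (rank-cancel l j (proj₂ (proj₂ max) l k<i))
      ... | inj₁ l<j = from (T-∨ {lexLtᵇ {0} (key l) (key j)}) (inj₁ (<ₗ⁺ (key l) (key j) l<j))
      ... | inj₂ l≡j = from (T-∨ {lexLtᵇ {0} (key l) (key j)}) (inj₂ (≡⇒pairEqᵇ (key l) (key j) l≡j))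

  rank-onto : ∀ m i → rank i ≡ m → ∀ k → k < m → ∃ λ j → rank j ≡ k
  rank-onto (suc m) i e k k<1+m with j , rj≡m ← rank-pred i m e | ℕ.m≤n⇒m<n∨m≡n (ℕ.≤-pred k<1+m)
  ... | inj₁ k<m  = rank-onto m j rj≡m k k<m
  ... | inj₂ refl = j , rj≡m

-- `g` is the shape to which `meet` unfolds at size `suc n`: `f` inserts the key of position zero
-- into the keys of the later positions, and the ranks are read off. At the call, `L`, `G`, `I` and
-- `A` stand for `length`, the filter at position zero, the conditional and the duplicate test.
keys-step : ∀ {n : ℕ} {B : Set} (key : Fin (suc n) → ℕ × ℕ) (is : List (Fin (suc n)))
  (L : List (ℕ × ℕ) → ℕ) (G : List (ℕ × ℕ) → List (ℕ × ℕ))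
  (I : B → List (ℕ × ℕ) → List (ℕ × ℕ) → List (ℕ × ℕ)) (A : List (ℕ × ℕ) → B)
  (K : List (Fin (suc n)) → List (ℕ × ℕ)) → K [] ≡ [] →
  (∀ i is → K (i ∷ is) ≡ (if anyL (pairEqᵇ {0} (key i)) (K is) then K is else key i ∷ K is)) →
  let f : List (ℕ × ℕ) → List (ℕ × ℕ)
      f ks = I (A ks) ks (key Fin.zero ∷ ks)
      g : List (ℕ × ℕ) → Word (suc n)
      g ks = L (G (f ks)) ∷ tabulate (λ i → L (filterᵇ (λ k → lexLtᵇ {0} k (key (Fin.suc i))) (f ks))) in
  g (K is) ≡ g (keys key is)
keys-step key is L G I A K e f rewrite keys-determined key K e f is = refl

mutual
  -- The list of keys inside meet is a local function of Defs, out of scope here.  The placeholder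
  -- is solved to it in meet-rank, where abstracting the functions applied to it makes the
  -- unification problem rigid.
  meetKeys : ∀ {n} (ψ χ : Word (suc n)) → List (Fin (suc n)) → List (ℕ × ℕ)
  meetKeys ψ χ is = _

  meet-rank : ∀ {n} (ψ χ : Word n) → meet ψ χ ≡ tabulate (rank (λ i → ψ at i , χ at i))
  meet-rank {zero}  ψ χ = refl
  meet-rank {suc n} ψ χ
    with is ← List.tabulate {n = n} Fin.suc
       | L ← length {A = ℕ × ℕ}
       | G ← filterᵇ (λ k → lexLtᵇ {0} k (ψ at Fin.zero , χ at Fin.zero))
       | I ← if_then_else_ {A = List (ℕ × ℕ)}
       | A ← anyL (pairEqᵇ {0} (ψ at Fin.zero , χ at Fin.zero)) =
    keys-step (λ i → ψ at i , χ at i) is L G I A (meetKeys ψ χ) refl (λ _ _ → refl)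

-- The meet as the packed word of the lexicographic preorder

module _ {n : ℕ} (ψ χ : Word n) where

  private
    key : Fin n → ℕ × ℕ
    key i = ψ at i , χ at i

  meet-at : ∀ i → meet ψ χ at i ≡ rank key i
  meet-at i = trans (cong (_at i) (meet-rank ψ χ)) (lookup∘tabulate (rank key) i)

  meet-≤⁺ : ∀ i j → key i ≤ₗ key j → meet ψ χ at i ≤ meet ψ χ at j
  meet-≤⁺ i j h = subst₂ _≤_ (sym (meet-at i)) (sym (meet-at j)) (rank-mono key i j h)

  meet-≤⁻ : ∀ i j → meet ψ χ at i ≤ meet ψ χ at j → key i ≤ₗ key j
  meet-≤⁻ i j h = rank-cancel key i j (subst₂ _≤_ (meet-at i) (meet-at j) h)

  meet-packed : Packed (meet ψ χ)
  meet-packed .preimage i k k< with j , e ← rank-onto key (rank key i) i refl k (subst (k <_) (meet-at i) k<) =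
    j , trans (meet-at j) e

  meet-≡⁺ : ∀ i j → ψ at i ≡ ψ at j → χ at i ≡ χ at j → meet ψ χ at i ≡ meet ψ χ at j
  meet-≡⁺ i j p q = ℕ.≤-antisym (meet-≤⁺ i j (inj₂ (p , ℕ.≤-reflexive q))) (meet-≤⁺ j i (inj₂ (sym p , ℕ.≤-reflexive (sym q))))

  ≼-meet : ψ ≼ meet ψ χ
  ≼-meet .at-≤ i j h with meet-≤⁻ i j h
  ... | inj₁ p       = ℕ.<⇒≤ p
  ... | inj₂ (p , _) = ℕ.≤-reflexive p

  meet-≡⁻ : ∀ i j → meet ψ χ at i ≡ meet ψ χ at j → ψ at i ≡ ψ at j × χ at i ≡ χ at j
  meet-≡⁻ i j e with meet-≤⁻ i j (ℕ.≤-reflexive e) | meet-≤⁻ j i (ℕ.≤-reflexive (sym e))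
  ... | inj₁ p       | inj₁ q       = ⊥-elim (ℕ.<-asym p q)
  ... | inj₁ p       | inj₂ (q , _) = ⊥-elim (ℕ.<-irrefl (sym q) p)
  ... | inj₂ (p , _) | inj₁ q       = ⊥-elim (ℕ.<-irrefl (sym p) q)
  ... | inj₂ (p , a) | inj₂ (_ , b) = p , ℕ.≤-antisym a b

-- The length of a set composition

module _ {A B : Set} where

  private
    total : {C : Set} → List C → (C → ℕ) → ℕ
    total xs f = sum (map f xs)

    total-cong : ∀ {C : Set} (xs : List C) {f g : C → ℕ} → (∀ x → x ∈ xs → f x ≡ g x) → total xs f ≡ total xs g
    total-cong []       h = refl
    total-cong (x ∷ xs) h = cong₂ ℕ._+_ (h x (here refl)) (total-cong xs (λ y → h y ∘ there))

    total-count : ∀ {C : Set} (b : C → Bool) (c : C → ℕ) xs →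
      total xs (λ x → (if b x then 1 else 0) ℕ.+ c x) ≡ countL b xs ℕ.+ total xs c
    total-count b c [] = refl
    total-count b c (x ∷ xs) with b x
    ... | true  = cong suc (trans (cong (c x ℕ.+_) (total-count b c xs)) (x∙yz≈y∙xz (c x) (countL b xs) (total xs c)))
    ... | false = trans (cong (c x ℕ.+_) (total-count b c xs)) (x∙yz≈y∙xz (c x) (countL b xs) (total xs c))

    total-zero : ∀ {C : Set} (xs : List C) → total xs (λ _ → 0) ≡ 0
    total-zero []       = refl
    total-zero (x ∷ xs) = total-zero xs

    total-indicator : ∀ {C : Set} (b : C → Bool) xs → total xs (λ x → if b x then 1 else 0) ≡ countL b xs
    total-indicator b xs = begin
      total xs (λ x → if b x then 1 else 0)           ≡⟨ total-cong xs (λ x _ → sym (ℕ.+-identityʳ _)) ⟩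
      total xs (λ x → (if b x then 1 else 0) ℕ.+ 0)   ≡⟨ total-count b (λ _ → 0) xs ⟩
      countL b xs ℕ.+ total xs (λ _ → 0)              ≡⟨ cong (countL b xs ℕ.+_) (total-zero xs) ⟩
      countL b xs ℕ.+ 0                               ≡⟨ ℕ.+-identityʳ _ ⟩
      countL b xs                                     ∎
      where open ≡-Reasoning

    total-swap : ∀ (r : A → B → Bool) xs ys →
      total xs (λ x → countL (r x) ys) ≡ total ys (λ y → countL (λ x → r x y) xs)
    total-swap r []       ys = sym (total-zero ys)
    total-swap r (x ∷ xs) ys = begin
      countL (r x) ys ℕ.+ total xs (λ x → countL (r x) ys)                               ≡⟨ cong (countL (r x) ys ℕ.+_) (total-swap r xs ys) ⟩
      countL (r x) ys ℕ.+ total ys (λ y → countL (λ x → r x y) xs)                       ≡⟨ total-count (r x) (λ y → countL (λ x → r x y) xs) ys ⟨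
      total ys (λ y → (if r x y then 1 else 0) ℕ.+ countL (λ x → r x y) xs)              ≡⟨ total-cong ys (λ y _ → sym (countL-∷ (λ x → r x y) x xs)) ⟩
      total ys (λ y → countL (λ x → r x y) (x ∷ xs))                                     ∎
      where open ≡-Reasoning

  -- Double counting of the pairs related by `r`.
  countL-matching : ∀ (r : A → B → Bool) {p q} xs ys →
    (∀ x → x ∈ xs → countL (r x) ys ≡ (if p x then 1 else 0)) →
    (∀ y → y ∈ ys → countL (λ x → r x y) xs ≡ (if q y then 1 else 0)) →
    countL p xs ≡ countL q ys
  countL-matching r {p} {q} xs ys hp hq = begin
    countL p xs                                     ≡⟨ total-indicator p xs ⟨
    total xs (λ x → if p x then 1 else 0)           ≡⟨ total-cong xs hp ⟨
    total xs (λ x → countL (r x) ys)                ≡⟨ total-swap r xs ys ⟩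
    total ys (λ y → countL (λ x → r x y) xs)        ≡⟨ total-cong ys hq ⟩
    total ys (λ y → if q y then 1 else 0)           ≡⟨ total-indicator q ys ⟩
    countL q ys                                     ∎
    where open ≡-Reasoning

module _ {n : ℕ} where

  -- Marks one representative of each block. The length becomes a count over positions, which can be
  -- split along a class of positions and compared between words.
  firstᵇ : Word n → Fin n → Bool
  firstᵇ w i = allL (λ j → not ((w at j ≡ᵇ w at i) ∧ (toℕ j <ᵇ toℕ i))) (allFin n)

  first⁻ : ∀ w i → T (firstᵇ w i) → ∀ j → w at j ≡ w at i → toℕ i ≤ toℕ j
  first⁻ w i t j e = ℕ.≮⇒≥ λ j<i →
    T-not⁻ (allFin⁻ {p = λ j → not ((w at j ≡ᵇ w at i) ∧ (toℕ j <ᵇ toℕ i))} t j)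
      (from T-∧ (ℕ.≡⇒≡ᵇ _ _ e , ℕ.<⇒<ᵇ j<i))

  first⁺ : ∀ w i → (∀ j → w at j ≡ w at i → toℕ i ≤ toℕ j) → T (firstᵇ w i)
  first⁺ w i h = allFin⁺ᵇ {p = λ j → not ((w at j ≡ᵇ w at i) ∧ (toℕ j <ᵇ toℕ i))} λ j → T-not⁺ λ t →
    let e , j<i = to (T-∧ {w at j ≡ᵇ w at i}) t in
    ℕ.≤⇒≯ (h j (ℕ.≡ᵇ⇒≡ _ _ e)) (ℕ.<ᵇ⇒< _ _ j<i)

  first-unique : ∀ w i j → T (firstᵇ w i) → T (firstᵇ w j) → w at i ≡ w at j → i ≡ j
  first-unique w i j fi fj e = Fin.toℕ-injective (ℕ.≤-antisym (first⁻ w i fi j (sym e)) (first⁻ w j fj i e))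

  first-exists : ∀ (w : Word n) i → ∃ λ j → w at j ≡ w at i × T (firstᵇ w j)
  first-exists w i with j , e , min ← best {_≲_ = λ a b → b ≤ a} (λ a b → ℕ.≤-total b a) (λ p q → ℕ.≤-trans q p)
                                        (λ j → w at j ≡ᵇ w at i) toℕ (i , ℕ.≡⇒≡ᵇ (w at i) _ refl) =
    j , ℕ.≡ᵇ⇒≡ _ _ e , first⁺ w j (λ k e′ → min k (ℕ.≡⇒≡ᵇ _ _ (trans e′ (ℕ.≡ᵇ⇒≡ _ _ e))))

  len-firsts : ∀ {w} → Packed w → len w ≡ countL (firstᵇ w) (allFin n)
  len-firsts {w} pw = countL-matching r (upTo n) (allFin n) at-value at-position
    where
    r : ℕ → Fin n → Bool
    r k i = firstᵇ w i ∧ (w at i ≡ᵇ k)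
    r⁻ : ∀ k i → T (r k i) → T (firstᵇ w i) × w at i ≡ k
    r⁻ k i t with f , e ← to (T-∧ {firstᵇ w i}) t = f , ℕ.≡ᵇ⇒≡ _ _ e
    r⁺ : ∀ k i → T (firstᵇ w i) → w at i ≡ k → T (r k i)
    r⁺ k i f e = from T-∧ (f , ℕ.≡⇒≡ᵇ _ _ e)
    at-value : ∀ k → k ∈ upTo n → countL (r k) (allFin n) ≡ (if occurs k w then 1 else 0)
    at-value k _ with occurs k w in eq
    ... | true with j , refl ← occurs⁻ k w (subst T (sym eq) tt) with i , wi≡wj , fi ← first-exists w j =
      countL-one (allFin⁺ n) (∈-allFin i) (r⁺ k i fi wi≡wj)
        (λ x _ t → let fx , wx≡k = r⁻ k x t in first-unique w x i fx fi (trans wx≡k (sym wi≡wj)))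
    ... | false = countL-none (allFin n) (λ i _ t → subst T eq (occurs⁺ w i (proj₂ (r⁻ k i t))))
    at-position : ∀ i → i ∈ allFin n → countL (λ k → r k i) (upTo n) ≡ (if firstᵇ w i then 1 else 0)
    at-position i _ with T? (firstᵇ w i)
    ... | yes fi = trans
      (countL-one (upTo⁺ n) (∈-upTo⁺ (packed-< pw i)) (r⁺ (w at i) i fi refl) (λ k _ t → sym (proj₂ (r⁻ k i t))))
      (cong (if_then 1 else 0) (sym (T⇒true fi)))
    ... | no ¬fi = trans
      (countL-none (upTo n) (λ k _ t → ¬fi (proj₁ (r⁻ k i t))))
      (cong (if_then 1 else 0) (sym (¬T⇒false ¬fi)))

  len-≤ : ∀ w → len {n} w ≤ n
  len-≤ w = subst (len w ≤_) (List.length-upTo n) (countL-≤length (λ k → occurs k w) (upTo n))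

  first-≼ : ∀ {z y : Word n} → z ≼ y → ∀ i → T (firstᵇ z i) → T (firstᵇ y i)
  first-≼ {z} {y} z≼y i f = first⁺ y i (λ j e → first⁻ z i f j (≼-≡ z≼y j i e))

  -- Merging blocks can only remove first positions. If none were removed, distinct blocks of `y`
  -- would have their first positions in distinct blocks of `z`, and the two words would agree.
  len-< : ∀ {z y : Word n} → Packed z → Packed y → z ≼ y → z ≢ y → len z < len y
  len-< {z} {y} pz py z≼y z≢y with Fin.any? (λ i → T? (firstᵇ y i) ×-dec ¬? (T? (firstᵇ z i)))
  ... | yes (i , fy , ¬fz) = subst₂ _<_ (sym (len-firsts pz)) (sym (len-firsts py))
    (countL-mono-< (λ j _ → first-≼ z≼y j) (∈-allFin i) ¬fz fy)
  ... | no ∄ = ⊥-elim (z≢y (≼-antisym pz py z≼y (≼-reverse z≼y separated)))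
    where
    first-y⇒z : ∀ i → T (firstᵇ y i) → T (firstᵇ z i)
    first-y⇒z i fy with T? (firstᵇ z i)
    ... | yes fz = fz
    ... | no ¬fz = ⊥-elim (∄ (i , fy , ¬fz))
    separated : ∀ i j → z at i ≡ z at j → y at i ≡ y at j
    separated i j e with i′ , ei , fi ← first-exists y i | j′ , ej , fj ← first-exists y j =
      trans (sym ei) (trans (cong (y at_) (first-unique z i′ j′ (first-y⇒z i′ fi) (first-y⇒z j′ fj)
        (trans (≼-≡ z≼y i′ i ei) (trans e (sym (≼-≡ z≼y j′ j ej)))))) ej)

-- Algebra of the meet

module _ {n : ℕ} where

  meet-<⁻ : ∀ (ψ χ : Word n) i j → meet ψ χ at i < meet ψ χ at j → (ψ at i , χ at i) <ₗ (ψ at j , χ at j)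
  meet-<⁻ ψ χ i j h with ≤ₗ⇒<ₗ⊎≡ _ _ (meet-≤⁻ ψ χ i j (ℕ.<⇒≤ h))
  ... | inj₁ lt = lt
  ... | inj₂ e  = ⊥-elim (ℕ.<-irrefl (meet-≡⁺ ψ χ i j (cong proj₁ e) (cong proj₂ e)) h)

  -- Both sides are packed and order the positions lexicographically by the triple of values of `α`,
  -- `β`, `s`.
  meet-assoc : ∀ (α β s : Word n) → meet α (meet β s) ≡ meet (meet α β) s
  meet-assoc α β s = ≼-antisym (meet-packed α (meet β s)) (meet-packed (meet α β) s) below (≼-reverse below separated)
    where
    below : meet α (meet β s) ≼ meet (meet α β) s
    below .at-≤ i j h = meet-≤⁺ α (meet β s) i j (order (meet-≤⁻ (meet α β) s i j h))
      where
      order : (meet α β at i , s at i) ≤ₗ (meet α β at j , s at j) → (α at i , meet β s at i) ≤ₗ (α at j , meet β s at j)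
      order (inj₁ lt) with meet-<⁻ α β i j lt
      ... | inj₁ α<       = inj₁ α<
      ... | inj₂ (α≡ , β<) = inj₂ (α≡ , meet-≤⁺ β s i j (inj₁ β<))
      order (inj₂ (e , s≤)) with α≡ , β≡ ← meet-≡⁻ α β i j e = inj₂ (α≡ , meet-≤⁺ β s i j (inj₂ (β≡ , s≤)))
    separated : ∀ i j → meet α (meet β s) at i ≡ meet α (meet β s) at j → meet (meet α β) s at i ≡ meet (meet α β) s at j
    separated i j e with α≡ , βs≡ ← meet-≡⁻ α (meet β s) i j e with β≡ , s≡ ← meet-≡⁻ β s i j βs≡ =
      meet-≡⁺ (meet α β) s i j (meet-≡⁺ α β i j α≡ β≡) s≡

  meet-absorb : ∀ {β s : Word n} → Packed β → (∀ i j → β at i ≡ β at j → s at i ≡ s at j) → meet β s ≡ β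
  meet-absorb {β} {s} pβ h = sym (≼-antisym pβ (meet-packed β s) (≼-meet β s)
    (≼-reverse (≼-meet β s) (λ i j e → meet-≡⁺ β s i j e (h i j e))))

  meet-monoʳ : ∀ (α : Word n) {ζ ξ} → ζ ≼ ξ → meet α ζ ≼ meet α ξ
  meet-monoʳ α {ζ} {ξ} ζ≼ξ .at-≤ i j h with meet-≤⁻ α ξ i j h
  ... | inj₁ α<        = meet-≤⁺ α ζ i j (inj₁ α<)
  ... | inj₂ (α≡ , ξ≤) = meet-≤⁺ α ζ i j (inj₂ (α≡ , ζ≼ξ .at-≤ i j ξ≤))

  -- Words below a member of 𝒞

  rearr⁺ : ∀ (φ ξ : Word n) → (∀ i j → φ at i ≡ φ at j → ξ at i ≡ ξ at j) → (∀ i j → ξ at i ≡ ξ at j → φ at i ≡ φ at j) →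
    T (rearrᵇ φ ξ)
  rearr⁺ φ ξ h k = allFin⁺ᵇ {p = λ i → allL (same i) (allFin n)} (λ i → allFin⁺ᵇ {p = same i} (go i))
    where
    same : Fin n → Fin n → Bool
    same i j = ((φ at i) ≡ᵇ (φ at j)) ∧ ((ξ at i) ≡ᵇ (ξ at j)) ∨ not ((φ at i) ≡ᵇ (φ at j)) ∧ not ((ξ at i) ≡ᵇ (ξ at j))
    go : ∀ i j → T (same i j)
    go i j with (φ at i) ℕ.≟ (φ at j)
    ... | yes e = from (T-∨ {((φ at i) ≡ᵇ (φ at j)) ∧ ((ξ at i) ≡ᵇ (ξ at j))})
      (inj₁ (from T-∧ (ℕ.≡⇒≡ᵇ (φ at i) _ e , ℕ.≡⇒≡ᵇ (ξ at i) _ (h i j e))))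
    ... | no ne = from (T-∨ {((φ at i) ≡ᵇ (φ at j)) ∧ ((ξ at i) ≡ᵇ (ξ at j))})
      (inj₂ (from T-∧ (T-not⁺ (ne ∘ ℕ.≡ᵇ⇒≡ _ _) , T-not⁺ (ne ∘ k i j ∘ ℕ.≡ᵇ⇒≡ _ _))))

  -- If ζ ≤ ξ with ξ in 𝒞, monotonicity gives α∧ζ ≤ α∧ξ = φ.
  belowC⁻ : ∀ (φ α ζ : Word n) → T (belowCᵇ φ α ζ) → meet α ζ ≼ φ
  belowC⁻ φ α ζ t with ξ , _ , t′ ← anyL⁻ {p = λ ξ → inCᵇ φ α ξ ∧ (ζ ≼ᵇ ξ)} (SC n) t
    with ξ∈C , ζ≼ξ ← to (T-∧ {inCᵇ φ α ξ}) t′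
    with _ , e ← to (T-∧ {rearrᵇ φ ξ}) ξ∈C =
    subst (meet α ζ ≼_) (wordEqᵇ⇒≡ (meet α ξ) φ e) (meet-monoʳ α (≼⁻ ζ ξ ζ≼ξ))

  -- The rearrangement ξ orders the blocks of φ first by the block of ζ containing them.
  belowC⁺ : ∀ {φ α ζ : Word n} → Packed φ → meet α ζ ≼ φ → T (belowCᵇ φ α ζ)
  belowC⁺ {φ} {α} {ζ} pφ αζ≼φ = anyL⁺ {p = λ ξ → inCᵇ φ α ξ ∧ (ζ ≼ᵇ ξ)} (∈-SC⁺ (meet-packed ζ φ))
    (from (T-∧ {inCᵇ φ α ξ}) (from (T-∧ {rearrᵇ φ ξ}) (rearranged , ≡⇒wordEqᵇ (meet α ξ) φ meet≡φ) , ≼⁺ ζ ξ (≼-meet ζ φ)))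
    where
    ξ = meet ζ φ
    ζ≡ : ∀ i j → φ at i ≡ φ at j → ζ at i ≡ ζ at j
    ζ≡ i j e = proj₂ (meet-≡⁻ α ζ i j (≼-≡ αζ≼φ i j e))
    rearranged : T (rearrᵇ φ ξ)
    rearranged = rearr⁺ φ ξ (λ i j e → meet-≡⁺ ζ φ i j (ζ≡ i j e) e) (λ i j e → proj₂ (meet-≡⁻ ζ φ i j e))
    -- α∧(ζ∧φ) = (α∧ζ)∧φ, and refining by φ turns α∧ζ, which is coarser than φ, into φ itself.
    meet≡φ : meet α ξ ≡ φ
    meet≡φ = trans (meet-assoc α ζ φ) (≼-antisym (meet-packed (meet α ζ) φ) pφ below
      (≼-reverse below (λ i j e → proj₂ (meet-≡⁻ (meet α ζ) φ i j e))))
      where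
      below : meet (meet α ζ) φ ≼ φ
      below .at-≤ i j φ≤ with ℕ.m≤n⇒m<n∨m≡n (αζ≼φ .at-≤ i j φ≤)
      ... | inj₁ lt = meet-≤⁺ (meet α ζ) φ i j (inj₁ lt)
      ... | inj₂ e  = meet-≤⁺ (meet α ζ) φ i j (inj₂ (e , φ≤))

-- Binary words, their signs, and flips

2ℚ : ℚ
2ℚ = pos 2 ÷ℚ 1

self-negative : ∀ x → x ≡ - x → x ≡ 0ℚ
self-negative x e = begin
  x               ≡⟨ halve x ⟩
  ½ * (x + x)     ≡⟨ cong (λ y → ½ * (x + y)) e ⟩
  ½ * (x + - x)   ≡⟨ cong (½ *_) (ℚ.+-inverseʳ x) ⟩
  ½ * 0ℚ          ≡⟨⟩
  0ℚ              ∎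
  where
  open ≡-Reasoning
  halve : ∀ x → x ≡ ½ * (x + x)
  halve x = sym (trans (ℚ.*-distribˡ-+ ½ x x) (trans (sym (ℚ.*-distribʳ-+ x ½ ½)) (ℚ.*-identityˡ x)))

neg-involutive : ∀ x → - - x ≡ x
neg-involutive = solve-∀ ℚ-ring

signℚ-even : ∀ m → m % 2 ≢ 1 → signℚ m ≡ 1ℚ
signℚ-even zero          _ = refl
signℚ-even (suc zero)    h = ⊥-elim (h refl)
signℚ-even (suc (suc m)) h = trans (neg-involutive (signℚ m)) (signℚ-even m h)

signℚ-odd : ∀ m → m % 2 ≡ 1 → signℚ m ≡ - 1ℚ
signℚ-odd (suc zero)    _ = refl
signℚ-odd (suc (suc m)) h = trans (neg-involutive (signℚ m)) (signℚ-odd m h)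

sgn : ∀ {n} → Word n → ℚ
sgn []          = 1ℚ
sgn (zero ∷ s)  = sgn s
sgn (suc _ ∷ s) = - sgn s

flip : ∀ {n} → (Fin n → Bool) → Word n → Word n
flip p s = tabulate λ i → if p i then 1 ∸ s at i else s at i

module _ {n : ℕ} (p : Fin n → Bool) (s : Word n) where

  flip-in : ∀ i → T (p i) → flip p s at i ≡ 1 ∸ s at i
  flip-in i pi = trans (lookup∘tabulate _ i) (cong (if_then 1 ∸ s at i else s at i) (T⇒true pi))

  flip-out : ∀ i → ¬ T (p i) → flip p s at i ≡ s at i
  flip-out i ¬pi = trans (lookup∘tabulate _ i) (cong (if_then 1 ∸ s at i else s at i) (¬T⇒false ¬pi))

  flip-<2 : (∀ i → s at i < 2) → ∀ i → flip p s at i < 2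
  flip-<2 s<2 i with T? (p i)
  ... | yes pi = subst (_< 2) (sym (flip-in i pi)) (s≤s (ℕ.m∸n≤m 1 (s at i)))
  ... | no ¬pi = subst (_< 2) (sym (flip-out i ¬pi)) (s<2 i)

1∸1∸ : ∀ {x} → x < 2 → 1 ∸ (1 ∸ x) ≡ x
1∸1∸ (s≤s z≤n)       = refl
1∸1∸ (s≤s (s≤s z≤n)) = refl

flip-involutive : ∀ {n} (p : Fin n → Bool) s → (∀ i → s at i < 2) → flip p (flip p s) ≡ s
flip-involutive p s s<2 = word-ext go
  where
  go : ∀ i → flip p (flip p s) at i ≡ s at i
  go i with T? (p i)
  ... | yes pi = trans (flip-in p (flip p s) i pi) (trans (cong (1 ∸_) (flip-in p s i pi)) (1∸1∸ (s<2 i)))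
  ... | no ¬pi = trans (flip-out p (flip p s) i ¬pi) (flip-out p s i ¬pi)

-- Flipping permutes the binary words; letter by letter, it exchanges the two summands of a flipped
-- position or leaves them alone.
Σ-flip : ∀ {n} p (f : Word n → ℚ) → sumℚ (words 2 n) (λ s → f (flip p s)) ≡ sumℚ (words 2 n) f
Σ-flip {zero}  p f = refl
Σ-flip {suc n} p f = begin
  sumℚ (words 2 (suc n)) (λ s → f (flip p s))       ≡⟨ Σ-words-suc 2 n (λ s → f (flip p s)) ⟩
  sumℚ (words 2 n) (λ v → f (flip p (0 ∷ v)) + (f (flip p (1 ∷ v)) + 0ℚ))
                                                     ≡⟨ Σ-cong (words 2 n) (λ v _ → head v) ⟩
  sumℚ (words 2 n) (λ v → g (flip (p ∘ Fin.suc) v)) ≡⟨ Σ-flip (p ∘ Fin.suc) g ⟩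
  sumℚ (words 2 n) g                                ≡⟨ Σ-words-suc 2 n f ⟨
  sumℚ (words 2 (suc n)) f                          ∎
  where
  open ≡-Reasoning
  g : Word n → ℚ
  g v = f (0 ∷ v) + (f (1 ∷ v) + 0ℚ)
  exchange : ∀ a b → b + (a + 0ℚ) ≡ a + (b + 0ℚ)
  exchange = solve-∀ ℚ-ring
  head : ∀ v → f (flip p (0 ∷ v)) + (f (flip p (1 ∷ v)) + 0ℚ) ≡ g (flip (p ∘ Fin.suc) v)
  head v with p Fin.zero
  ... | true  = exchange (f (0 ∷ flip (p ∘ Fin.suc) v)) (f (1 ∷ flip (p ∘ Fin.suc) v))
  ... | false = refl

countL-allFin-suc : ∀ {n} (p : Fin (suc n) → Bool) →
  countL p (allFin (suc n)) ≡ (if p Fin.zero then 1 else 0) ℕ.+ countL (p ∘ Fin.suc) (allFin n)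
countL-allFin-suc {n} p = trans (countL-∷ p Fin.zero _) (cong ((if p Fin.zero then 1 else 0) ℕ.+_)
  (trans (cong (countL p) (sym (List.map-tabulate id Fin.suc))) (countL-map Fin.suc p (allFin n))))

sgn-flip : ∀ {n} p (s : Word n) → (∀ i → s at i < 2) → sgn (flip p s) ≡ signℚ (countL p (allFin n)) * sgn s
sgn-flip p []      _   = refl
sgn-flip {suc n} p (x ∷ s) s<2 rewrite countL-allFin-suc p
  with p Fin.zero | x | s<2 Fin.zero | sgn-flip (p ∘ Fin.suc) s (s<2 ∘ Fin.suc)
... | false | zero        | _ | ih = ih
... | false | suc zero    | _ | ih = trans (cong -_ ih) (ℚ.neg-distribʳ-* c (sgn s))
  where c = signℚ (countL (p ∘ Fin.suc) (allFin n))
... | true  | zero        | _ | ih = trans (cong -_ ih) (ℚ.neg-distribˡ-* c (sgn s))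
  where c = signℚ (countL (p ∘ Fin.suc) (allFin n))
... | true  | suc zero    | _ | ih = trans ih (neg-neg c (sgn s))
  where
  c = signℚ (countL (p ∘ Fin.suc) (allFin n))
  neg-neg : ∀ a b → a * b ≡ - a * - b
  neg-neg = solve-∀ ℚ-ring
... | _     | suc (suc x) | s≤s (s≤s ()) | _

-- The two-letter relation

-- Treats at once the first block on which s is 1 (upward) and the last one on which s is 0 (downward).
record Direction : Set₁ where
  infix 4 _≲_
  field
    value      : ℕ
    _≲_        : ℕ → ℕ → Set
    ≲-total    : ∀ a b → a ≲ b ⊎ b ≲ a
    ≲-trans    : ∀ {a b c} → a ≲ b → b ≲ c → a ≲ c
    ≲-antisym  : ∀ {a b} → a ≲ b → b ≲ a → a ≡ b
    value-flip : 1 ∸ value ≢ value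
    -- Here x, y are block indices and a, b the letters there. A monotone binary word is the same as
    -- a set of indices with letter `value` that is closed under passing to `≲`-larger ones:
    -- `propagate` is one direction, `collect` the other.
    propagate  : ∀ {x y a b} → a < 2 → b < 2 → x ≲ y → (x ≤ y → a ≤ b) → (y ≤ x → b ≤ a) → a ≡ value → b ≡ value
    collect    : ∀ {x y a b} → a < 2 → b < 2 → x ≤ y →
                 (x ≲ y → a ≡ value → b ≡ value) → (y ≲ x → b ≡ value → a ≡ value) → a ≤ b

upward : Direction
upward = record
  { value      = 1
  ; _≲_        = _≤_
  ; ≲-total    = ℕ.≤-total
  ; ≲-trans    = ℕ.≤-trans
  ; ≲-antisym  = ℕ.≤-antisym
  ; value-flip = λ ()
  ; propagate  = λ { _ b<2 x≤y f _ refl → ℕ.≤-antisym (ℕ.≤-pred b<2) (f x≤y) }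
  ; collect    = λ { {a = zero} _ _ _ _ _ → z≤n
                   ; {a = suc zero} _ _ x≤y f _ → ℕ.≤-reflexive (sym (f x≤y refl))
                   ; {a = suc (suc _)} (s≤s (s≤s ())) _ _ _ _ }
  }

downward : Direction
downward = record
  { value      = 0
  ; _≲_        = λ a b → b ≤ a
  ; ≲-total    = λ a b → ℕ.≤-total b a
  ; ≲-trans    = λ p q → ℕ.≤-trans q p
  ; ≲-antisym  = λ p q → ℕ.≤-antisym q p
  ; value-flip = λ ()
  ; propagate  = λ { _ _ y≤x _ g refl → ℕ.n≤0⇒n≡0 (g y≤x) }
  ; collect    = λ { {b = zero} _ _ x≤y _ g → ℕ.≤-reflexive (g x≤y refl)
                   ; {b = suc _} a<2 _ _ _ _ → ℕ.≤-trans (ℕ.≤-pred a<2) (s≤s z≤n) }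
  }

pow2 : ℕ → ℚ
pow2 = powℚ 2ℚ

pow2-+ : ∀ a b → pow2 (a ℕ.+ b) ≡ pow2 a * pow2 b
pow2-+ zero    b = sym (ℚ.*-identityˡ (pow2 b))
pow2-+ (suc a) b = trans (cong (2ℚ *_) (pow2-+ a b)) (sym (ℚ.*-assoc 2ℚ (pow2 a) (pow2 b)))

nat : ℕ → ℚ
nat zero    = 0ℚ
nat (suc m) = 1ℚ + nat m

Σ-count : ∀ {A : Set} (p : A → Bool) xs c → sumℚ xs (λ x → ι (p x) * c) ≡ nat (countL p xs) * c
Σ-count p []       c = sym (ℚ.*-zeroˡ c)
Σ-count p (x ∷ xs) c with p x
... | true  = trans (cong (1ℚ * c +_) (Σ-count p xs c)) (sym (ℚ.*-distribʳ-+ c 1ℚ (nat (countL p xs))))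
... | false = trans (cong₂ _+_ (ℚ.*-zeroˡ c) (Σ-count p xs c)) (ℚ.+-identityˡ _)

bit : Bool → ℕ
bit b = if b then 1 else 0

pow2-bits : ∀ a b → T (a ∨ b) → pow2 (bit a ℕ.+ bit b) ≡ nat (bit a ℕ.+ bit b) * 2ℚ
pow2-bits true  true  _ = refl
pow2-bits true  false _ = refl
pow2-bits false true  _ = refl

-- Binary words on the class of `o` under `κ`, and the blocks of `φ` in it

module _ {n : ℕ} (κ φ : Word n) (φ< : ∀ i → φ at i < n) (o : Fin n) where

  validᵇ : Word n → Bool
  validᵇ s = meet κ s ≼ᵇ φ

  Binary : Word n → Set
  Binary s = ∀ i → s at i < 2

  block : ℕ → Fin n → Bool
  block t i = φ at i ≡ᵇ t

  inClass : Fin n → Bool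
  inClass i = κ at i ≡ᵇ κ at o

  hasValue : Word n → ℕ → ℕ → Bool
  hasValue s v t = anyL (λ i → block t i ∧ (inClass i ∧ (s at i ≡ᵇ v))) (allFin n)

  attains : Word n → ℕ → Bool
  attains s v = anyL (λ i → inClass i ∧ (s at i ≡ᵇ v)) (allFin n)

  toggled : ℕ → Word n → Word n
  toggled t = flip (block t)

  hasValue⁻ : ∀ s v t → T (hasValue s v t) → ∃ λ i → φ at i ≡ t × κ at i ≡ κ at o × s at i ≡ v
  hasValue⁻ s v t h with i , h′ ← anyFin⁻ {p = λ i → block t i ∧ (inClass i ∧ (s at i ≡ᵇ v))} h
    with a , h″ ← to (T-∧ {block t i}) h′ with b , c ← to (T-∧ {inClass i}) h″ =
    i , ℕ.≡ᵇ⇒≡ _ _ a , ℕ.≡ᵇ⇒≡ _ _ b , ℕ.≡ᵇ⇒≡ _ _ c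

  hasValue⁺ : ∀ s v i → κ at i ≡ κ at o → s at i ≡ v → T (hasValue s v (φ at i))
  hasValue⁺ s v i e e′ = anyFin⁺ {p = λ j → block (φ at i) j ∧ (inClass j ∧ (s at j ≡ᵇ v))} i
    (from (T-∧ {block (φ at i) i}) (ℕ.≡⇒≡ᵇ (φ at i) _ refl , from (T-∧ {inClass i}) (ℕ.≡⇒≡ᵇ _ _ e , ℕ.≡⇒≡ᵇ _ _ e′)))

  attains⁻ : ∀ s v → T (attains s v) → ∃ λ i → T (inClass i ∧ (s at i ≡ᵇ v))
  attains⁻ s v = anyFin⁻

  attains⁺ : ∀ s v i → κ at i ≡ κ at o → s at i ≡ v → T (attains s v)
  attains⁺ s v i e e′ = anyFin⁺ {p = λ j → inClass j ∧ (s at j ≡ᵇ v)} i (from (T-∧ {inClass i}) (ℕ.≡⇒≡ᵇ _ _ e , ℕ.≡⇒≡ᵇ _ _ e′))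

  module Valid (s : Word n) (s<2 : Binary s) (vs : T (validᵇ s)) where

    κs≼φ : meet κ s ≼ φ
    κs≼φ = ≼⁻ (meet κ s) φ vs

    κ-block : ∀ i j → φ at i ≡ φ at j → κ at i ≡ κ at j
    κ-block i j e = proj₁ (meet-≡⁻ κ s i j (≼-≡ κs≼φ i j e))

    s-block : ∀ i j → φ at i ≡ φ at j → s at i ≡ s at j
    s-block i j e = proj₂ (meet-≡⁻ κ s i j (≼-≡ κs≼φ i j e))

    s-mono : ∀ i j → κ at i ≡ κ at j → φ at i ≤ φ at j → s at i ≤ s at j
    s-mono i j e φ≤ with meet-≤⁻ κ s i j (κs≼φ .at-≤ i j φ≤)
    ... | inj₁ κ<       = ⊥-elim (ℕ.<-irrefl e κ<)
    ... | inj₂ (_ , s≤) = s≤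

    -- Validity of `s` already shows that `φ` refines the order of the classes of `κ`, so for
    -- another word only the comparison within each class is left.
    valid-if-mono : ∀ s′ → (∀ i j → κ at i ≡ κ at j → φ at i ≤ φ at j → s′ at i ≤ s′ at j) → T (validᵇ s′)
    valid-if-mono s′ h = ≼⁺ (meet κ s′) φ (monotone mono)
      where
      mono : ∀ i j → φ at i ≤ φ at j → meet κ s′ at i ≤ meet κ s′ at j
      mono i j φ≤ with meet-≤⁻ κ s i j (κs≼φ .at-≤ i j φ≤)
      ... | inj₁ κ<      = meet-≤⁺ κ s′ i j (inj₁ κ<)
      ... | inj₂ (e , _) = meet-≤⁺ κ s′ i j (inj₂ (e , h i j e φ≤))

  -- Among the blocks of a class on which a valid s has a given value, exactly the extremal one can be toggled.
  module _ (s : Word n) (s<2 : Binary s) (vs : T (validᵇ s)) (D : Direction) where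

    open Direction D
    open Valid s s<2 vs

    chain : ∀ s′ → Binary s′ → T (validᵇ s′) → ∀ i j → κ at i ≡ κ at j → φ at i ≲ φ at j → s′ at i ≡ value → s′ at j ≡ value
    chain s′ s′<2 vs′ i j e φ≲ = propagate (s′<2 i) (s′<2 j) φ≲ (Valid.s-mono s′ s′<2 vs′ i j e) (Valid.s-mono s′ s′<2 vs′ j i (sym e))

    count-togglable : countL (λ t → hasValue s value t ∧ validᵇ (toggled t s)) (upTo n) ≡ bit (attains s value)
    count-togglable with attains s value in eq
    ... | false = countL-none (upTo n) (λ t _ h → none t (proj₁ (to (T-∧ {hasValue s value t}) h)))
      where
      none : ∀ t → ¬ T (hasValue s value t)
      none t h with i , _ , e , e′ ← hasValue⁻ s value t h = subst T eq (attains⁺ s value i e e′)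
    ... | true with i₀ , h₀ , extremal ← best {_≲_ = λ a b → b ≲ a} (λ a b → ≲-total b a) (λ p q → ≲-trans q p)
                        (λ i → inClass i ∧ (s at i ≡ᵇ value)) (φ at_) (attains⁻ s value (subst T (sym eq) tt)) =
      countL-one (upTo⁺ n) (∈-upTo⁺ (φ< i₀)) (from (T-∧ {hasValue s value t₀}) (hasValue⁺ s value i₀ κ₀ s₀ , valid-flip)) unique
      where
      t₀ = φ at i₀
      κ₀ : κ at i₀ ≡ κ at o
      κ₀ = ℕ.≡ᵇ⇒≡ _ _ (proj₁ (to (T-∧ {inClass i₀}) h₀))
      s₀ : s at i₀ ≡ value
      s₀ = ℕ.≡ᵇ⇒≡ _ _ (proj₂ (to (T-∧ {inClass i₀}) h₀))
      s′ = toggled t₀ s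
      s′<2 : Binary s′
      s′<2 = flip-<2 (block t₀) s s<2
      extremal′ : ∀ j → κ at j ≡ κ at o → s at j ≡ value → t₀ ≲ φ at j
      extremal′ j e e′ = extremal j (from (T-∧ {inClass j}) (ℕ.≡⇒≡ᵇ _ _ e , ℕ.≡⇒≡ᵇ _ _ e′))
      -- Within the class of `o`, the set where the word has `value` loses exactly its `≲`-least
      -- block `t₀`, so it stays closed; other classes are untouched.
      chain′ : ∀ i j → κ at i ≡ κ at j → φ at i ≲ φ at j → s′ at i ≡ value → s′ at j ≡ value
      chain′ i j e φ≲ s′i with T? (block t₀ i) | T? (block t₀ j)
      ... | yes bi | _ = ⊥-elim (value-flip (trans (cong (1 ∸_) (sym (trans (s-block i i₀ (ℕ.≡ᵇ⇒≡ _ _ bi)) s₀)))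
                                             (trans (sym (flip-in (block t₀) s i bi)) s′i)))
      ... | no ¬bi | no ¬bj = trans (flip-out (block t₀) s j ¬bj)
        (chain s s<2 vs i j e φ≲ (trans (sym (flip-out (block t₀) s i ¬bi)) s′i))
      ... | no ¬bi | yes bj = ⊥-elim (¬bi (ℕ.≡⇒≡ᵇ _ _ (≲-antisym (subst (φ at i ≲_) φj φ≲)
        (extremal′ i (trans e (trans (κ-block j i₀ φj) κ₀)) (trans (sym (flip-out (block t₀) s i ¬bi)) s′i)))))
        where
        φj : φ at j ≡ t₀
        φj = ℕ.≡ᵇ⇒≡ _ _ bj
      valid-flip : T (validᵇ s′)
      valid-flip = valid-if-mono s′ (λ i j e φ≤ → collect (s′<2 i) (s′<2 j) φ≤ (chain′ i j e) (chain′ j i (sym e)))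
      unique : ∀ t → t ∈ upTo n → T (hasValue s value t ∧ validᵇ (toggled t s)) → t ≡ t₀
      unique t _ h with to (T-∧ {hasValue s value t}) h
      ... | hv , vt with i , refl , κi , si ← hasValue⁻ s value t hv with φ at i ℕ.≟ t₀
      ...   | yes e = e
      -- If another block of this value is toggled, `t₀` keeps the value, and validity of the
      -- toggled word would propagate it to the very block that has just lost it.
      ...   | no ne = ⊥-elim (value-flip (trans (cong (1 ∸_) (sym si))
        (trans (sym (flip-in (block t) s i (ℕ.≡⇒≡ᵇ (φ at i) _ refl)))
          (chain (toggled t s) (flip-<2 (block t) s s<2) vt i₀ i (trans κ₀ (sym κi)) (extremal′ i κi si)
            (trans (flip-out (block t) s i₀ (λ b → ne (sym (ℕ.≡ᵇ⇒≡ _ _ b)))) s₀)))))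

  -- The positions of the class with letter `v` are either absent or form a single block of
  -- `meet κ s`.
  count-firsts : ∀ s v → countL (λ i → firstᵇ (meet κ s) i ∧ (inClass i ∧ (s at i ≡ᵇ v))) (allFin n) ≡ bit (attains s v)
  count-firsts s v with attains s v in eq
  ... | false = countL-none (allFin n) (λ i _ h →
    subst T eq (anyFin⁺ {p = λ j → inClass j ∧ (s at j ≡ᵇ v)} i (proj₂ (to (T-∧ {firstᵇ (meet κ s) i}) h))))
  ... | true with j , h ← attains⁻ s v (subst T (sym eq) tt) with i , e , fi ← first-exists (meet κ s) j =
    countL-one (allFin⁺ n) (∈-allFin i) (from (T-∧ {firstᵇ (meet κ s) i}) (fi , transfer)) unique
    where
    κs-i : κ at i ≡ κ at j × s at i ≡ s at j
    κs-i = meet-≡⁻ κ s i j e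
    κj : κ at j ≡ κ at o
    κj = ℕ.≡ᵇ⇒≡ _ _ (proj₁ (to (T-∧ {inClass j}) h))
    sj : s at j ≡ v
    sj = ℕ.≡ᵇ⇒≡ _ _ (proj₂ (to (T-∧ {inClass j}) h))
    transfer : T (inClass i ∧ (s at i ≡ᵇ v))
    transfer = from (T-∧ {inClass i}) (ℕ.≡⇒≡ᵇ _ _ (trans (proj₁ κs-i) κj) , ℕ.≡⇒≡ᵇ _ _ (trans (proj₂ κs-i) sj))
    unique : ∀ k → k ∈ allFin n → T (firstᵇ (meet κ s) k ∧ (inClass k ∧ (s at k ≡ᵇ v))) → k ≡ i
    unique k _ hk with fk , hk′ ← to (T-∧ {firstᵇ (meet κ s) k}) hk with κk , sk ← to (T-∧ {inClass k}) hk′ =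
      first-unique (meet κ s) k i fk fi (meet-≡⁺ κ s k i
        (trans (ℕ.≡ᵇ⇒≡ _ _ κk) (sym (trans (proj₁ κs-i) κj))) (trans (ℕ.≡ᵇ⇒≡ _ _ sk) (sym (trans (proj₂ κs-i) sj))))

  inside : ℕ → Bool
  inside t = anyL (λ i → block t i ∧ inClass i) (allFin n)

  inside⁻ : ∀ t → T (inside t) → ∃ λ i → φ at i ≡ t × κ at i ≡ κ at o
  inside⁻ t h with i , h′ ← anyFin⁻ {p = λ i → block t i ∧ inClass i} h with a , b ← to (T-∧ {block t i}) h′ =
    i , ℕ.≡ᵇ⇒≡ _ _ a , ℕ.≡ᵇ⇒≡ _ _ b

  inside⁺ : ∀ t i → φ at i ≡ t → κ at i ≡ κ at o → T (inside t)
  inside⁺ t i e e′ = anyFin⁺ {p = λ i → block t i ∧ inClass i} i (from (T-∧ {block t i}) (ℕ.≡⇒≡ᵇ _ _ e , ℕ.≡⇒≡ᵇ _ _ e′))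

  classValues : Word n → ℕ
  classValues s = bit (attains s 1) ℕ.+ bit (attains s 0)

  -- The blocks of `meet κ s` outside the class: the part of the length that a toggle inside the
  -- class preserves.
  rest : Word n → ℕ
  rest s = countL (λ i → firstᵇ (meet κ s) i ∧ not (inClass i)) (allFin n)

  binary-cases : ∀ {x} → x < 2 → x ≡ 1 ⊎ x ≡ 0
  binary-cases (s≤s z≤n)       = inj₂ refl
  binary-cases (s≤s (s≤s z≤n)) = inj₁ refl

  class-firsts : ∀ s → Binary s → countL (λ i → firstᵇ (meet κ s) i ∧ inClass i) (allFin n) ≡ classValues s
  class-firsts s s<2 = begin
    countL (λ i → firstᵇ (meet κ s) i ∧ inClass i) (allFin n)
      ≡⟨ countL-cong (allFin n) (λ i _ → T-ext (split i) (join i)) ⟩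
    countL (λ i → at-value 1 i ∨ at-value 0 i) (allFin n)
      ≡⟨ countL-∨ (at-value 1) (at-value 0) (allFin n) (λ i _ h h′ → contradiction (trans (sym (value⁻ 1 i h)) (value⁻ 0 i h′)) λ ()) ⟩
    countL (at-value 1) (allFin n) ℕ.+ countL (at-value 0) (allFin n)
      ≡⟨ cong₂ ℕ._+_ (count-firsts s 1) (count-firsts s 0) ⟩
    classValues s ∎
    where
    open ≡-Reasoning
    at-value : ℕ → Fin n → Bool
    at-value v i = firstᵇ (meet κ s) i ∧ (inClass i ∧ (s at i ≡ᵇ v))
    value⁻ : ∀ v i → T (at-value v i) → s at i ≡ v
    value⁻ v i h = ℕ.≡ᵇ⇒≡ _ _ (proj₂ (to (T-∧ {inClass i}) (proj₂ (to (T-∧ {firstᵇ (meet κ s) i}) h))))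
    split : ∀ i → T (firstᵇ (meet κ s) i ∧ inClass i) → T (at-value 1 i ∨ at-value 0 i)
    split i h with f , c ← to (T-∧ {firstᵇ (meet κ s) i}) h with binary-cases (s<2 i)
    ... | inj₁ e = from (T-∨ {at-value 1 i}) (inj₁ (from (T-∧ {firstᵇ (meet κ s) i}) (f , from (T-∧ {inClass i}) (c , ℕ.≡⇒≡ᵇ _ _ e))))
    ... | inj₂ e = from (T-∨ {at-value 1 i}) (inj₂ (from (T-∧ {firstᵇ (meet κ s) i}) (f , from (T-∧ {inClass i}) (c , ℕ.≡⇒≡ᵇ _ _ e))))
    forget : ∀ v i → T (at-value v i) → T (firstᵇ (meet κ s) i ∧ inClass i)
    forget v i h with f , h′ ← to (T-∧ {firstᵇ (meet κ s) i}) h = from (T-∧ {firstᵇ (meet κ s) i}) (f , proj₁ (to (T-∧ {inClass i}) h′))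
    join : ∀ i → T (at-value 1 i ∨ at-value 0 i) → T (firstᵇ (meet κ s) i ∧ inClass i)
    join i h = [ forget 1 i , forget 0 i ]′ (to (T-∨ {at-value 1 i}) h)

  -- Each letter attained on the class contributes one block, by the two instances of `Direction`;
  -- the counts add because a valid word is constant on each block of `φ`.
  class-toggles : ∀ s → Binary s → T (validᵇ s) → countL (λ t → inside t ∧ validᵇ (toggled t s)) (upTo n) ≡ classValues s
  class-toggles s s<2 vs = begin
    countL (λ t → inside t ∧ validᵇ (toggled t s)) (upTo n)
      ≡⟨ countL-cong (upTo n) (λ t _ → T-ext (split t) (join t)) ⟩
    countL (λ t → at-value 1 t ∨ at-value 0 t) (upTo n)
      ≡⟨ countL-∨ (at-value 1) (at-value 0) (upTo n) (λ t _ → exclusive t) ⟩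
    countL (at-value 1) (upTo n) ℕ.+ countL (at-value 0) (upTo n)
      ≡⟨ cong₂ ℕ._+_ (count-togglable s s<2 vs upward) (count-togglable s s<2 vs downward) ⟩
    classValues s ∎
    where
    open ≡-Reasoning
    open Valid s s<2 vs
    at-value : ℕ → ℕ → Bool
    at-value v t = hasValue s v t ∧ validᵇ (toggled t s)
    exclusive : ∀ t → T (at-value 1 t) → ¬ T (at-value 0 t)
    exclusive t h h′ with hasValue⁻ s 1 t (proj₁ (to (T-∧ {hasValue s 1 t}) h)) | hasValue⁻ s 0 t (proj₁ (to (T-∧ {hasValue s 0 t}) h′))
    ... | i , φi , _ , si | j , φj , _ , sj = contradiction (trans (sym si) (trans (s-block i j (trans φi (sym φj))) sj)) λ ()
    split : ∀ t → T (inside t ∧ validᵇ (toggled t s)) → T (at-value 1 t ∨ at-value 0 t)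
    split t h with k , v ← to (T-∧ {inside t}) h with i , refl , e ← inside⁻ t k with binary-cases (s<2 i)
    ... | inj₁ si = from (T-∨ {at-value 1 t}) (inj₁ (from (T-∧ {hasValue s 1 t}) (hasValue⁺ s 1 i e si , v)))
    ... | inj₂ si = from (T-∨ {at-value 1 t}) (inj₂ (from (T-∧ {hasValue s 0 t}) (hasValue⁺ s 0 i e si , v)))
    forget : ∀ v t → T (at-value v t) → T (inside t ∧ validᵇ (toggled t s))
    forget v t h with k , h′ ← to (T-∧ {hasValue s v t}) h with i , a , b , _ ← hasValue⁻ s v t k =
      from (T-∧ {inside t}) (inside⁺ t i a b , h′)
    join : ∀ t → T (at-value 1 t ∨ at-value 0 t) → T (inside t ∧ validᵇ (toggled t s))
    join t h = [ forget 1 t , forget 0 t ]′ (to (T-∨ {at-value 1 t}) h)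

  len-split : ∀ s → Binary s → len (meet κ s) ≡ rest s ℕ.+ classValues s
  len-split s s<2 = begin
    len (meet κ s)
      ≡⟨ len-firsts (meet-packed κ s) ⟩
    countL (firstᵇ (meet κ s)) (allFin n)
      ≡⟨ countL-cong (allFin n) (λ i _ → dichotomy (firstᵇ (meet κ s) i) (inClass i)) ⟩
    countL (λ i → (firstᵇ (meet κ s) i ∧ not (inClass i)) ∨ (firstᵇ (meet κ s) i ∧ inClass i)) (allFin n)
      ≡⟨ countL-∨ _ _ (allFin n) (λ i _ h h′ → T-not⁻ (proj₂ (to (T-∧ {firstᵇ (meet κ s) i}) h)) (proj₂ (to (T-∧ {firstᵇ (meet κ s) i}) h′))) ⟩
    rest s ℕ.+ countL (λ i → firstᵇ (meet κ s) i ∧ inClass i) (allFin n)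
      ≡⟨ cong (rest s ℕ.+_) (class-firsts s s<2) ⟩
    rest s ℕ.+ classValues s ∎
    where
    open ≡-Reasoning
    dichotomy : ∀ a b → a ≡ (a ∧ not b) ∨ (a ∧ b)
    dichotomy false _     = refl
    dichotomy true  false = refl
    dichotomy true  true  = refl

  -- A class with one value of s contributes 2¹ = 2·1, one with two values 2² = 2·2.
  pow2-len : ∀ s → Binary s → T (validᵇ s) →
    pow2 (len (meet κ s)) ≡ sumℚ (upTo n) (λ t → ι (inside t ∧ validᵇ (toggled t s)) * (2ℚ * pow2 (rest s)))
  pow2-len s s<2 vs = begin
    pow2 (len (meet κ s))                          ≡⟨ cong pow2 (len-split s s<2) ⟩
    pow2 (rest s ℕ.+ classValues s)                ≡⟨ pow2-+ (rest s) (classValues s) ⟩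
    pow2 (rest s) * pow2 (classValues s)           ≡⟨ cong (pow2 (rest s) *_) (pow2-bits (attains s 1) (attains s 0) some-value) ⟩
    pow2 (rest s) * (nat (classValues s) * 2ℚ)     ≡⟨ regroup (pow2 (rest s)) (nat (classValues s)) 2ℚ ⟩
    nat (classValues s) * (2ℚ * pow2 (rest s))     ≡⟨ cong (λ c → nat c * (2ℚ * pow2 (rest s))) (class-toggles s s<2 vs) ⟨
    nat (countL (λ t → inside t ∧ validᵇ (toggled t s)) (upTo n)) * (2ℚ * pow2 (rest s))
                                                   ≡⟨ Σ-count (λ t → inside t ∧ validᵇ (toggled t s)) (upTo n) (2ℚ * pow2 (rest s)) ⟨
    sumℚ (upTo n) (λ t → ι (inside t ∧ validᵇ (toggled t s)) * (2ℚ * pow2 (rest s))) ∎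
    where
    open ≡-Reasoning
    -- The class contains `o`, which excludes the count zero, where 2^k = 2k fails.
    some-value : T (attains s 1 ∨ attains s 0)
    some-value with binary-cases (s<2 o)
    ... | inj₁ e = from (T-∨ {attains s 1}) (inj₁ (attains⁺ s 1 o refl e))
    ... | inj₂ e = from (T-∨ {attains s 1}) (inj₂ (attains⁺ s 0 o refl e))
    regroup : ∀ a b c → a * (b * c) ≡ b * (c * a)
    regroup = solve-∀ ℚ-ring

  first-off-class : ∀ s s′ → (∀ i → κ at i ≢ κ at o → s at i ≡ s′ at i) → ∀ i → κ at i ≢ κ at o →
    T (firstᵇ (meet κ s) i) → T (firstᵇ (meet κ s′) i)
  first-off-class s s′ agree i i∉ f = first⁺ (meet κ s′) i λ j e →
    let κ≡ , s′≡ = meet-≡⁻ κ s′ j i e in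
    first⁻ (meet κ s) i f j (meet-≡⁺ κ s j i κ≡
      (trans (agree j (λ e′ → i∉ (trans (sym κ≡) e′))) (trans s′≡ (sym (agree i i∉)))))

  rest-cong : ∀ s s′ → (∀ i → κ at i ≢ κ at o → s at i ≡ s′ at i) → rest s ≡ rest s′
  rest-cong s s′ agree = countL-cong (allFin n) (λ i _ → T-ext (move s s′ agree i) (move s′ s (λ i i∉ → sym (agree i i∉)) i))
    where
    move : ∀ s s′ → (∀ i → κ at i ≢ κ at o → s at i ≡ s′ at i) → ∀ i →
      T (firstᵇ (meet κ s) i ∧ not (inClass i)) → T (firstᵇ (meet κ s′) i ∧ not (inClass i))
    move s s′ agree i h with f , c ← to (T-∧ {firstᵇ (meet κ s) i}) h =
      from (T-∧ {firstᵇ (meet κ s′) i}) (first-off-class s s′ agree i (λ e → T-not⁻ c (ℕ.≡⇒≡ᵇ _ _ e)) f , c)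

  module _ (odd : ∀ i → blockSize φ (φ at i) % 2 ≡ 1) (B : Fin n → Bool)
           (B-class : ∀ i → κ at i ≡ κ at o → T (B i)) where

    supported : Word n → Bool
    supported s = allL (λ i → B i ∨ (s at i ≡ᵇ 0)) (allFin n)

    supported-flip : ∀ p s → (∀ i → T (p i) → T (B i)) → T (supported s) → T (supported (flip p s))
    supported-flip p s p⊆B h = allFin⁺ᵇ {p = λ i → B i ∨ (flip p s at i ≡ᵇ 0)} go
      where
      go : ∀ i → T (B i ∨ (flip p s at i ≡ᵇ 0))
      go i with T? (p i)
      ... | yes pi = from (T-∨ {B i}) (inj₁ (p⊆B i pi))
      ... | no ¬pi = subst (λ x → T (B i ∨ (x ≡ᵇ 0))) (sym (flip-out p s i ¬pi)) (allFin⁻ {p = λ i → B i ∨ (s at i ≡ᵇ 0)} h i)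

    signed : Word n → ℚ
    signed s = (ι (supported s) * sgn s) * (2ℚ * pow2 (rest s))

    -- Asking for validity of both words makes the indicator invariant under the toggle, so that
    -- only `signed` changes.
    paired : ℕ → Word n → ℚ
    paired t s = ι (validᵇ s ∧ validᵇ (toggled t s)) * signed s

    -- Validity puts the whole block `t` inside the class, hence inside `B`: support and `rest`
    -- survive, and the odd size of the block flips the sign.
    signed-toggled : ∀ t → T (inside t) → ∀ s → Binary s → T (validᵇ s) → signed (toggled t s) ≡ - signed s
    signed-toggled t it s s<2 vs with m , refl , κm ← inside⁻ t it = begin
      (ι (supported s′) * sgn s′) * (2ℚ * pow2 (rest s′))
        ≡⟨ cong₂ (λ a b → (a * sgn s′) * (2ℚ * pow2 b)) (cong ι supported-≡) (sym rest-≡) ⟩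
      (ι (supported s) * sgn s′) * (2ℚ * pow2 (rest s))
        ≡⟨ cong (λ x → (ι (supported s) * x) * (2ℚ * pow2 (rest s)))
             (trans (sgn-flip (block t) s s<2) (cong (_* sgn s) (signℚ-odd (blockSize φ t) (odd m)))) ⟩
      (ι (supported s) * (- 1ℚ * sgn s)) * (2ℚ * pow2 (rest s))
        ≡⟨ negate (ι (supported s)) (sgn s) (2ℚ * pow2 (rest s)) ⟩
      - signed s ∎
      where
      open ≡-Reasoning
      s′ = toggled t s
      negate : ∀ a b c → (a * (- 1ℚ * b)) * c ≡ - ((a * b) * c)
      negate = solve-∀ ℚ-ring
      block-in-class : ∀ i → T (block t i) → κ at i ≡ κ at o
      block-in-class i b = trans (Valid.κ-block s s<2 vs i m (ℕ.≡ᵇ⇒≡ _ _ b)) κm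
      block⊆B : ∀ i → T (block t i) → T (B i)
      block⊆B i b = B-class i (block-in-class i b)
      rest-≡ : rest s ≡ rest s′
      rest-≡ = rest-cong s s′ (λ i i∉ → sym (flip-out (block t) s i (i∉ ∘ block-in-class i)))
      supported-≡ : supported s′ ≡ supported s
      supported-≡ = T-ext (λ h → subst (T ∘ supported) (flip-involutive (block t) s s<2) (supported-flip (block t) s′ block⊆B h))
                          (supported-flip (block t) s block⊆B)

    paired-toggled : ∀ t → T (inside t) → ∀ s → Binary s → paired t (toggled t s) ≡ - 1ℚ * paired t s
    paired-toggled t it s s<2 = begin
      ι (validᵇ s′ ∧ validᵇ (toggled t s′)) * signed s′
        ≡⟨ cong (λ u → ι (validᵇ s′ ∧ validᵇ u) * signed s′) (flip-involutive (block t) s s<2) ⟩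
      ι (validᵇ s′ ∧ validᵇ s) * signed s′
        ≡⟨ ι-*-cong (validᵇ s′ ∧ validᵇ s) (λ h → signed-toggled t it s s<2 (proj₂ (to (T-∧ {validᵇ s′}) h))) ⟩
      ι (validᵇ s′ ∧ validᵇ s) * - signed s
        ≡⟨ cong (_* - signed s) (ι-cong (λ h → from (T-∧ {validᵇ s}) (swap (to (T-∧ {validᵇ s′}) h)))
                                        (λ h → from (T-∧ {validᵇ s′}) (swap (to (T-∧ {validᵇ s}) h)))) ⟩
      ι (validᵇ s ∧ validᵇ s′) * - signed s
        ≡⟨ negate (ι (validᵇ s ∧ validᵇ s′)) (signed s) ⟩
      - 1ℚ * paired t s ∎
      where
      open ≡-Reasoning
      s′ = toggled t s
      negate : ∀ a b → a * - b ≡ - 1ℚ * (a * b)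
      negate = solve-∀ ℚ-ring

    Σ-paired : ∀ t → T (inside t) → sumℚ (words 2 n) (paired t) ≡ 0ℚ
    Σ-paired t it = self-negative _ (begin
      sumℚ (words 2 n) (paired t)                          ≡⟨ Σ-flip (block t) (paired t) ⟨
      sumℚ (words 2 n) (λ s → paired t (toggled t s))      ≡⟨ Σ-cong (words 2 n) (λ s s∈ → paired-toggled t it s (∈-words⁻ 2 s∈)) ⟩
      sumℚ (words 2 n) (λ s → - 1ℚ * paired t s)           ≡⟨ Σ-*ˡ (words 2 n) (- 1ℚ) (paired t) ⟩
      - 1ℚ * sumℚ (words 2 n) (paired t)                   ≡⟨ negate (sumℚ (words 2 n) (paired t)) ⟩
      - sumℚ (words 2 n) (paired t)                        ∎)
      where
      open ≡-Reasoning
      negate : ∀ a → - 1ℚ * a ≡ - a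
      negate = solve-∀ ℚ-ring

    -- `pow2-len` spreads each weight over the blocks that can be toggled; after exchanging the
    -- sums, the contribution of every single block vanishes by `Σ-paired`.
    split-relation : sumℚ (words 2 n) (λ s → (ι (supported s) * sgn s) * (ι (validᵇ s) * pow2 (len (meet κ s)))) ≡ 0ℚ
    split-relation = begin
      sumℚ (words 2 n) (λ s → (ι (supported s) * sgn s) * (ι (validᵇ s) * pow2 (len (meet κ s))))
        ≡⟨ Σ-cong (words 2 n) (λ s s∈ → expand s (∈-words⁻ 2 s∈)) ⟩
      sumℚ (words 2 n) (λ s → sumℚ (upTo n) (λ t → ι (inside t) * paired t s))
        ≡⟨ Σ-swap (words 2 n) (upTo n) (λ s t → ι (inside t) * paired t s) ⟩
      sumℚ (upTo n) (λ t → sumℚ (words 2 n) (λ s → ι (inside t) * paired t s))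
        ≡⟨ Σ-zero (upTo n) (λ t _ → trans (Σ-*ˡ (words 2 n) (ι (inside t)) (paired t)) (ι-*-zero (inside t) (Σ-paired t))) ⟩
      0ℚ ∎
      where
      open ≡-Reasoning
      regroup₁ : ∀ a b c → a * (b * c) ≡ b * (a * c)
      regroup₁ = solve-∀ ℚ-ring
      regroup₂ : ∀ v a x y p → v * (a * ((x * y) * p)) ≡ x * ((v * y) * (a * p))
      regroup₂ = solve-∀ ℚ-ring
      expand : ∀ s → Binary s → (ι (supported s) * sgn s) * (ι (validᵇ s) * pow2 (len (meet κ s)))
                              ≡ sumℚ (upTo n) (λ t → ι (inside t) * paired t s)
      expand s s<2 = begin
        a * (ι (validᵇ s) * pow2 (len (meet κ s)))
          ≡⟨ regroup₁ a (ι (validᵇ s)) _ ⟩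
        ι (validᵇ s) * (a * pow2 (len (meet κ s)))
          ≡⟨ ι-*-cong (validᵇ s) (λ vs → trans (cong (a *_) (pow2-len s s<2 vs)) (sym (Σ-*ˡ (upTo n) a _))) ⟩
        ι (validᵇ s) * sumℚ (upTo n) (λ t → a * (ι (inside t ∧ validᵇ (toggled t s)) * (2ℚ * pow2 (rest s))))
          ≡⟨ Σ-*ˡ (upTo n) (ι (validᵇ s)) _ ⟨
        sumℚ (upTo n) (λ t → ι (validᵇ s) * (a * (ι (inside t ∧ validᵇ (toggled t s)) * (2ℚ * pow2 (rest s)))))
          ≡⟨ Σ-cong (upTo n) (λ t _ → begin
               ι (validᵇ s) * (a * (ι (inside t ∧ validᵇ (toggled t s)) * (2ℚ * pow2 (rest s))))
                 ≡⟨ cong (λ x → ι (validᵇ s) * (a * (x * (2ℚ * pow2 (rest s))))) (ι-∧ (inside t) (validᵇ (toggled t s))) ⟩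
               ι (validᵇ s) * (a * ((ι (inside t) * ι (validᵇ (toggled t s))) * (2ℚ * pow2 (rest s))))
                 ≡⟨ regroup₂ (ι (validᵇ s)) a (ι (inside t)) (ι (validᵇ (toggled t s))) (2ℚ * pow2 (rest s)) ⟩
               ι (inside t) * ((ι (validᵇ s) * ι (validᵇ (toggled t s))) * (a * (2ℚ * pow2 (rest s))))
                 ≡⟨ cong (λ x → ι (inside t) * (x * signed s)) (ι-∧ (validᵇ s) (validᵇ (toggled t s))) ⟨
               ι (inside t) * paired t s ∎) ⟩
        sumℚ (upTo n) (λ t → ι (inside t) * paired t s) ∎
        where a = ι (supported s) * sgn s

-- Odd set compositions

module _ {n : ℕ} where

  at-<-len : ∀ {w : Word n} → Packed w → ∀ i → w at i < len w
  at-<-len {w} pw i = subst (_≤ len w) (countL-< (packed-< pw i)) (countL-mono (upTo n) λ k _ k< →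
    let j , e = packed-≤ pw i k (ℕ.≤-pred (ℕ.<ᵇ⇒< k (suc (w at i)) k<)) in occurs⁺ w j e)

  -- If `k` were missing, packedness would leave only values below `k`, hence at most `k` of them.
  <-len-occurs : ∀ {w : Word n} → Packed w → ∀ k → k < len w → T (occurs k w)
  <-len-occurs {w} pw k k<len with T? (occurs k w)
  ... | yes t = t
  ... | no ¬t = ⊥-elim (ℕ.<⇒≱ k<len (subst (len w ≤_) (countL-< (ℕ.<⇒≤ (ℕ.<-≤-trans k<len (len-≤ w))))
    (countL-mono (upTo n) below)))
    where
    below : ∀ l → l ∈ upTo n → T (occurs l w) → T (l <ᵇ k)
    below l _ t with i , e ← occurs⁻ l w t = ℕ.<⇒<ᵇ (ℕ.≰⇒> λ k≤l →
      let j , e′ = packed-≤ pw i k (subst (k ≤_) (sym e) k≤l) in ¬t (occurs⁺ w j e′))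

  odd⁻ : ∀ {w : Word n} → Packed w → T (oddᵇ w) → ∀ i → blockSize w (w at i) % 2 ≡ 1
  odd⁻ {w} pw t i = ℕ.≡ᵇ⇒≡ _ _ (allL⁻ {p = λ k → (blockSize w k % 2) ≡ᵇ 1} t (∈-upTo⁺ (at-<-len pw i)))

  even-block : ∀ {w : Word n} → Packed w → ¬ T (oddᵇ w) → ∃ λ i → blockSize w (w at i) % 2 ≢ 1
  even-block {w} pw ¬t with Fin.any? (λ i → ¬? (blockSize w (w at i) % 2 ℕ.≟ 1))
  ... | yes e = e
  ... | no ∄ = ⊥-elim (¬t (allL⁺ {p = λ k → (blockSize w k % 2) ≡ᵇ 1} (upTo (len w)) all-odd))
    where
    all-odd : ∀ k → k ∈ upTo (len w) → T ((blockSize w k % 2) ≡ᵇ 1)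
    all-odd k k∈ with j , refl ← occurs⁻ k w (<-len-occurs pw k (∈-upTo⁻ k∈)) with blockSize w k % 2 ℕ.≟ 1
    ... | yes e = ℕ.≡⇒≡ᵇ _ _ e
    ... | no ne = ⊥-elim (∄ (j , ne))

  odd-packed : ∀ {w} → w ∈ OddSC n → Packed w
  odd-packed w∈ = ∈-SC⁻ (proj₁ (∈-filterᵇ⁻ {p = oddᵇ} {xs = SC n} w∈))

  odd-odd : ∀ {w} → w ∈ OddSC n → T (oddᵇ w)
  odd-odd w∈ = proj₂ (∈-filterᵇ⁻ {p = oddᵇ} {xs = SC n} w∈)

  Σ-Odd-δ : ∀ {α} (f : Word n → ℚ) → α ∈ OddSC n → sumℚ (OddSC n) (λ w → ι (wordEqᵇ α w) * f w) ≡ f α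
  Σ-Odd-δ {α} f α∈ = begin
    sumℚ (OddSC n) (λ w → ι (wordEqᵇ α w) * f w)                     ≡⟨ Σ-filter oddᵇ (SC n) (λ w → ι (wordEqᵇ α w) * f w) ⟩
    sumℚ (SC n) (λ w → ι (oddᵇ w) * (ι (wordEqᵇ α w) * f w))         ≡⟨ Σ-cong (SC n) (λ w _ → exchange (ι (oddᵇ w)) (ι (wordEqᵇ α w)) (f w)) ⟩
    sumℚ (SC n) (λ w → ι (wordEqᵇ α w) * (ι (oddᵇ w) * f w))         ≡⟨ Σ-SC-δ α (λ w → ι (oddᵇ w) * f w) ⟩
    ι (packedᵇ α) * (ι (oddᵇ α) * f α)                               ≡⟨ cong₂ (λ a b → a * (b * f α)) (ι-true (packed⁺ α (odd-packed α∈))) (ι-true (odd-odd α∈)) ⟩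
    1ℚ * (1ℚ * f α)                                                  ≡⟨ trans (ℚ.*-identityˡ _) (ℚ.*-identityˡ _) ⟩
    f α                                                              ∎
    where
    open ≡-Reasoning
    exchange : ∀ a b c → a * (b * c) ≡ b * (a * c)
    exchange = solve-∀ ℚ-ring

-- The Möbius function

  -- The recursion passes to strictly shorter words by `len-<`, so the fuel never runs out. This
  -- turns the leftover fuel in the recursive calls back into `μ`.
  μ-fuel-stable : ∀ f g x {y : Word n} → Packed y → len y < f → len y < g → μ-fuel f x y ≡ μ-fuel g x y
  μ-fuel-stable (suc f) (suc g) x {y} py (s≤s y<f) (s≤s y<g) with wordEqᵇ x y | x ≼ᵇ y
  ... | true  | _     = refl
  ... | false | false = refl
  ... | false | true  = cong -_ (Σ-cong _ λ z z∈ →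
    let z∈L , h = ∈-filterᵇ⁻ {p = λ z → (x ≼ᵇ z) ∧ (z ≼ᵇ y) ∧ not (wordEqᵇ z y)} {xs = OddSC n} z∈
        z≼y , z≢y = to (T-∧ {z ≼ᵇ y}) (proj₂ (to (T-∧ {x ≼ᵇ z}) h))
        z<y = len-< (odd-packed z∈L) py (≼⁻ z y z≼y) (T-not⁻ z≢y ∘ ≡⇒wordEqᵇ z y)
    in μ-fuel-stable f g x (odd-packed z∈L) (ℕ.<-≤-trans z<y y<f) (ℕ.<-≤-trans z<y y<g))

  μ-refl : ∀ (x : Word n) → μ x x ≡ 1ℚ
  μ-refl x rewrite T⇒true (≡⇒wordEqᵇ x x refl) = refl

  strictlyBetween : Word n → Word n → Word n → Bool
  strictlyBetween x y z = (x ≼ᵇ z) ∧ (z ≼ᵇ y) ∧ not (wordEqᵇ z y)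

  μ-step : ∀ (x : Word n) {y} → Packed y → x ≼ y → x ≢ y →
    μ x y ≡ - sumℚ (OddSC n) (λ z → ι (strictlyBetween x y z) * μ x z)
  μ-step x {y} py x≼y x≢y
    rewrite ¬T⇒false (x≢y ∘ wordEqᵇ⇒≡ x y) | T⇒true (≼⁺ x y x≼y) =
    cong -_ (trans
      (Σ-filter (strictlyBetween x y) (OddSC n) (λ z → μ-fuel (len y) x z))
      (Σ-cong (OddSC n) λ z z∈L → ι-*-cong (strictlyBetween x y z) λ h →
        let z≼y , z≢y = to (T-∧ {z ≼ᵇ y}) (proj₂ (to (T-∧ {x ≼ᵇ z}) h))
            z<y = len-< (odd-packed z∈L) py (≼⁻ z y z≼y) (T-not⁻ z≢y ∘ ≡⇒wordEqᵇ z y)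
        in μ-fuel-stable (len y) (suc (len z)) x (odd-packed z∈L) z<y ℕ.≤-refl))

  -- Splits off the top element of a closed interval: `a` and `b` are the two bounds, `c` is
  -- equality with the top.
  ι-split : ∀ a b c q → (T c → T a × T b) → ι a * (ι b * q) ≡ ι (a ∧ b ∧ not c) * q + ι c * q
  ι-split true  true  true  q _ = identity q
    where
    identity : ∀ q → 1ℚ * (1ℚ * q) ≡ 0ℚ * q + 1ℚ * q
    identity = solve-∀ ℚ-ring
  ι-split true  true  false q _ = identity q
    where
    identity : ∀ q → 1ℚ * (1ℚ * q) ≡ 1ℚ * q + 0ℚ * q
    identity = solve-∀ ℚ-ring
  ι-split true  false false q _ = identity q
    where
    identity : ∀ q → 1ℚ * (0ℚ * q) ≡ 0ℚ * q + 0ℚ * q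
    identity = solve-∀ ℚ-ring
  ι-split false b     false q _ = identity (ι b) q
    where
    identity : ∀ b q → 0ℚ * (b * q) ≡ 0ℚ * q + 0ℚ * q
    identity = solve-∀ ℚ-ring
  ι-split true  false true  q h = ⊥-elim (proj₂ (h tt))
  ι-split false b     true  q h = ⊥-elim (proj₁ (h tt))

  Σ-μ-lower : ∀ {x y} → x ∈ OddSC n → y ∈ OddSC n →
    sumℚ (OddSC n) (λ z → ι (x ≼ᵇ z) * (ι (z ≼ᵇ y) * μ x z)) ≡ ι (wordEqᵇ x y)
  Σ-μ-lower {x} {y} x∈ y∈ with T? (wordEqᵇ x y) | T? (x ≼ᵇ y)
  ... | no x≢y | no ¬x≼y = trans
    (Σ-zero (OddSC n) (λ z _ → ι-*-zero (x ≼ᵇ z) λ x≼z → ι-*-zero (z ≼ᵇ y) λ z≼y →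
      ⊥-elim (¬x≼y (≼⁺ x y (≼-trans (≼⁻ x z x≼z) (≼⁻ z y z≼y))))))
    (sym (ι-false x≢y))
  ... | yes x≡y | _ with refl ← wordEqᵇ⇒≡ x y x≡y = begin
    sumℚ (OddSC n) (λ z → ι (x ≼ᵇ z) * (ι (z ≼ᵇ x) * μ x z))
      ≡⟨ Σ-cong (OddSC n) (λ z z∈ → trans (sym (ℚ.*-assoc (ι (x ≼ᵇ z)) (ι (z ≼ᵇ x)) (μ x z)))
           (cong (_* μ x z) (trans (sym (ι-∧ (x ≼ᵇ z) (z ≼ᵇ x))) (ι-cong (equal z z∈) (below z))))) ⟩
    sumℚ (OddSC n) (λ z → ι (wordEqᵇ x z) * μ x z)
      ≡⟨ Σ-Odd-δ (μ x) x∈ ⟩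
    μ x x
      ≡⟨ μ-refl x ⟩
    1ℚ
      ≡⟨ ι-true x≡y ⟨
    ι (wordEqᵇ x x) ∎
    where
    open ≡-Reasoning
    equal : ∀ z → z ∈ OddSC n → T ((x ≼ᵇ z) ∧ (z ≼ᵇ x)) → T (wordEqᵇ x z)
    equal z z∈ h = let a , b = to (T-∧ {x ≼ᵇ z}) h in
      ≡⇒wordEqᵇ x z (≼-antisym (odd-packed x∈) (odd-packed z∈) (≼⁻ x z a) (≼⁻ z x b))
    below : ∀ z → T (wordEqᵇ x z) → T ((x ≼ᵇ z) ∧ (z ≼ᵇ x))
    below z e with refl ← wordEqᵇ⇒≡ x z e = from (T-∧ {x ≼ᵇ x}) (≼⁺ x x ≼-refl , ≼⁺ x x ≼-refl)
  ... | no x≢y | yes x≼y = begin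
    sumℚ (OddSC n) (λ z → ι (x ≼ᵇ z) * (ι (z ≼ᵇ y) * μ x z))
      ≡⟨ Σ-cong (OddSC n) (λ z _ → split z) ⟩
    sumℚ (OddSC n) (λ z → ι (strictlyBetween x y z) * μ x z + ι (wordEqᵇ y z) * μ x z)
      ≡⟨ Σ-+ (OddSC n) (λ z → ι (strictlyBetween x y z) * μ x z) (λ z → ι (wordEqᵇ y z) * μ x z) ⟩
    sumℚ (OddSC n) (λ z → ι (strictlyBetween x y z) * μ x z) + sumℚ (OddSC n) (λ z → ι (wordEqᵇ y z) * μ x z)
      ≡⟨ cong (S +_) (trans (Σ-Odd-δ (μ x) y∈) (μ-step x (odd-packed y∈) (≼⁻ x y x≼y) (x≢y ∘ ≡⇒wordEqᵇ x y))) ⟩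
    S + - S
      ≡⟨ ℚ.+-inverseʳ S ⟩
    0ℚ
      ≡⟨ ι-false x≢y ⟨
    ι (wordEqᵇ x y) ∎
    where
    open ≡-Reasoning
    S = sumℚ (OddSC n) (λ z → ι (strictlyBetween x y z) * μ x z)
    split : ∀ z → ι (x ≼ᵇ z) * (ι (z ≼ᵇ y) * μ x z) ≡ ι (strictlyBetween x y z) * μ x z + ι (wordEqᵇ y z) * μ x z
    split z = trans
      (ι-split (x ≼ᵇ z) (z ≼ᵇ y) (wordEqᵇ z y) (μ x z) (λ e → subst (λ w → T (x ≼ᵇ w)) (sym (wordEqᵇ⇒≡ z y e)) x≼y
                                                       , subst (λ w → T (z ≼ᵇ w)) (wordEqᵇ⇒≡ z y e) (≼⁺ z z ≼-refl)))
      (cong (λ e → ι (strictlyBetween x y z) * μ x z + e * μ x z)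
        (ι-cong (≡⇒wordEqᵇ y z ∘ sym ∘ wordEqᵇ⇒≡ z y) (≡⇒wordEqᵇ z y ∘ sym ∘ wordEqᵇ⇒≡ y z)))

  Σ-μ : Word n → Word n → ℚ
  Σ-μ x y = sumℚ (OddSC n) (λ z → ι (x ≼ᵇ z) * (ι (z ≼ᵇ y) * μ z y))

  -- A left inverse of a unitriangular matrix is a right inverse: N = Σ-μ satisfies
  -- Σ_z μ(x,z) N(z,y) = μ(x,y) = Σ_z μ(x,z) δ(z,y), and N = δ follows by downward induction on x.
  Σ-μ-upper : ∀ d {x y} → x ∈ OddSC n → y ∈ OddSC n → n < len x ℕ.+ d → Σ-μ x y ≡ ι (wordEqᵇ x y)
  Σ-μ-upper zero {x} _ _ n<  = ⊥-elim (ℕ.<⇒≱ n< (ℕ.≤-trans (ℕ.≤-reflexive (ℕ.+-identityʳ (len x))) (len-≤ x)))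
  Σ-μ-upper (suc d) {x} {y} x∈ y∈ n< = begin
    Σ-μ x y                                           ≡⟨ cancel (Σ-μ x y) (ι (wordEqᵇ x y)) ⟩
    Σ-μ x y - ι (wordEqᵇ x y) + ι (wordEqᵇ x y)       ≡⟨ cong (_+ ι (wordEqᵇ x y)) vanishes ⟩
    0ℚ + ι (wordEqᵇ x y)                              ≡⟨ ℚ.+-identityˡ _ ⟩
    ι (wordEqᵇ x y)                                   ∎
    where
    open ≡-Reasoning
    cancel : ∀ a b → a ≡ a - b + b
    cancel = solve-∀ ℚ-ring
    L = OddSC n
    defect : Word n → ℚ
    defect z = Σ-μ z y - ι (wordEqᵇ z y)
    regroup₁ : ∀ a m b c e → (a * m) * (b * (c * e)) ≡ (c * e) * (a * (b * m))
    regroup₁ = solve-∀ ℚ-ring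
    regroup₂ : ∀ a b c → (a * b) * c ≡ c * (a * b)
    regroup₂ = solve-∀ ℚ-ring
    regroup₃ : ∀ a b c e → a * (b * (c - e)) ≡ (a * b) * c + - 1ℚ * ((a * b) * e)
    regroup₃ = solve-∀ ℚ-ring
    convolution : sumℚ L (λ z → (ι (x ≼ᵇ z) * μ x z) * Σ-μ z y) ≡ ι (x ≼ᵇ y) * μ x y
    convolution = begin
      sumℚ L (λ z → (ι (x ≼ᵇ z) * μ x z) * Σ-μ z y)
        ≡⟨ Σ-cong L (λ z _ → sym (Σ-*ˡ L (ι (x ≼ᵇ z) * μ x z) (λ t → ι (z ≼ᵇ t) * (ι (t ≼ᵇ y) * μ t y)))) ⟩
      sumℚ L (λ z → sumℚ L (λ t → (ι (x ≼ᵇ z) * μ x z) * (ι (z ≼ᵇ t) * (ι (t ≼ᵇ y) * μ t y))))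
        ≡⟨ Σ-swap L L (λ z t → (ι (x ≼ᵇ z) * μ x z) * (ι (z ≼ᵇ t) * (ι (t ≼ᵇ y) * μ t y))) ⟩
      sumℚ L (λ t → sumℚ L (λ z → (ι (x ≼ᵇ z) * μ x z) * (ι (z ≼ᵇ t) * (ι (t ≼ᵇ y) * μ t y))))
        ≡⟨ Σ-cong L (λ t t∈ → trans
             (Σ-cong L (λ z _ → regroup₁ (ι (x ≼ᵇ z)) (μ x z) (ι (z ≼ᵇ t)) (ι (t ≼ᵇ y)) (μ t y)))
             (trans (Σ-*ˡ L (ι (t ≼ᵇ y) * μ t y) (λ z → ι (x ≼ᵇ z) * (ι (z ≼ᵇ t) * μ x z)))
             (trans (cong ((ι (t ≼ᵇ y) * μ t y) *_) (Σ-μ-lower x∈ t∈)) (regroup₂ (ι (t ≼ᵇ y)) (μ t y) (ι (wordEqᵇ x t)))))) ⟩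
      sumℚ L (λ t → ι (wordEqᵇ x t) * (ι (t ≼ᵇ y) * μ t y))
        ≡⟨ Σ-Odd-δ (λ t → ι (t ≼ᵇ y) * μ t y) x∈ ⟩
      ι (x ≼ᵇ y) * μ x y ∎
    convolution-δ : sumℚ L (λ z → (ι (x ≼ᵇ z) * μ x z) * ι (wordEqᵇ z y)) ≡ ι (x ≼ᵇ y) * μ x y
    convolution-δ = trans
      (Σ-cong L (λ z _ → trans (ℚ.*-comm (ι (x ≼ᵇ z) * μ x z) (ι (wordEqᵇ z y))) (cong (_* (ι (x ≼ᵇ z) * μ x z))
        (ι-cong (≡⇒wordEqᵇ y z ∘ sym ∘ wordEqᵇ⇒≡ z y) (≡⇒wordEqᵇ z y ∘ sym ∘ wordEqᵇ⇒≡ y z)))))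
      (Σ-Odd-δ (λ z → ι (x ≼ᵇ z) * μ x z) y∈)
    total : sumℚ L (λ z → ι (x ≼ᵇ z) * (μ x z * defect z)) ≡ 0ℚ
    total = begin
      sumℚ L (λ z → ι (x ≼ᵇ z) * (μ x z * defect z))
        ≡⟨ Σ-cong L (λ z _ → regroup₃ (ι (x ≼ᵇ z)) (μ x z) (Σ-μ z y) (ι (wordEqᵇ z y))) ⟩
      sumℚ L (λ z → (ι (x ≼ᵇ z) * μ x z) * Σ-μ z y + - 1ℚ * ((ι (x ≼ᵇ z) * μ x z) * ι (wordEqᵇ z y)))
        ≡⟨ Σ-+ L (λ z → (ι (x ≼ᵇ z) * μ x z) * Σ-μ z y) (λ z → - 1ℚ * ((ι (x ≼ᵇ z) * μ x z) * ι (wordEqᵇ z y))) ⟩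
      sumℚ L (λ z → (ι (x ≼ᵇ z) * μ x z) * Σ-μ z y) + sumℚ L (λ z → - 1ℚ * ((ι (x ≼ᵇ z) * μ x z) * ι (wordEqᵇ z y)))
        ≡⟨ cong₂ _+_ convolution (trans (Σ-*ˡ L (- 1ℚ) (λ z → (ι (x ≼ᵇ z) * μ x z) * ι (wordEqᵇ z y))) (cong (- 1ℚ *_) convolution-δ)) ⟩
      ι (x ≼ᵇ y) * μ x y + - 1ℚ * (ι (x ≼ᵇ y) * μ x y)
        ≡⟨ cancel′ (ι (x ≼ᵇ y) * μ x y) ⟩
      0ℚ ∎
      where
      cancel′ : ∀ a → a + - 1ℚ * a ≡ 0ℚ
      cancel′ = solve-∀ ℚ-ring
    -- A word strictly above `x` is longer, so its defect is zero by induction; only `z` = `x`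
    -- remains, with μ(x,x) = 1.
    localised : ∀ z → z ∈ L → ι (x ≼ᵇ z) * (μ x z * defect z) ≡ ι (wordEqᵇ x z) * defect z
    localised z z∈ with T? (wordEqᵇ x z)
    ... | yes e with refl ← wordEqᵇ⇒≡ x z e = cong₂ _*_
      (trans (ι-true (≼⁺ x x ≼-refl)) (sym (ι-true e)))
      (trans (cong (_* defect x) (μ-refl x)) (ℚ.*-identityˡ (defect x)))
    ... | no ne = trans
      (ι-*-zero (x ≼ᵇ z) (λ x≼z → trans (cong (μ x z *_) (above (≼⁻ x z x≼z))) (ℚ.*-zeroʳ (μ x z))))
      (sym (trans (cong (_* defect z) (ι-false ne)) (ℚ.*-zeroˡ (defect z))))
      where
      above : x ≼ z → defect z ≡ 0ℚ
      above x≼z = trans (cong (_- ι (wordEqᵇ z y)) (Σ-μ-upper d z∈ y∈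
        (ℕ.<-≤-trans n< (ℕ.≤-trans (ℕ.≤-reflexive (ℕ.+-suc (len x) d))
          (ℕ.+-monoˡ-≤ d (len-< (odd-packed x∈) (odd-packed z∈) x≼z (ne ∘ ≡⇒wordEqᵇ x z))))))) (ℚ.+-inverseʳ (ι (wordEqᵇ z y)))
    vanishes : defect x ≡ 0ℚ
    vanishes = trans (sym (trans (Σ-cong L localised) (Σ-Odd-δ defect x∈))) total

  coefficient : (Word n → ℚ) → Word n → ℚ
  coefficient h χ = sumℚ (OddSC n) (λ ζ → ι (χ ≼ᵇ ζ) * (μ χ ζ * h ζ))

  -- Here the lower argument of `μ` is summed, whereas the defining recursion sums over the upper
  -- one; hence the detour through `Σ-μ-upper`.
  möbius-inversion : ∀ (h : Word n → ℚ) {β} → β ∈ OddSC n →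
    sumℚ (OddSC n) (λ χ → ι (β ≼ᵇ χ) * coefficient h χ) ≡ h β
  möbius-inversion h {β} β∈ = begin
    sumℚ L (λ χ → ι (β ≼ᵇ χ) * coefficient h χ)
      ≡⟨ Σ-cong L (λ χ _ → sym (Σ-*ˡ L (ι (β ≼ᵇ χ)) (λ ζ → ι (χ ≼ᵇ ζ) * (μ χ ζ * h ζ)))) ⟩
    sumℚ L (λ χ → sumℚ L (λ ζ → ι (β ≼ᵇ χ) * (ι (χ ≼ᵇ ζ) * (μ χ ζ * h ζ))))
      ≡⟨ Σ-swap L L (λ χ ζ → ι (β ≼ᵇ χ) * (ι (χ ≼ᵇ ζ) * (μ χ ζ * h ζ))) ⟩
    sumℚ L (λ ζ → sumℚ L (λ χ → ι (β ≼ᵇ χ) * (ι (χ ≼ᵇ ζ) * (μ χ ζ * h ζ))))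
      ≡⟨ Σ-cong L (λ ζ ζ∈ → trans (Σ-cong L (λ χ _ → regroup (ι (β ≼ᵇ χ)) (ι (χ ≼ᵇ ζ)) (μ χ ζ) (h ζ)))
           (trans (Σ-*ʳ L (h ζ) (λ χ → ι (β ≼ᵇ χ) * (ι (χ ≼ᵇ ζ) * μ χ ζ))) (cong (_* h ζ) (Σ-μ-upper (suc n) β∈ ζ∈ (ℕ.m≤n+m (suc n) (len β)))))) ⟩
    sumℚ L (λ ζ → ι (wordEqᵇ β ζ) * h ζ)
      ≡⟨ Σ-Odd-δ h β∈ ⟩
    h β ∎
    where
    open ≡-Reasoning
    L = OddSC n
    regroup : ∀ a b c e → a * (b * (c * e)) ≡ (a * (b * c)) * e
    regroup = solve-∀ ℚ-ring

-- The peak-type coefficients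

module _ {n : ℕ} where

  -- The coefficient of 𝐌_ρ in 𝛈_φ without its sign.
  peak : Word n → Word n → ℚ
  peak φ ρ = ι (ρ ≼ᵇ φ) * pow2 (len ρ)

  module _ (β : Word n) (pβ : Packed β) (o : Fin n) where

    private
      B : Fin n → Bool
      B i = β at i ≡ᵇ β at o

      supportedᴮ : Word n → Bool
      supportedᴮ s = allL (λ i → B i ∨ (s at i ≡ᵇ 0)) (allFin n)

      zeros ones : Word n
      zeros = tabulate (λ _ → 0)
      ones  = flip B zeros

      zeros-at : ∀ i → zeros at i ≡ 0
      zeros-at = lookup∘tabulate (λ _ → 0)

      zeros<2 : ∀ i → zeros at i < 2
      zeros<2 i = subst (_< 2) (sym (zeros-at i)) (s≤s z≤n)

      sgn-zeros : ∀ m → sgn {m} (tabulate (λ _ → 0)) ≡ 1ℚ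
      sgn-zeros zero    = refl
      sgn-zeros (suc m) = sgn-zeros m

      o∈B : T (B o)
      o∈B = ℕ.≡⇒≡ᵇ (β at o) _ refl

      ones-in : ∀ i → T (B i) → ones at i ≡ 1
      ones-in i b = trans (flip-in B zeros i b) (cong (1 ∸_) (zeros-at i))

      ones-out : ∀ i → ¬ T (B i) → ones at i ≡ 0
      ones-out i ¬b = trans (flip-out B zeros i ¬b) (zeros-at i)

      supported-zeros : T (supportedᴮ zeros)
      supported-zeros = allFin⁺ᵇ {p = λ i → B i ∨ (zeros at i ≡ᵇ 0)} (λ i → from (T-∨ {B i}) (inj₂ (ℕ.≡⇒≡ᵇ _ _ (zeros-at i))))

      supported-ones : T (supportedᴮ ones)
      supported-ones = allFin⁺ᵇ {p = λ i → B i ∨ (ones at i ≡ᵇ 0)} go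
        where
        go : ∀ i → T (B i ∨ (ones at i ≡ᵇ 0))
        go i with T? (B i)
        ... | yes b = from (T-∨ {B i}) (inj₁ b)
        ... | no ¬b = from (T-∨ {B i}) (inj₂ (ℕ.≡⇒≡ᵇ _ _ (ones-out i ¬b)))

      meet-zeros : meet β zeros ≡ β
      meet-zeros = meet-absorb pβ (λ i j _ → trans (zeros-at i) (sym (zeros-at j)))

      meet-ones : meet β ones ≡ β
      meet-ones = meet-absorb pβ constant
        where
        constant : ∀ i j → β at i ≡ β at j → ones at i ≡ ones at j
        constant i j e with T? (B i)
        ... | yes b = trans (ones-in i b) (sym (ones-in j (ℕ.≡⇒≡ᵇ _ _ (trans (sym e) (ℕ.≡ᵇ⇒≡ _ _ b)))))
        ... | no ¬b = trans (ones-out i ¬b) (sym (ones-out j (λ b → ¬b (ℕ.≡⇒≡ᵇ _ _ (trans e (ℕ.≡ᵇ⇒≡ _ _ b))))))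

      -- A word that does not split `β` is constant on the block and zero off it, so its letter at
      -- `o` decides.
      unsplit : ∀ s → (∀ i → s at i < 2) → T (supportedᴮ s) → meet β s ≡ β → s ≡ zeros ⊎ s ≡ ones
      unsplit s s<2 sup e = go (s at o) refl (s<2 o)
        where
        on-B : ∀ i → T (B i) → s at i ≡ s at o
        on-B i b = proj₂ (meet-≡⁻ β s i o (trans (cong (_at i) e) (trans (ℕ.≡ᵇ⇒≡ _ _ b) (sym (cong (_at o) e)))))
        off-B : ∀ i → ¬ T (B i) → s at i ≡ 0
        off-B i ¬b with to (T-∨ {B i}) (allFin⁻ {p = λ i → B i ∨ (s at i ≡ᵇ 0)} sup i)
        ... | inj₁ b = ⊥-elim (¬b b)
        ... | inj₂ z = ℕ.≡ᵇ⇒≡ _ _ z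
        go : ∀ x → s at o ≡ x → x < 2 → s ≡ zeros ⊎ s ≡ ones
        go 0 so _ = inj₁ (word-ext λ i → trans (zero-at i) (sym (zeros-at i)))
          where
          zero-at : ∀ i → s at i ≡ 0
          zero-at i with T? (B i)
          ... | yes b = trans (on-B i b) so
          ... | no ¬b = off-B i ¬b
        go 1 so _ = inj₂ (word-ext one-at)
          where
          one-at : ∀ i → s at i ≡ ones at i
          one-at i with T? (B i)
          ... | yes b = trans (trans (on-B i b) so) (sym (ones-in i b))
          ... | no ¬b = trans (off-B i ¬b) (sym (ones-out i ¬b))
        go (suc (suc _)) _ (s≤s (s≤s ()))

    relation-functional : (Word n → ℚ) → ℚ
    relation-functional F = sumℚ (words 2 n) (λ s → (ι (supportedᴮ s) * sgn s) * F (meet β s))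

    -- Only the two trivial splittings keep the length, and they have equal signs when the block is even.
    even-relation : ∀ F → blockSize β (β at o) % 2 ≢ 1 → (∀ β′ → Packed β′ → len β < len β′ → F β′ ≡ 0ℚ) →
      relation-functional F ≡ 0ℚ → F β ≡ 0ℚ
    even-relation F even vanish rel = self-negative (F β) (begin
      F β                       ≡⟨ shift (F β) ⟩
      (F β + F β) + - F β       ≡⟨ cong (_+ - F β) (trans (sym double) rel) ⟩
      0ℚ + - F β                ≡⟨ ℚ.+-identityˡ _ ⟩
      - F β                     ∎)
      where
      open ≡-Reasoning
      shift : ∀ a → a ≡ (a + a) + - a
      shift = solve-∀ ℚ-ring
      weight : Word n → ℚ
      weight s = (ι (supportedᴮ s) * sgn s) * F (meet β s)
      sgn-ones : sgn ones ≡ 1ℚ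
      sgn-ones = trans (sgn-flip B zeros zeros<2) (cong₂ _*_ (signℚ-even (blockSize β (β at o)) even) (sgn-zeros n))
      unit : ∀ s → T (supportedᴮ s) → sgn s ≡ 1ℚ → meet β s ≡ β → weight s ≡ F β
      unit s sup sg e = trans (cong₂ _*_ (cong₂ _*_ (ι-true sup) sg) (cong F e)) (ℚ.*-identityˡ (F β))
      pick : ∀ s → (∀ i → s at i < 2) → weight s ≡ ι (wordEqᵇ zeros s) * F β + ι (wordEqᵇ ones s) * F β
      pick s s<2 with T? (wordEqᵇ zeros s) | T? (wordEqᵇ ones s)
      ... | yes z | yes u = contradiction
        (trans (sym (zeros-at o)) (trans (cong (_at o) (trans (wordEqᵇ⇒≡ zeros s z) (sym (wordEqᵇ⇒≡ ones s u)))) (ones-in o o∈B))) λ ()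
      ... | yes z | no ¬u with refl ← wordEqᵇ⇒≡ zeros s z rewrite T⇒true z | ¬T⇒false ¬u =
        trans (unit zeros supported-zeros (sgn-zeros n) meet-zeros) (left (F β))
        where
        left : ∀ a → a ≡ 1ℚ * a + 0ℚ * a
        left = solve-∀ ℚ-ring
      ... | no ¬z | yes u with refl ← wordEqᵇ⇒≡ ones s u rewrite T⇒true u | ¬T⇒false ¬z =
        trans (unit ones supported-ones sgn-ones meet-ones) (right (F β))
        where
        right : ∀ a → a ≡ 0ℚ * a + 1ℚ * a
        right = solve-∀ ℚ-ring
      ... | no ¬z | no ¬u rewrite ¬T⇒false ¬u | ¬T⇒false ¬z = trans
        (trans (ℚ.*-assoc (ι (supportedᴮ s)) (sgn s) (F (meet β s)))
          (ι-*-zero (supportedᴮ s) (λ sup → trans (cong (sgn s *_) (vanish (meet β s) (meet-packed β s) (longer sup))) (ℚ.*-zeroʳ (sgn s)))))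
        (neither (F β))
        where
        neither : ∀ a → 0ℚ ≡ 0ℚ * a + 0ℚ * a
        neither = solve-∀ ℚ-ring
        longer : T (supportedᴮ s) → len β < len (meet β s)
        longer sup = len-< pβ (meet-packed β s) (≼-meet β s) λ e →
          [ (λ z → ¬z (≡⇒wordEqᵇ zeros s (sym z))) , (λ u → ¬u (≡⇒wordEqᵇ ones s (sym u))) ]′ (unsplit s s<2 sup (sym e))
      double : relation-functional F ≡ F β + F β
      double = begin
        sumℚ (words 2 n) weight
          ≡⟨ Σ-cong (words 2 n) (λ s s∈ → pick s (∈-words⁻ 2 s∈)) ⟩
        sumℚ (words 2 n) (λ s → ι (wordEqᵇ zeros s) * F β + ι (wordEqᵇ ones s) * F β)
          ≡⟨ Σ-+ (words 2 n) (λ s → ι (wordEqᵇ zeros s) * F β) (λ s → ι (wordEqᵇ ones s) * F β) ⟩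
        sumℚ (words 2 n) (λ s → ι (wordEqᵇ zeros s) * F β) + sumℚ (words 2 n) (λ s → ι (wordEqᵇ ones s) * F β)
          ≡⟨ cong₂ _+_ (Σ-words-δ 2 zeros (λ _ → F β) zeros<2) (Σ-words-δ 2 ones (λ _ → F β) (flip-<2 B zeros zeros<2)) ⟩
        F β + F β ∎

    -- Associativity moves the splitting outside, and `split-relation` applies with κ = α∧β: the
    -- block of `o` in α∧β lies in its block in β.
    peak-relation : ∀ {φ} → φ ∈ OddSC n → ∀ α → relation-functional (λ ρ → peak φ (meet α ρ)) ≡ 0ℚ
    peak-relation {φ} φ∈ α = trans
      (Σ-cong (words 2 n) (λ s _ → cong (λ ρ → (ι (supportedᴮ s) * sgn s) * peak φ ρ) (meet-assoc α β s)))
      (split-relation (meet α β) φ (packed-< (odd-packed φ∈)) o (odd⁻ (odd-packed φ∈) (odd-odd φ∈)) B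
        (λ i e → ℕ.≡⇒≡ᵇ _ _ (proj₂ (meet-≡⁻ α β i o e))))

    peak-relation′ : ∀ {χ} → χ ∈ OddSC n → relation-functional (peak χ) ≡ 0ℚ
    peak-relation′ {χ} χ∈ = split-relation β χ (packed-< (odd-packed χ∈)) o (odd⁻ (odd-packed χ∈) (odd-odd χ∈)) B
      (λ i e → ℕ.≡⇒≡ᵇ _ _ e)

  pow2-cancel : ∀ a b → pow2 b * two^[ a - b ] ≡ pow2 a
  pow2-cancel a b = begin
    pow2 b * (pow2 a * powℚ ½ b)   ≡⟨ regroup (pow2 b) (pow2 a) (powℚ ½ b) ⟩
    pow2 a * (pow2 b * powℚ ½ b)   ≡⟨ cong (pow2 a *_) (inverse b) ⟩
    pow2 a * 1ℚ                    ≡⟨ ℚ.*-identityʳ _ ⟩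
    pow2 a                         ∎
    where
    open ≡-Reasoning
    regroup : ∀ a b c → a * (b * c) ≡ b * (a * c)
    regroup = solve-∀ ℚ-ring
    interchange : ∀ a b c d → (a * b) * (c * d) ≡ (a * c) * (b * d)
    interchange = solve-∀ ℚ-ring
    inverse : ∀ m → pow2 m * powℚ ½ m ≡ 1ℚ
    inverse zero    = refl
    inverse (suc m) = trans (interchange 2ℚ (pow2 m) ½ (powℚ ½ m)) (trans (cong (2ℚ * ½ *_) (inverse m)) refl)

  -- This is `peak φ (meet α ζ)` divided by 2^ℓ(ζ), the function whose Möbius transform gives the
  -- coefficients C up to sign.
  scaledPeak : Word n → Word n → Word n → ℚ
  scaledPeak φ α ζ = ι (meet α ζ ≼ᵇ φ) * two^[ len (meet α ζ) - len ζ ]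

  expansion : Word n → Word n → Word n → ℚ
  expansion φ α β = sumℚ (OddSC n) (λ χ → coefficient (scaledPeak φ α) χ * peak χ β)

  -- The factor 2^ℓ(β) is common to all χ ≥ β; what remains is Möbius inversion of `scaledPeak`.
  peak-expansion-odd : ∀ φ α {β} → β ∈ OddSC n → peak φ (meet α β) ≡ expansion φ α β
  peak-expansion-odd φ α {β} β∈ = sym (begin
    sumℚ (OddSC n) (λ χ → c χ * (ι (β ≼ᵇ χ) * pow2 (len β)))    ≡⟨ Σ-cong (OddSC n) (λ χ _ → regroup (c χ) (ι (β ≼ᵇ χ)) (pow2 (len β))) ⟩
    sumℚ (OddSC n) (λ χ → pow2 (len β) * (ι (β ≼ᵇ χ) * c χ))    ≡⟨ Σ-*ˡ (OddSC n) (pow2 (len β)) (λ χ → ι (β ≼ᵇ χ) * c χ) ⟩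
    pow2 (len β) * sumℚ (OddSC n) (λ χ → ι (β ≼ᵇ χ) * c χ)      ≡⟨ cong (pow2 (len β) *_) (möbius-inversion (scaledPeak φ α) β∈) ⟩
    pow2 (len β) * (ι (meet α β ≼ᵇ φ) * two^[ len (meet α β) - len β ])
                                                                ≡⟨ regroup′ (pow2 (len β)) (ι (meet α β ≼ᵇ φ)) two^[ len (meet α β) - len β ] ⟩
    ι (meet α β ≼ᵇ φ) * (pow2 (len β) * two^[ len (meet α β) - len β ])
                                                                ≡⟨ cong (ι (meet α β ≼ᵇ φ) *_) (pow2-cancel (len (meet α β)) (len β)) ⟩
    peak φ (meet α β)                                           ∎)
    where
    open ≡-Reasoning
    c = coefficient (scaledPeak φ α)
    regroup : ∀ a b c → a * (b * c) ≡ c * (b * a)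
    regroup = solve-∀ ℚ-ring
    regroup′ : ∀ a b c → a * (b * c) ≡ b * (a * c)
    regroup′ = solve-∀ ℚ-ring

  -- The relation is linear, and each `peak χ` with χ odd satisfies it.
  expansion-relation : ∀ φ α β (pβ : Packed β) o → relation-functional β pβ o (expansion φ α) ≡ 0ℚ
  expansion-relation φ α β pβ o = begin
    sumℚ (words 2 n) (λ s → w s * sumℚ (OddSC n) (λ χ → c χ * peak χ (meet β s)))
      ≡⟨ Σ-cong (words 2 n) (λ s _ → trans (sym (Σ-*ˡ (OddSC n) (w s) (λ χ → c χ * peak χ (meet β s)))) (Σ-cong (OddSC n) (λ χ _ → exchange (w s) (c χ) (peak χ (meet β s))))) ⟩
    sumℚ (words 2 n) (λ s → sumℚ (OddSC n) (λ χ → c χ * (w s * peak χ (meet β s))))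
      ≡⟨ Σ-swap (words 2 n) (OddSC n) (λ s χ → c χ * (w s * peak χ (meet β s))) ⟩
    sumℚ (OddSC n) (λ χ → sumℚ (words 2 n) (λ s → c χ * (w s * peak χ (meet β s))))
      ≡⟨ Σ-zero (OddSC n) (λ χ χ∈ → trans (Σ-*ˡ (words 2 n) (c χ) (λ s → w s * peak χ (meet β s)))
           (trans (cong (c χ *_) (peak-relation′ β pβ o χ∈)) (ℚ.*-zeroʳ (c χ)))) ⟩
    0ℚ ∎
    where
    open ≡-Reasoning
    c = coefficient (scaledPeak φ α)
    w : Word n → ℚ
    w s = ι (allL (λ i → (β at i ≡ᵇ β at o) ∨ (s at i ≡ᵇ 0)) (allFin n)) * sgn s
    exchange : ∀ a b c → a * (b * c) ≡ b * (a * c)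
    exchange = solve-∀ ℚ-ring

  module _ {φ : Word n} (φ∈ : φ ∈ OddSC n) (α : Word n) where

    -- Lengths are at most `n`, so `d` makes the downward induction on length structural. The
    -- relation is applied to the difference of the two sides, which vanishes on longer
    -- compositions.
    defect-zero : ∀ d β → Packed β → n < len β ℕ.+ d → peak φ (meet α β) - expansion φ α β ≡ 0ℚ
    defect-zero zero β _ n< = ⊥-elim (ℕ.<⇒≱ n< (ℕ.≤-trans (ℕ.≤-reflexive (ℕ.+-identityʳ (len β))) (len-≤ β)))
    defect-zero (suc d) β pβ n< with T? (oddᵇ β)
    ... | yes oβ = trans (cong (_- expansion φ α β) (peak-expansion-odd φ α (∈-filterᵇ⁺ {p = oddᵇ} (∈-SC⁺ pβ) oβ)))
                         (ℚ.+-inverseʳ (expansion φ α β))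
    ... | no ¬oβ with o , even ← even-block pβ ¬oβ = even-relation β pβ o (λ ρ → peak φ (meet α ρ) - expansion φ α ρ) even
      (λ β′ pβ′ longer → defect-zero d β′ pβ′ (ℕ.<-≤-trans n< (ℕ.≤-trans (ℕ.≤-reflexive (ℕ.+-suc (len β) d)) (ℕ.+-monoˡ-≤ d longer))))
      (begin
        sumℚ (words 2 n) (λ s → w s * (peak φ (meet α (meet β s)) - expansion φ α (meet β s)))
          ≡⟨ Σ-cong (words 2 n) (λ s _ → distribute (w s) (peak φ (meet α (meet β s))) (expansion φ α (meet β s))) ⟩
        sumℚ (words 2 n) (λ s → w s * peak φ (meet α (meet β s)) + - 1ℚ * (w s * expansion φ α (meet β s)))
          ≡⟨ Σ-+ (words 2 n) (λ s → w s * peak φ (meet α (meet β s))) (λ s → - 1ℚ * (w s * expansion φ α (meet β s))) ⟩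
        sumℚ (words 2 n) (λ s → w s * peak φ (meet α (meet β s))) + sumℚ (words 2 n) (λ s → - 1ℚ * (w s * expansion φ α (meet β s)))
          ≡⟨ cong₂ _+_ (peak-relation β pβ o φ∈ α)
               (trans (Σ-*ˡ (words 2 n) (- 1ℚ) (λ s → w s * expansion φ α (meet β s))) (cong (- 1ℚ *_) (expansion-relation φ α β pβ o))) ⟩
        0ℚ + - 1ℚ * 0ℚ
          ≡⟨⟩
        0ℚ ∎)
      where
      open ≡-Reasoning
      w : Word n → ℚ
      w s = ι (allL (λ i → (β at i ≡ᵇ β at o) ∨ (s at i ≡ᵇ 0)) (allFin n)) * sgn s
      distribute : ∀ a b c → a * (b - c) ≡ a * b + - 1ℚ * (a * c)
      distribute = solve-∀ ℚ-ring

    peak-expansion : ∀ {β} → Packed β → peak φ (meet α β) ≡ expansion φ α β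
    peak-expansion {β} pβ = begin
      peak φ (meet α β)                                               ≡⟨ restore (peak φ (meet α β)) (expansion φ α β) ⟩
      peak φ (meet α β) - expansion φ α β + expansion φ α β           ≡⟨ cong (_+ expansion φ α β) (defect-zero (suc n) β pβ (ℕ.m≤n+m (suc n) (len β))) ⟩
      0ℚ + expansion φ α β                                            ≡⟨ ℚ.+-identityˡ _ ⟩
      expansion φ α β                                                 ∎
      where
      open ≡-Reasoning
      restore : ∀ a b → a ≡ a - b + b
      restore = solve-∀ ℚ-ring

-- The internal coproduct

signℚ-+ : ∀ a b → signℚ (a ℕ.+ b) ≡ signℚ a * signℚ b
signℚ-+ zero    b = sym (ℚ.*-identityˡ (signℚ b))
signℚ-+ (suc a) b = trans (cong -_ (signℚ-+ a b)) (ℚ.neg-distribˡ-* (signℚ a) (signℚ b))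

signℚ-square : ∀ a → signℚ a * signℚ a ≡ 1ℚ
signℚ-square zero    = refl
signℚ-square (suc a) = trans (neg-square (signℚ a)) (signℚ-square a)
  where
  neg-square : ∀ x → - x * - x ≡ x * x
  neg-square = solve-∀ ℚ-ring

module _ {n : ℕ} where

  Δ∘𝐌-coefficient : ∀ (ρ α β : Word n) → Δ∘𝐌 ρ α β ≡ (ι (packedᵇ α) * ι (packedᵇ β)) * ι (wordEqᵇ (meet α β) ρ)
  Δ∘𝐌-coefficient ρ α β = begin
    sumℚ (SC n) (λ ψ → sumℚ (SC n) (λ ϑ → if wordEqᵇ (meet ψ ϑ) ρ then 𝐌 ψ α * 𝐌 ϑ β else 0ℚ))
      ≡⟨ Σ-cong (SC n) (λ ψ _ → begin
           sumℚ (SC n) (λ ϑ → if wordEqᵇ (meet ψ ϑ) ρ then 𝐌 ψ α * 𝐌 ϑ β else 0ℚ)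
             ≡⟨ Σ-cong (SC n) (λ ϑ _ → trans (if-ι (wordEqᵇ (meet ψ ϑ) ρ) _) (regroup (ι (wordEqᵇ (meet ψ ϑ) ρ)) (𝐌 ψ α) (𝐌 ϑ β))) ⟩
           sumℚ (SC n) (λ ϑ → 𝐌 ψ α * (ι (wordEqᵇ β ϑ) * ι (wordEqᵇ (meet ψ ϑ) ρ)))
             ≡⟨ Σ-*ˡ (SC n) (𝐌 ψ α) (λ ϑ → ι (wordEqᵇ β ϑ) * ι (wordEqᵇ (meet ψ ϑ) ρ)) ⟩
           𝐌 ψ α * sumℚ (SC n) (λ ϑ → ι (wordEqᵇ β ϑ) * ι (wordEqᵇ (meet ψ ϑ) ρ))
             ≡⟨ cong (𝐌 ψ α *_) (Σ-SC-δ β (λ ϑ → ι (wordEqᵇ (meet ψ ϑ) ρ))) ⟩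
           ι (wordEqᵇ α ψ) * (ι (packedᵇ β) * ι (wordEqᵇ (meet ψ β) ρ)) ∎) ⟩
    sumℚ (SC n) (λ ψ → ι (wordEqᵇ α ψ) * (ι (packedᵇ β) * ι (wordEqᵇ (meet ψ β) ρ)))
      ≡⟨ Σ-SC-δ α (λ ψ → ι (packedᵇ β) * ι (wordEqᵇ (meet ψ β) ρ)) ⟩
    ι (packedᵇ α) * (ι (packedᵇ β) * ι (wordEqᵇ (meet α β) ρ))
      ≡⟨ ℚ.*-assoc (ι (packedᵇ α)) (ι (packedᵇ β)) (ι (wordEqᵇ (meet α β) ρ)) ⟨
    (ι (packedᵇ α) * ι (packedᵇ β)) * ι (wordEqᵇ (meet α β) ρ) ∎
    where
    open ≡-Reasoning
    regroup : ∀ a b c → a * (b * c) ≡ b * (c * a)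
    regroup = solve-∀ ℚ-ring

  -- The coproduct is dual to the meet: the only 𝐌_ρ producing 𝐌_α ⊗ 𝐌_β is ρ = α∧β.
  Δ∘-coefficient : ∀ (x : NCQ n) α β → Δ∘ x α β ≡ (ι (packedᵇ α) * ι (packedᵇ β)) * x (meet α β)
  Δ∘-coefficient x α β = begin
    sumℚ (SC n) (λ ρ → x ρ * Δ∘𝐌 ρ α β)
      ≡⟨ Σ-cong (SC n) (λ ρ _ → trans (cong (x ρ *_) (Δ∘𝐌-coefficient ρ α β)) (regroup (x ρ) p (ι (wordEqᵇ (meet α β) ρ)))) ⟩
    sumℚ (SC n) (λ ρ → p * (ι (wordEqᵇ (meet α β) ρ) * x ρ))
      ≡⟨ Σ-*ˡ (SC n) p (λ ρ → ι (wordEqᵇ (meet α β) ρ) * x ρ) ⟩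
    p * sumℚ (SC n) (λ ρ → ι (wordEqᵇ (meet α β) ρ) * x ρ)
      ≡⟨ cong (p *_) (Σ-SC-δ (meet α β) x) ⟩
    p * (ι (packedᵇ (meet α β)) * x (meet α β))
      ≡⟨ cong (p *_) (trans (cong (_* x (meet α β)) (ι-true (packed⁺ (meet α β) (meet-packed α β)))) (ℚ.*-identityˡ _)) ⟩
    p * x (meet α β) ∎
    where
    open ≡-Reasoning
    p = ι (packedᵇ α) * ι (packedᵇ β)
    regroup : ∀ a b c → a * (b * c) ≡ b * (c * a)
    regroup = solve-∀ ℚ-ring

  𝛈-coefficient : ∀ (φ α : Word n) → 𝛈 φ α ≡ signℚ (pp φ) * (ι (packedᵇ α) * peak φ α)
  𝛈-coefficient φ α = cong (signℚ (pp φ) *_) (begin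
    sumℚ (filterᵇ (_≼ᵇ φ) (SC n)) (λ ψ → pow2 (len ψ) * 𝐌 ψ α)
      ≡⟨ Σ-filter (_≼ᵇ φ) (SC n) (λ ψ → pow2 (len ψ) * 𝐌 ψ α) ⟩
    sumℚ (SC n) (λ ψ → ι (ψ ≼ᵇ φ) * (pow2 (len ψ) * ι (wordEqᵇ α ψ)))
      ≡⟨ Σ-cong (SC n) (λ ψ _ → regroup (ι (ψ ≼ᵇ φ)) (pow2 (len ψ)) (ι (wordEqᵇ α ψ))) ⟩
    sumℚ (SC n) (λ ψ → ι (wordEqᵇ α ψ) * peak φ ψ)
      ≡⟨ Σ-SC-δ α (peak φ) ⟩
    ι (packedᵇ α) * peak φ α ∎)
    where
    open ≡-Reasoning
    regroup : ∀ a b c → a * (b * c) ≡ c * (a * b)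
    regroup = solve-∀ ℚ-ring

  -- The right tensor factors

  rightFactor : Word n → Word n → NCQ n
  rightFactor φ ψ = lincomb (filterᵇ (belowCᵇ φ ψ) (OddSC n)) (λ χ → Ccoef χ φ ψ) 𝛈

  rightFactor-Σ : ∀ φ ψ β → rightFactor φ ψ β ≡ sumℚ (OddSC n) (λ χ → (ι (belowCᵇ φ ψ χ) * Ccoef χ φ ψ) * 𝛈 χ β)
  rightFactor-Σ φ ψ β = trans
    (Σ-filter (belowCᵇ φ ψ) (OddSC n) (λ χ → Ccoef χ φ ψ * 𝛈 χ β))
    (Σ-cong (OddSC n) (λ χ _ → sym (ℚ.*-assoc (ι (belowCᵇ φ ψ χ)) (Ccoef χ φ ψ) (𝛈 χ β))))

  module _ {φ : Word n} (φ∈ : φ ∈ OddSC n) (α : Word n) where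

    below-≡ : ∀ ζ → belowCᵇ φ α ζ ≡ (meet α ζ ≼ᵇ φ)
    below-≡ ζ = T-ext (≼⁺ (meet α ζ) φ ∘ belowC⁻ φ α ζ) (belowC⁺ (odd-packed φ∈) ∘ ≼⁻ (meet α ζ) φ)

    Ccoef-coefficient : ∀ χ → Ccoef χ φ α ≡ signℚ (pp χ ℕ.+ pp φ) * coefficient (scaledPeak φ α) χ
    Ccoef-coefficient χ = cong (signℚ (pp χ ℕ.+ pp φ) *_) (trans
      (Σ-filter (λ ζ → (χ ≼ᵇ ζ) ∧ belowCᵇ φ α ζ) (OddSC n) (λ ζ → μ χ ζ * two^[ len (meet α ζ) - len ζ ]))
      (Σ-cong (OddSC n) (λ ζ _ → begin
        ι ((χ ≼ᵇ ζ) ∧ belowCᵇ φ α ζ) * (μ χ ζ * two^[ len (meet α ζ) - len ζ ])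
          ≡⟨ cong (_* (μ χ ζ * two^[ len (meet α ζ) - len ζ ])) (trans (ι-∧ (χ ≼ᵇ ζ) (belowCᵇ φ α ζ)) (cong (λ b → ι (χ ≼ᵇ ζ) * ι b) (below-≡ ζ))) ⟩
        (ι (χ ≼ᵇ ζ) * ι (meet α ζ ≼ᵇ φ)) * (μ χ ζ * two^[ len (meet α ζ) - len ζ ])
          ≡⟨ regroup (ι (χ ≼ᵇ ζ)) (ι (meet α ζ ≼ᵇ φ)) (μ χ ζ) two^[ len (meet α ζ) - len ζ ] ⟩
        ι (χ ≼ᵇ ζ) * (μ χ ζ * scaledPeak φ α ζ) ∎)))
      where
      open ≡-Reasoning
      regroup : ∀ a b c d → (a * b) * (c * d) ≡ a * (c * (b * d))
      regroup = solve-∀ ℚ-ring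

    -- The words below 𝒞 form a down-set: if χ is not among them, no ζ ≥ χ is, and every summand of
    -- the coefficient vanishes.
    below-coefficient : ∀ χ → ι (belowCᵇ φ α χ) * coefficient (scaledPeak φ α) χ ≡ coefficient (scaledPeak φ α) χ
    below-coefficient χ with T? (belowCᵇ φ α χ)
    ... | yes t = trans (cong (_* coefficient (scaledPeak φ α) χ) (ι-true t)) (ℚ.*-identityˡ _)
    ... | no ¬t = trans (cong (_* coefficient (scaledPeak φ α) χ) (ι-false ¬t)) (trans (ℚ.*-zeroˡ (coefficient (scaledPeak φ α) χ))
      (sym (Σ-zero (OddSC n) (λ ζ _ → ι-*-zero (χ ≼ᵇ ζ) (λ χ≼ζ → trans (cong (μ χ ζ *_) (vanish ζ (≼⁻ χ ζ χ≼ζ))) (ℚ.*-zeroʳ (μ χ ζ)))))))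
      where
      vanish : ∀ ζ → χ ≼ ζ → scaledPeak φ α ζ ≡ 0ℚ
      vanish ζ χ≼ζ = ι-*-zero (meet α ζ ≼ᵇ φ) λ t → ⊥-elim (¬t (belowC⁺ (odd-packed φ∈) (≼-trans (meet-monoʳ α χ≼ζ) (≼⁻ (meet α ζ) φ t))))

    rightFactor-expansion : ∀ β → rightFactor φ α β ≡ (ι (packedᵇ β) * signℚ (pp φ)) * expansion φ α β
    rightFactor-expansion β = begin
      rightFactor φ α β
        ≡⟨ rightFactor-Σ φ α β ⟩
      sumℚ (OddSC n) (λ χ → (ι (belowCᵇ φ α χ) * Ccoef χ φ α) * 𝛈 χ β)
        ≡⟨ Σ-cong (OddSC n) (λ χ _ → term χ) ⟩
      sumℚ (OddSC n) (λ χ → (ι (packedᵇ β) * signℚ (pp φ)) * (c χ * peak χ β))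
        ≡⟨ Σ-*ˡ (OddSC n) (ι (packedᵇ β) * signℚ (pp φ)) (λ χ → c χ * peak χ β) ⟩
      (ι (packedᵇ β) * signℚ (pp φ)) * expansion φ α β ∎
      where
      open ≡-Reasoning
      c = coefficient (scaledPeak φ α)
      -- The sign of p(χ) occurs both in C and in 𝛈_χ; its square is 1 and only the sign of p(φ)
      -- survives.
      regroup : ∀ b x y c p k → (b * ((x * y) * c)) * (x * (p * k)) ≡ (x * x) * ((p * y) * ((b * c) * k))
      regroup = solve-∀ ℚ-ring
      term : ∀ χ → (ι (belowCᵇ φ α χ) * Ccoef χ φ α) * 𝛈 χ β ≡ (ι (packedᵇ β) * signℚ (pp φ)) * (c χ * peak χ β)
      term χ = begin
        (ι (belowCᵇ φ α χ) * Ccoef χ φ α) * 𝛈 χ β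
          ≡⟨ cong₂ (λ a b → (ι (belowCᵇ φ α χ) * a) * b)
               (trans (Ccoef-coefficient χ) (cong (_* c χ) (signℚ-+ (pp χ) (pp φ)))) (𝛈-coefficient χ β) ⟩
        (ι (belowCᵇ φ α χ) * ((signℚ (pp χ) * signℚ (pp φ)) * c χ)) * (signℚ (pp χ) * (ι (packedᵇ β) * peak χ β))
          ≡⟨ regroup (ι (belowCᵇ φ α χ)) (signℚ (pp χ)) (signℚ (pp φ)) (c χ) (ι (packedᵇ β)) (peak χ β) ⟩
        (signℚ (pp χ) * signℚ (pp χ)) * ((ι (packedᵇ β) * signℚ (pp φ)) * ((ι (belowCᵇ φ α χ) * c χ) * peak χ β))
          ≡⟨ cong₂ (λ a b → a * ((ι (packedᵇ β) * signℚ (pp φ)) * (b * peak χ β))) (signℚ-square (pp χ)) (below-coefficient χ) ⟩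
        1ℚ * ((ι (packedᵇ β) * signℚ (pp φ)) * (c χ * peak χ β))
          ≡⟨ ℚ.*-identityˡ _ ⟩
        (ι (packedᵇ β) * signℚ (pp φ)) * (c χ * peak χ β) ∎

    -- α ≤ α∧β ≤ φ whenever the peak coefficient is nonzero; this is the source of the restriction ψ
    -- ≤ φ.
    peak-meet-below : ∀ β → ι (α ≼ᵇ φ) * peak φ (meet α β) ≡ peak φ (meet α β)
    peak-meet-below β = begin
      ι (α ≼ᵇ φ) * (ι (meet α β ≼ᵇ φ) * pow2 (len (meet α β)))   ≡⟨ ℚ.*-assoc (ι (α ≼ᵇ φ)) (ι (meet α β ≼ᵇ φ)) _ ⟨
      (ι (α ≼ᵇ φ) * ι (meet α β ≼ᵇ φ)) * pow2 (len (meet α β))   ≡⟨ cong (_* pow2 (len (meet α β))) (ι-∧ (α ≼ᵇ φ) (meet α β ≼ᵇ φ)) ⟨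
      ι ((α ≼ᵇ φ) ∧ (meet α β ≼ᵇ φ)) * pow2 (len (meet α β))     ≡⟨ cong (_* pow2 (len (meet α β))) (ι-cong (λ t → proj₂ (to (T-∧ {α ≼ᵇ φ}) t))
           (λ t → from (T-∧ {α ≼ᵇ φ}) (≼⁺ α φ (≼-trans (≼-meet α β) (≼⁻ (meet α β) φ t)) , t))) ⟩
      peak φ (meet α β)                                          ∎
      where open ≡-Reasoning

    Δ∘𝛈 : ∀ β → Δ∘ (𝛈 φ) α β ≡ ι (packedᵇ α) * (ι (α ≼ᵇ φ) * rightFactor φ α β)
    Δ∘𝛈 β = begin
      Δ∘ (𝛈 φ) α β
        ≡⟨ Δ∘-coefficient (𝛈 φ) α β ⟩
      (ι (packedᵇ α) * ι (packedᵇ β)) * 𝛈 φ (meet α β)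
        ≡⟨ cong ((ι (packedᵇ α) * ι (packedᵇ β)) *_) (𝛈-coefficient φ (meet α β)) ⟩
      (ι (packedᵇ α) * ι (packedᵇ β)) * (s * (ι (packedᵇ (meet α β)) * peak φ (meet α β)))
        ≡⟨ cong₂ (λ a b → (ι (packedᵇ α) * ι (packedᵇ β)) * (s * (a * b))) (ι-true (packed⁺ (meet α β) (meet-packed α β))) (sym (peak-meet-below β)) ⟩
      (ι (packedᵇ α) * ι (packedᵇ β)) * (s * (1ℚ * (ι (α ≼ᵇ φ) * peak φ (meet α β))))
        ≡⟨ regroup₁ (ι (packedᵇ α)) (ι (packedᵇ β)) s (ι (α ≼ᵇ φ)) (peak φ (meet α β)) ⟩
      ι (packedᵇ β) * (((ι (packedᵇ α) * s) * ι (α ≼ᵇ φ)) * peak φ (meet α β))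
        -- The expansion is known for packed β only; the indicator in front supplies that
        -- hypothesis.
        ≡⟨ ι-*-cong (packedᵇ β) (λ t → cong (((ι (packedᵇ α) * s) * ι (α ≼ᵇ φ)) *_) (peak-expansion φ∈ α (packed⁻ β t))) ⟩
      ι (packedᵇ β) * (((ι (packedᵇ α) * s) * ι (α ≼ᵇ φ)) * expansion φ α β)
        ≡⟨ regroup₂ (ι (packedᵇ α)) (ι (packedᵇ β)) s (ι (α ≼ᵇ φ)) (expansion φ α β) ⟩
      ι (packedᵇ α) * (ι (α ≼ᵇ φ) * ((ι (packedᵇ β) * s) * expansion φ α β))
        ≡⟨ cong (λ x → ι (packedᵇ α) * (ι (α ≼ᵇ φ) * x)) (rightFactor-expansion β) ⟨
      ι (packedᵇ α) * (ι (α ≼ᵇ φ) * rightFactor φ α β) ∎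
      where
      open ≡-Reasoning
      s = signℚ (pp φ)
      regroup₁ : ∀ a b s c x → (a * b) * (s * (1ℚ * (c * x))) ≡ b * (((a * s) * c) * x)
      regroup₁ = solve-∀ ℚ-ring
      regroup₂ : ∀ a b s c x → b * (((a * s) * c) * x) ≡ a * (c * ((b * s) * x))
      regroup₂ = solve-∀ ℚ-ring

  Δ∘𝛈-expansion : ∀ {φ} → φ ∈ OddSC n → ∀ α β →
    Δ∘ (𝛈 φ) α β ≡ sumℚ (filterᵇ (λ ψ → ψ ≼ᵇ φ) (SC n)) (λ ψ → (𝐌 ψ ⊗ rightFactor φ ψ) α β)
  Δ∘𝛈-expansion {φ} φ∈ α β = sym (begin
    sumℚ (filterᵇ (_≼ᵇ φ) (SC n)) (λ ψ → 𝐌 ψ α * rightFactor φ ψ β)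
      ≡⟨ Σ-filter (_≼ᵇ φ) (SC n) (λ ψ → 𝐌 ψ α * rightFactor φ ψ β) ⟩
    sumℚ (SC n) (λ ψ → ι (ψ ≼ᵇ φ) * (ι (wordEqᵇ α ψ) * rightFactor φ ψ β))
      ≡⟨ Σ-cong (SC n) (λ ψ _ → exchange (ι (ψ ≼ᵇ φ)) (ι (wordEqᵇ α ψ)) (rightFactor φ ψ β)) ⟩
    sumℚ (SC n) (λ ψ → ι (wordEqᵇ α ψ) * (ι (ψ ≼ᵇ φ) * rightFactor φ ψ β))
      ≡⟨ Σ-SC-δ α (λ ψ → ι (ψ ≼ᵇ φ) * rightFactor φ ψ β) ⟩
    ι (packedᵇ α) * (ι (α ≼ᵇ φ) * rightFactor φ α β)
      ≡⟨ Δ∘𝛈 φ∈ α β ⟨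
    Δ∘ (𝛈 φ) α β ∎)
    where
    open ≡-Reasoning
    exchange : ∀ a b c → a * (b * c) ≡ b * (a * c)
    exchange = solve-∀ ℚ-ring

  -- Linearity: Δ° sees `x` only through the values x(α∧β), where its expansion in the 𝛈_φ can be
  -- inserted.
  co-ideal : ∀ (x : NCQ n) → InNCΠ x → InNCQ⊗NCΠ (Δ∘ x)
  co-ideal x (c , x≡) = w , w∈NCΠ , Δx≡
    where
    open ≡-Reasoning
    L = OddSC n
    w : Word n → NCQ n
    -- Collects the right factors attached to 𝐌_γ in the expansions of all Δ°(𝛈_φ) with γ ≤ φ.
    w γ β = sumℚ L (λ φ → c φ * (ι (γ ≼ᵇ φ) * rightFactor φ γ β))
    w∈NCΠ : ∀ γ → InNCΠ (w γ)
    w∈NCΠ γ = (λ χ → sumℚ L (λ φ → e φ χ)) , λ β → begin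
      sumℚ L (λ φ → c φ * (ι (γ ≼ᵇ φ) * rightFactor φ γ β))
        ≡⟨ Σ-cong L (λ φ _ → expand φ β) ⟩
      sumℚ L (λ φ → sumℚ L (λ χ → e φ χ * 𝛈 χ β))
        ≡⟨ Σ-swap L L (λ φ χ → e φ χ * 𝛈 χ β) ⟩
      sumℚ L (λ χ → sumℚ L (λ φ → e φ χ * 𝛈 χ β))
        ≡⟨ Σ-cong L (λ χ _ → Σ-*ʳ L (𝛈 χ β) (λ φ → e φ χ)) ⟩
      sumℚ L (λ χ → sumℚ L (λ φ → e φ χ) * 𝛈 χ β) ∎
      where
      e : Word n → Word n → ℚ
      e φ χ = (c φ * ι (γ ≼ᵇ φ)) * (ι (belowCᵇ φ γ χ) * Ccoef χ φ γ)
      expand : ∀ φ β → c φ * (ι (γ ≼ᵇ φ) * rightFactor φ γ β) ≡ sumℚ L (λ χ → e φ χ * 𝛈 χ β)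
      expand φ β = begin
        c φ * (ι (γ ≼ᵇ φ) * rightFactor φ γ β)
          ≡⟨ ℚ.*-assoc (c φ) (ι (γ ≼ᵇ φ)) (rightFactor φ γ β) ⟨
        (c φ * ι (γ ≼ᵇ φ)) * rightFactor φ γ β
          ≡⟨ cong ((c φ * ι (γ ≼ᵇ φ)) *_) (rightFactor-Σ φ γ β) ⟩
        (c φ * ι (γ ≼ᵇ φ)) * sumℚ L (λ χ → (ι (belowCᵇ φ γ χ) * Ccoef χ φ γ) * 𝛈 χ β)
          ≡⟨ Σ-*ˡ L (c φ * ι (γ ≼ᵇ φ)) (λ χ → (ι (belowCᵇ φ γ χ) * Ccoef χ φ γ) * 𝛈 χ β) ⟨
        sumℚ L (λ χ → (c φ * ι (γ ≼ᵇ φ)) * ((ι (belowCᵇ φ γ χ) * Ccoef χ φ γ) * 𝛈 χ β))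
          ≡⟨ Σ-cong L (λ χ _ → sym (ℚ.*-assoc (c φ * ι (γ ≼ᵇ φ)) (ι (belowCᵇ φ γ χ) * Ccoef χ φ γ) (𝛈 χ β))) ⟩
        sumℚ L (λ χ → e φ χ * 𝛈 χ β) ∎
    exchange : ∀ a b c → a * (b * c) ≡ b * (a * c)
    exchange = solve-∀ ℚ-ring
    Δx≡ : ∀ α β → Δ∘ x α β ≡ sumℚ (SC n) (λ γ → (𝐌 γ ⊗ w γ) α β)
    Δx≡ α β = begin
      Δ∘ x α β
        ≡⟨ trans (Δ∘-coefficient x α β) (cong (p *_) (x≡ (meet α β))) ⟩
      p * sumℚ L (λ φ → c φ * 𝛈 φ (meet α β))
        ≡⟨ Σ-*ˡ L p (λ φ → c φ * 𝛈 φ (meet α β)) ⟨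
      sumℚ L (λ φ → p * (c φ * 𝛈 φ (meet α β)))
        ≡⟨ Σ-cong L (λ φ φ∈ → begin
             p * (c φ * 𝛈 φ (meet α β))                                           ≡⟨ exchange p (c φ) (𝛈 φ (meet α β)) ⟩
             c φ * (p * 𝛈 φ (meet α β))                                           ≡⟨ cong (c φ *_) (trans (sym (Δ∘-coefficient (𝛈 φ) α β)) (Δ∘𝛈 φ∈ α β)) ⟩
             c φ * (ι (packedᵇ α) * (ι (α ≼ᵇ φ) * rightFactor φ α β))             ≡⟨ exchange (c φ) (ι (packedᵇ α)) _ ⟩
             ι (packedᵇ α) * (c φ * (ι (α ≼ᵇ φ) * rightFactor φ α β))             ∎) ⟩
      sumℚ L (λ φ → ι (packedᵇ α) * (c φ * (ι (α ≼ᵇ φ) * rightFactor φ α β)))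
        ≡⟨ Σ-*ˡ L (ι (packedᵇ α)) (λ φ → c φ * (ι (α ≼ᵇ φ) * rightFactor φ α β)) ⟩
      ι (packedᵇ α) * w α β
        ≡⟨ Σ-SC-δ α (λ γ → w γ β) ⟨
      sumℚ (SC n) (λ γ → ι (wordEqᵇ α γ) * w γ β) ∎
      where p = ι (packedᵇ α) * ι (packedᵇ β)

theorem12p1 : ((n : ℕ) (φ : Word n) → T (packedᵇ φ) → T (oddᵇ φ) →
    (α β : Word n) →
    Δ∘ (𝛈 φ) α β ≡
    sumℚ (filterᵇ (λ ψ → ψ ≼ᵇ φ) (SC n)) (λ ψ →
    (𝐌 ψ ⊗ lincomb (filterᵇ (belowCᵇ φ ψ) (OddSC n))
    (λ χ → Ccoef χ φ ψ) 𝛈) α β))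
    × ((n : ℕ) (x : NCQ n) → InNCΠ x → InNCQ⊗NCΠ (Δ∘ x))
theorem12p1 =
  (λ n φ p o α β → Δ∘𝛈-expansion (∈-filterᵇ⁺ {p = oddᵇ} (∈-SC⁺ (packed⁻ φ p)) o) α β) ,
  (λ n → co-ideal)
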